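{- Let $G$ be a finite simple connected vertex-transitive non-bipartite graph of degree $k$ (i.e. $k$-regular) and of even order $|V(G)|\ge 6$. Then $G$ is $4$-factor-critical if and only if $k\ge 5$.
   Context: A graph $G$ is vertex-transitive if for any two vertices $x,y$ there is an automorphism $\varphi$ of $G$ with $\varphi(x)=y$. A perfect matching is a set of pairwise nonadjacent edges covering all vertices (the graph with no vertices is regarded as having a perfect matching). A graph of order $n$ is $p$-factor-critical, where $p$ is an integer of the same parity as $n$, if the removal of any set of $p$ vertices results in a graph with a perfect matching. -}

module Defs where

open import Data.Bool.Base using (Bool)
open import Data.Fin.Base using (Fin)
open import Data.Fin.Permutation using (Permutation′; _⟨$⟩ʳ_)
open import Data.Fin.Subset using (Subset; ∣_∣; _∉_)
open import Data.Nat.Base using (ℕ; _%_)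
open import Data.Product.Base using (Σ-syntax; ∃-syntax; _×_)
open import Data.Refinement using (Refinement; value)
open import Data.Vec.Base using (tabulate)
open import Function.Base using (_∘_; _on_)
open import Function.Bundles using (_⇔_)
open import Level using (0ℓ)
open import Relation.Binary.Construct.Closure.ReflexiveTransitive using (Star)
open import Relation.Binary.Core using (Rel; _⇒_)
open import Relation.Binary.Definitions using (Decidable; Irreflexive; Symmetric)
open import Relation.Binary.PropositionalEquality.Core using (_≡_; _≢_; cong)
open import Relation.Nullary.Decidable.Core using (does)

-- Simple graphs. Adjacency is decidable, as it is classically; the
-- finite graphs of order n are those on the vertex set Fin n.

record Graph (V : Set) : Set₁ where
  infix 4 _~_ _~?_
  field
    _~_      : Rel V 0ℓ
    ~-sym    : Symmetric _~_
    ~-irrefl : Irreflexive _≡_ _~_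
    _~?_     : Decidable _~_

module _ {V : Set} (G : Graph V) where
  open Graph G

  Connected : Set
  Connected = ∀ x y → Star _~_ x y

  Bipartite : Set
  Bipartite = Σ[ colour ∈ (V → Bool) ] (∀ {x y} → x ~ y → colour x ≢ colour y)

  -- A set M of edges is encoded, like the edge set of G itself, as a
  -- symmetric relation on the vertices: M x y says that the edge {x , y}
  -- belongs to the set. Pairwise nonadjacent means that two members with
  -- a common endpoint x are the same edge.

  record PerfectMatching : Set₁ where
    field
      M           : Rel V 0ℓ
      M-sym       : Symmetric M
      M⊆E         : M ⇒ _~_
      nonadjacent : ∀ {x y z} → M x y → M x z → y ≡ z
      covering    : ∀ x → ∃[ y ] M x y

module _ {n : ℕ} (G : Graph (Fin n)) where
  open Graph G

  neighbours : Fin n → Subset n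
  neighbours x = tabulate (does ∘ (x ~?_))

  degree : Fin n → ℕ
  degree x = ∣ neighbours x ∣

  Regular : ℕ → Set
  Regular k = ∀ x → degree x ≡ k

  IsAutomorphism : Permutation′ n → Set
  IsAutomorphism φ = ∀ x y → (x ~ y) ⇔ ((φ ⟨$⟩ʳ x) ~ (φ ⟨$⟩ʳ y))

  VertexTransitive : Set
  VertexTransitive = ∀ x y → ∃[ φ ] (IsAutomorphism φ × φ ⟨$⟩ʳ x ≡ y)

  -- G with the vertices of S removed. The proof of x ∉ S is irrelevant in
  -- Refinement, so equality of the remaining vertices is that of Fin n.

  remove : (S : Subset n) → Graph (Refinement (Fin n) (_∉ S))
  remove S = record
    { _~_      = _~_ on value
    ; ~-sym    = ~-sym
    ; ~-irrefl = ~-irrefl ∘ cong value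
    ; _~?_     = λ x y → value x ~? value y
    }

  FactorCritical : ℕ → Set₁
  FactorCritical p =
    p % 2 ≡ n % 2 × (∀ (S : Subset n) → ∣ S ∣ ≡ p → PerfectMatching (remove S))

{-# OPTIONS --safe #-}
module Submission where

open import Defs
open import Data.Bool.Base using (Bool; true; false; _∧_; _∨_; not)
open import Data.Bool.Properties using (∧-comm; not-involutive)
open import Data.Empty using (⊥; ⊥-elim; ⊥-elim-irr)
open import Data.Fin.Base using (Fin; zero; suc)
open import Data.Fin.Permutation using (Permutation′; _⟨$⟩ʳ_; _⟨$⟩ˡ_; inverseʳ; inverseˡ; flip; _∘ₚ_)
open import Data.Fin.Properties using (_≟_) renaming (suc-injective to Fin-suc-injective)
open import Data.Fin.Subset using (Subset) renaming (∣_∣ to card; _∉_ to _∉ˢ_)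
open import Data.Irrelevant using (Irrelevant; [_])
open import Data.List.Base using (List; []; _∷_; _++_; length; lookup)
open import Data.List.Membership.Propositional using () renaming (_∈_ to _∈ᴸ_)
open import Data.List.Membership.Propositional.Properties using (∈-lookup)
open import Data.List.Properties using (length-++)
open import Data.List.Relation.Unary.All as All using (All)
open import Data.List.Relation.Unary.All.Properties using () renaming (++⁺ to All-++⁺)
open import Data.List.Relation.Unary.AllPairs as AllPairs using (AllPairs)
open import Data.List.Relation.Unary.AllPairs.Properties using () renaming (++⁺ to AllPairs-++⁺)
open import Data.List.Relation.Unary.Any using (here; there)
open import Data.Nat.Base using (ℕ; zero; suc; _+_; _*_; _∸_; _≤_; _<_; _≥_; z≤n; s≤s; s≤s⁻¹)
open import Data.Nat.Divisibility using (n∣m⇒m%n≡0)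
open import Data.Nat.Divisibility.Core using (_∣_; divides)
open import Data.Nat.Properties using (≤-refl; ≤-trans; ≤-reflexive; ≤-antisym; ≤-total; +-mono-≤; *-monoʳ-≤; +-comm; +-suc; +-identityʳ; *-comm; *-distribˡ-+; *-zeroʳ; *-identityʳ; m≤m+n; m≤n+m; n≤1+n; n≮n; +-cancelʳ-≤; +-cancelˡ-≡; *-cancelˡ-≤; _≤?_; _<?_; ≰⇒>; ≮⇒≥; <⇒≤; suc-injective; m≤n⇒m<n∨m≡n; m+[n∸m]≡n; n≤0⇒n≡0; allUpTo?; +-0-commutativeMonoid) renaming (_≟_ to _≟ᴺ_)
open import Data.Nat.Tactic.RingSolver using (solve)
open import Data.Product.Base using (Σ-syntax; ∃; ∃-syntax; _×_; _,_; proj₁; proj₂)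
open import Data.Refinement using (Refinement; value; proof) renaming (_,_ to _,ᴿ_)
open import Data.Sum.Base using (_⊎_; inj₁; inj₂; [_,_]′)
open import Data.Unit.Base using (tt)
open import Data.Vec.Base using (Vec; tabulate) renaming (lookup to lookupⱽ)
open import Data.Vec.Properties using (lookup∘tabulate; []=⇒lookup; lookup⇒[]=)
open import Function.Base using (_∘_; case_of_)
open import Function.Bundles using (_⇔_; mk⇔; Equivalence)
open import Relation.Binary.Construct.Closure.ReflexiveTransitive using (Star; ε; _◅_)
open import Relation.Binary.PropositionalEquality using (_≡_; _≢_; refl; sym; trans; cong; cong₂; subst; module ≡-Reasoning)
open import Relation.Nullary.Decidable using (toWitness; dec-true; dec-false; _→-dec_; _×-dec_; _⊎-dec_)
open import Relation.Nullary.Decidable.Core using (Dec; yes; no; does)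
open import Relation.Nullary.Negation.Core using (¬_)
import Algebra.Properties.CommutativeMonoid.Sum +-0-commutativeMonoid as Sum

-- Suppose that G minus some four vertices has no perfect matching.  By
-- Tutte's theorem some set X leaves at least |X| - 2 pairwise nonadjacent
-- odd parts; let U consist of the singletons among them and t be the number
-- of the other parts, so that |X| ≤ |U| + t + 2.
--
-- The function |N F| - |F| is submodular.  Hence its minimisers of least
-- size, over nonempty F with N F ≠ V, are blocks of the automorphism group,
-- and N F is a union of translates for every minimiser F.  It follows that
-- |N F| - |F| ≥ 4, which excludes t ≤ 1, and for k ≥ 6 parity of the blocks
-- excludes t = 2 with U nonempty.  The same argument for closed
-- neighbourhoods excludes t = 2 with U empty.
--
-- For the remaining t, count the edges at X: the t parts send at most
-- k (t + 2) edges to X.  By submodularity again, a part sending few edges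
-- forces the vertices to split into (k - 1)-regular blocks joined by a
-- perfect matching.  Edges inside and between the blocks can be counted
-- separately, and these two counts are contradictory.

-- Linear arithmetic: a bound is read off a combination L ≤ R of the
-- hypotheses and an identity which accounts for it up to a slack.  The
-- arithmetic of an argument x is stated apart from it, as x-arith.

-- Let γ be the minimum of |N F| - |F| and b the size of the blocks. As N of a block is a union of
-- blocks, b divides γ; together with γ ≥ 1 and k ≤ b + γ this leaves finitely many pairs (b, γ),
-- which are checked by evaluation. The pair γ = b passes the numerical test; there the blocks form
-- a cycle, and b = 3 would make the order odd. Closed neighbourhoods are the neighbourhoods of the
-- relation with all loops added, so one development serves both kinds, and a loop excludes γ = b.
--
-- Put κ = k - 1. If every part sends at least 2κ edges to X, then 2κt ≤ (κ + 1)(t + 2), which for t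
-- ≥ 3 and κ ≥ 5 leaves only t = 3, κ = 5, with equality. This tight case and the case t = 2, k = 5
-- are the reason for the estimates on sets spanning few triangles. Below 2κ the total count is too
-- weak, because a part may be cheap; but a part that is cheap in edges inside the blocks is
-- expensive in edges between them, so a weighted sum of the two separate counts succeeds.

by : ∀ {L R g h} s → L ≤ R → g + R + s ≡ h + L → g ≤ h
by {L} {R} {g} {h} s p e =
  +-cancelʳ-≤ R g h (≤-trans (m≤m+n (g + R) s) (≤-trans (≤-reflexive e) (+-mono-≤ (≤-refl {h}) p)))

absurd : ∀ {L R} s → L ≤ R → R + suc s ≡ L → ⊥
absurd {L} {R} s p e = n≮n 0 (by {L} {R} {1} {0} s p (trans (sym (+-suc R s)) e))

infixl 6 _⊞_
infixl 7 _⊠_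

_⊞_ : ∀ {a b c d} → a ≤ b → c ≤ d → a + c ≤ b + d
_⊞_ = +-mono-≤

_⊠_ : ∀ c {a b} → a ≤ b → c * a ≤ c * b
c ⊠ p = *-monoʳ-≤ c p

≤≡ : ∀ {a b} → a ≡ b → a ≤ b
≤≡ = ≤-reflexive

≥≡ : ∀ {a b} → a ≡ b → b ≤ a
≥≡ e = ≤-reflexive (sym e)

-- Boolean predicates

⟦_⟧ : Bool → ℕ
⟦ true  ⟧ = 1
⟦ false ⟧ = 0

-- Inequalities between the contributions of one edge to several cuts depend on finitely many truth
-- values; this lets them be proved by evaluation.
∀? : {P : Bool → Set} → (∀ b → Dec (P b)) → Dec (∀ b → P b)
∀? P? with P? true | P? false
... | yes p | yes q = yes λ { true → p ; false → q }
... | no ¬p | _     = no λ f → ¬p (f true)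
... | yes _ | no ¬q = no λ f → ¬q (f false)

bool? : ∀ b → (b ≡ true) ⊎ (b ≡ false)
bool? true  = inj₁ refl
bool? false = inj₂ refl

true≢false : ∀ {b} → b ≡ true → b ≡ false → ⊥
true≢false refl ()

∧⁺ : ∀ {a b} → a ≡ true → b ≡ true → a ∧ b ≡ true
∧⁺ refl refl = refl

∧⁻ : ∀ {a b} → a ∧ b ≡ true → a ≡ true × b ≡ true
∧⁻ {true} p = refl , p

∨⁺ˡ : ∀ {a b} → a ≡ true → a ∨ b ≡ true
∨⁺ˡ refl = refl

∨⁺ʳ : ∀ {a b} → b ≡ true → a ∨ b ≡ true
∨⁺ʳ {true}  p = refl
∨⁺ʳ {false} p = p

∨⁻ : ∀ {a b} → a ∨ b ≡ true → a ≡ true ⊎ b ≡ true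
∨⁻ {true}  p = inj₁ refl
∨⁻ {false} p = inj₂ p

not⁺ : ∀ {a} → a ≡ false → not a ≡ true
not⁺ refl = refl

not⁻ : ∀ {a} → not a ≡ true → a ≡ false
not⁻ {false} p = refl

≡false : ∀ {b} → (b ≡ true → ⊥) → b ≡ false
≡false {true}  f = ⊥-elim (f refl)
≡false {false} f = refl

bool-ext : ∀ {a b} → (a ≡ true → b ≡ true) → (b ≡ true → a ≡ true) → a ≡ b
bool-ext {true}  f g = sym (f refl)
bool-ext {false} f g = sym (≡false (λ p → case g p of λ ()))

⟦⟧-mono : ∀ {a b} → (a ≡ true → b ≡ true) → ⟦ a ⟧ ≤ ⟦ b ⟧
⟦⟧-mono {true}  f rewrite f refl = ≤-refl
⟦⟧-mono {false} f = z≤n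

any : ∀ {n} → (Fin n → Bool) → Bool
any {zero}  f = false
any {suc n} f = f zero ∨ any (f ∘ suc)

any⁺ : ∀ {n} {f : Fin n → Bool} x → f x ≡ true → any f ≡ true
any⁺ zero    p = ∨⁺ˡ p
any⁺ {f = f} (suc x) p = ∨⁺ʳ {f zero} (any⁺ x p)

any⁻ : ∀ {n} {f : Fin n → Bool} → any f ≡ true → ∃[ x ] f x ≡ true
any⁻ {suc n} {f} p with ∨⁻ {f zero} p
... | inj₁ q = zero , q
... | inj₂ q = let x , r = any⁻ q in suc x , r

-- Sums are opaque so that unification can infer their summands.

opaque

  ∑ : ∀ {n} → (Fin n → ℕ) → ℕ
  ∑ = Sum.sum

  ∑-nil : (f : Fin 0 → ℕ) → ∑ f ≡ 0
  ∑-nil f = refl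

  ∑-suc : ∀ {n} (f : Fin (suc n) → ℕ) → ∑ f ≡ f zero + ∑ (f ∘ suc)
  ∑-suc f = refl

  ∑-cong : ∀ {n} {f g : Fin n → ℕ} → (∀ x → f x ≡ g x) → ∑ f ≡ ∑ g
  ∑-cong = Sum.sum-cong-≗

  ∑-+ : ∀ {n} (f g : Fin n → ℕ) → ∑ (λ x → f x + g x) ≡ ∑ f + ∑ g
  ∑-+ = Sum.∑-distrib-+

  ∑-comm : ∀ {m n} (f : Fin m → Fin n → ℕ) → ∑ (λ x → ∑ (f x)) ≡ ∑ (λ y → ∑ (λ x → f x y))
  ∑-comm = Sum.∑-comm

  ∑-permute : ∀ {n} (f : Fin n → ℕ) (π : Permutation′ n) → ∑ (λ x → f (π ⟨$⟩ʳ x)) ≡ ∑ f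
  ∑-permute f π = sym (Sum.sum-permute f π)

  ∑-mono : ∀ {n} {f g : Fin n → ℕ} → (∀ x → f x ≤ g x) → ∑ f ≤ ∑ g
  ∑-mono {zero}  h = z≤n
  ∑-mono {suc n} h = +-mono-≤ (h zero) (∑-mono (h ∘ suc))

  ∑-* : ∀ {n} c (f : Fin n → ℕ) → ∑ (λ x → c * f x) ≡ c * ∑ f
  ∑-* {zero}  c f = sym (*-zeroʳ c)
  ∑-* {suc n} c f = trans (cong (c * f zero +_) (∑-* c (f ∘ suc))) (sym (*-distribˡ-+ c (f zero) _))

  ∑-zero : ∀ {n} {f : Fin n → ℕ} → (∀ x → f x ≡ 0) → ∑ f ≡ 0
  ∑-zero {zero}  h = refl
  ∑-zero {suc n} h = cong₂ _+_ (h zero) (∑-zero (h ∘ suc))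

  ∑≡0 : ∀ {n} {f : Fin n → ℕ} → ∑ f ≡ 0 → ∀ x → f x ≡ 0
  ∑≡0 {suc n} {f} p zero    = n≤0⇒n≡0 (≤-trans (m≤m+n (f zero) _) (≤≡ p))
  ∑≡0 {suc n} {f} p (suc x) = ∑≡0 (n≤0⇒n≡0 (≤-trans (m≤n+m _ (f zero)) (≤≡ p))) x

  ∑-one : ∀ n → ∑ {n} (λ _ → 1) ≡ n
  ∑-one zero    = refl
  ∑-one (suc n) = cong suc (∑-one n)

  term≤∑ : ∀ {n} (f : Fin n → ℕ) x → f x ≤ ∑ f
  term≤∑ f zero    = m≤m+n _ _
  term≤∑ f (suc x) = ≤-trans (term≤∑ (f ∘ suc) x) (m≤n+m _ (f zero))

-- Subsets of Fin n

Sub : ℕ → Set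
Sub n = Fin n → Bool

infix 4 _∈_ _∉_ _⊆_ _≐_
infixr 7 _∩_ _∖_
infixr 6 _∪_

_∈_ _∉_ : ∀ {n} → Fin n → Sub n → Set
x ∈ A = A x ≡ true
x ∉ A = A x ≡ false

_⊆_ _≐_ : ∀ {n} → Sub n → Sub n → Set
A ⊆ B = ∀ x → x ∈ A → x ∈ B
A ≐ B = ∀ x → A x ≡ B x

_∩_ _∪_ _∖_ : ∀ {n} → Sub n → Sub n → Sub n
(A ∩ B) x = A x ∧ B x
(A ∪ B) x = A x ∨ B x
(A ∖ B) x = A x ∧ not (B x)

∁ : ∀ {n} → Sub n → Sub n
∁ A x = not (A x)

∅ full : ∀ {n} → Sub n
∅ _ = false
full _ = true

⁅_⁆ : ∀ {n} → Fin n → Sub n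
⁅ x ⁆ y = does (x ≟ y)

opaque

  # : ∀ {n} → Sub n → ℕ
  # A = ∑ (λ x → ⟦ A x ⟧)

  #-def : ∀ {n} (A : Sub n) → # A ≡ ∑ (λ x → ⟦ A x ⟧)
  #-def A = refl

Nonempty : ∀ {n} → Sub n → Set
Nonempty A = ∃[ x ] x ∈ A

x∈⁅x⁆ : ∀ {n} (x : Fin n) → x ∈ ⁅ x ⁆
x∈⁅x⁆ x = dec-true (x ≟ x) refl

∈⁅⁆⇒≡ : ∀ {n} {x y : Fin n} → y ∈ ⁅ x ⁆ → x ≡ y
∈⁅⁆⇒≡ {x = x} {y} p with x ≟ y
... | yes q = q

≢⇒∉⁅⁆ : ∀ {n} {x y : Fin n} → x ≢ y → y ∉ ⁅ x ⁆
≢⇒∉⁅⁆ {x = x} {y} p = dec-false (x ≟ y) p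

opaque
  unfolding ∑ #

  #⁅_⁆ : ∀ {n} (x : Fin n) → # (⁅ x ⁆) ≡ 1
  #⁅_⁆ {suc n} zero    = cong suc (∑-zero {n} (λ _ → refl))
  #⁅_⁆ {suc n} (suc x) = trans (∑-cong {n} (λ y → cong ⟦_⟧ (lem y))) #⁅ x ⁆
    where
    lem : ∀ y → does (suc x ≟ suc y) ≡ does (x ≟ y)
    lem y with x ≟ y
    ... | yes p = refl
    ... | no ¬p = refl

  #-mono : ∀ {n} {A B : Sub n} → A ⊆ B → # A ≤ # B
  #-mono {n} h = ∑-mono {n} (λ x → ⟦⟧-mono (h x))

  #-cong : ∀ {n} {A B : Sub n} → A ≐ B → # A ≡ # B
  #-cong h = ∑-cong (λ x → cong ⟦_⟧ (h x))

  #∁ : ∀ {n} (A : Sub n) → # A + # (∁ A) ≡ n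
  #∁ {n} A = trans (sym (∑-+ {n} _ _)) (trans (∑-cong (λ x → lem (A x))) (∑-one n))
    where
    lem : ∀ a → ⟦ a ⟧ + ⟦ not a ⟧ ≡ 1
    lem true  = refl
    lem false = refl

  #∩+#∪ : ∀ {n} (A B : Sub n) → # (A ∩ B) + # (A ∪ B) ≡ # A + # B
  #∩+#∪ {n} A B = trans (sym (∑-+ {n} _ _)) (trans (∑-cong (λ x → lem (A x) (B x))) (∑-+ {n} _ _))
    where
    lem : ∀ a b → ⟦ a ∧ b ⟧ + ⟦ a ∨ b ⟧ ≡ ⟦ a ⟧ + ⟦ b ⟧
    lem true  b     = +-comm ⟦ b ⟧ 1
    lem false true  = refl
    lem false false = refl

  #∩+#∖ : ∀ {n} (A B : Sub n) → # (A ∩ B) + # (A ∖ B) ≡ # A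
  #∩+#∖ {n} A B = trans (sym (∑-+ {n} _ _)) (∑-cong (λ x → lem (A x) (B x)))
    where
    lem : ∀ a b → ⟦ a ∧ b ⟧ + ⟦ a ∧ not b ⟧ ≡ ⟦ a ⟧
    lem true  true  = refl
    lem true  false = refl
    lem false b     = refl

  #-permute : ∀ {n} (A : Sub n) (π : Permutation′ n) → # (λ x → A (π ⟨$⟩ʳ x)) ≡ # A
  #-permute A π = ∑-permute (λ x → ⟦ A x ⟧) π

  #≡0⇒∉ : ∀ {n} {A : Sub n} → # A ≡ 0 → ∀ x → x ∉ A
  #≡0⇒∉ {A = A} p x with A x | ∑≡0 {f = λ x → ⟦ A x ⟧} p x
  ... | false | _ = refl

  ∉⇒#≡0 : ∀ {n} {A : Sub n} → (∀ x → x ∉ A) → # A ≡ 0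
  ∉⇒#≡0 h = ∑-zero (λ x → cong ⟦_⟧ (h x))

  ∈⇒1≤ : ∀ {n} {A : Sub n} {x} → x ∈ A → 1 ≤ # A
  ∈⇒1≤ {A = A} {x} p = ≤-trans (≥≡ (cong ⟦_⟧ p)) (term≤∑ (λ y → ⟦ A y ⟧) x)

#≤n : ∀ {n} (A : Sub n) → # A ≤ n
#≤n A = ≤-trans (m≤m+n _ _) (≤≡ (#∁ A))

∩-comm : ∀ {n} (A B : Sub n) → A ∩ B ≐ B ∩ A
∩-comm A B x = ∧-comm (A x) (B x)

⊆-antisym : ∀ {n} {A B : Sub n} → A ⊆ B → B ⊆ A → A ≐ B
⊆-antisym f g x = bool-ext (f x) (g x)

nonempty : ∀ {n} (A : Sub n) → 1 ≤ # A → Nonempty A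
nonempty A p with bool? (any A)
... | inj₁ q = any⁻ q
... | inj₂ q = ⊥-elim (n≮n 0 (≤-trans p
    (≤≡ (∉⇒#≡0 {A = A} (λ x → ≡false (λ r → true≢false (any⁺ x r) q))))))

empty? : ∀ {n} (A : Sub n) → Nonempty A ⊎ (∀ x → x ∉ A)
empty? A with bool? (any A)
... | inj₁ q = inj₁ (any⁻ q)
... | inj₂ q = inj₂ (λ x → ≡false (λ r → true≢false (any⁺ x r) q))

⊆∧≥⇒⊇ : ∀ {n} {A B : Sub n} → A ⊆ B → # B ≤ # A → B ⊆ A
⊆∧≥⇒⊇ {A = A} {B} f p x q with bool? (A x)
... | inj₁ r = r
... | inj₂ r = ⊥-elim (arith _ _ _ _ p (#∩+#∖ B A) (∈⇒1≤ {A = B ∖ A} (∧⁺ q (not⁺ r)))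
    (#-mono {A = A} {B ∩ A} (λ y s → ∧⁺ (f y s) s)))
  where
  arith : ∀ a b c d → b ≤ a → c + d ≡ b → 1 ≤ d → a ≤ c → ⊥
  arith a b c d h₁ h₂ h₃ h₄ = absurd 0 (h₁ ⊞ ≤≡ h₂ ⊞ h₃ ⊞ h₄) (solve (a ∷ b ∷ c ∷ d ∷ []))

disjoint-∪ : ∀ {n} (A B : Sub n) → (∀ x → x ∈ A → x ∈ B → ⊥) → # (A ∪ B) ≡ # A + # B
disjoint-∪ A B h = trans (cong (_+ # (A ∪ B))
    (sym (∉⇒#≡0 {A = A ∩ B} (λ x → ≡false (λ p → h x (proj₁ (∧⁻ p)) (proj₂ (∧⁻ {A x} p)))))))
                         (#∩+#∪ A B)

#-remove : ∀ {n} {A : Sub n} {x} → x ∈ A → # A ≡ suc (# (A ∖ ⁅ x ⁆))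
#-remove {A = A} {x} p = trans (sym (#∩+#∖ A ⁅ x ⁆))
    (cong (_+ # (A ∖ ⁅ x ⁆)) (trans (#-cong (⊆-antisym {A = A ∩ ⁅ x ⁆} {⁅ x ⁆}
  (λ y q → proj₂ (∧⁻ {A y} q)) (λ y q → ∧⁺ (subst (_∈ A) (∈⁅⁆⇒≡ q) p) q))) (#⁅ x ⁆)))

#-insert : ∀ {n} {A : Sub n} {x} → x ∉ A → # (A ∪ ⁅ x ⁆) ≡ suc (# A)
#-insert {A = A} {x} p = trans (disjoint-∪ A ⁅ x ⁆
    (λ y q s → true≢false (subst (_∈ A) (sym (∈⁅⁆⇒≡ s)) q) p))
  (trans (cong (# A +_) (#⁅ x ⁆)) (+-comm (# A) 1))

-- Edge counts and edge cuts

Rel : ℕ → Set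
Rel n = Fin n → Fin n → Bool

Symm : ∀ {n} → Rel n → Set
Symm r = ∀ x y → r x y ≡ r y x

-- Edges inside A are counted twice by E r A A.

opaque

  E : ∀ {n} → Rel n → Sub n → Sub n → ℕ
  E r A B = ∑ (λ x → ∑ (λ y → ⟦ A x ∧ B y ∧ r x y ⟧))

d : ∀ {n} → Rel n → Sub n → ℕ
d r A = E r A (∁ A)

opaque
  unfolding E

  ∑∑-mono : ∀ {m n} {f g : Fin m → Fin n → ℕ} → (∀ x y → f x y ≤ g x y) →
            ∑ (λ x → ∑ (f x)) ≤ ∑ (λ x → ∑ (g x))
  ∑∑-mono h = ∑-mono (λ x → ∑-mono (h x))

  ∑∑-cong : ∀ {m n} {f g : Fin m → Fin n → ℕ} → (∀ x y → f x y ≡ g x y) →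
            ∑ (λ x → ∑ (f x)) ≡ ∑ (λ x → ∑ (g x))
  ∑∑-cong h = ∑-cong (λ x → ∑-cong (h x))

  ∑∑-+ : ∀ {m n} (f g : Fin m → Fin n → ℕ) →
         ∑ (λ x → ∑ (λ y → f x y + g x y)) ≡ ∑ (λ x → ∑ (f x)) + ∑ (λ x → ∑ (g x))
  ∑∑-+ f g = trans (∑-cong (λ x → ∑-+ (f x) (g x))) (∑-+ _ _)

  E-cong : ∀ {n} {r : Rel n} {A A′ B B′} → A ≐ A′ → B ≐ B′ → E r A B ≡ E r A′ B′
  E-cong {r = r} f g = ∑∑-cong (λ x y → cong₂ (λ a b → ⟦ a ∧ b ∧ r x y ⟧) (f x) (g y))

  E-sym : ∀ {n} {r : Rel n} → Symm r → ∀ A B → E r A B ≡ E r B A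
  E-sym {r = r} s A B = trans (∑-comm _) (∑∑-cong (λ y x → trans
    (cong (λ w → ⟦ A x ∧ B y ∧ w ⟧) (s x y)) (lem (A x) (B y) (r y x))))
    where
    lem : ∀ a b w → ⟦ a ∧ b ∧ w ⟧ ≡ ⟦ b ∧ a ∧ w ⟧
    lem true  b     w = refl
    lem false true  w = refl
    lem false false w = refl

  E-splitˡ : ∀ {n} {r : Rel n} A B C → E r A B ≡ E r (A ∩ C) B + E r (A ∖ C) B
  E-splitˡ {r = r} A B C = trans (∑∑-cong (λ x y → lem (A x) (B y) (C x) (r x y))) (∑∑-+ _ _)
    where
    lem : ∀ a b c w → ⟦ a ∧ b ∧ w ⟧ ≡ ⟦ (a ∧ c) ∧ b ∧ w ⟧ + ⟦ (a ∧ not c) ∧ b ∧ w ⟧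
    lem true  b true  w = sym (+-identityʳ _)
    lem true  b false w = refl
    lem false b c     w = refl

  E-splitʳ : ∀ {n} {r : Rel n} A B C → E r A B ≡ E r A (B ∩ C) + E r A (B ∖ C)
  E-splitʳ {r = r} A B C = trans (∑∑-cong (λ x y → lem (A x) (B y) (C y) (r x y))) (∑∑-+ _ _)
    where
    lem : ∀ a b c w → ⟦ a ∧ b ∧ w ⟧ ≡ ⟦ a ∧ (b ∧ c) ∧ w ⟧ + ⟦ a ∧ (b ∧ not c) ∧ w ⟧
    lem true  true  true  w = sym (+-identityʳ _)
    lem true  true  false w = refl
    lem true  false c     w = refl
    lem false b     c     w = refl

  E-split-rel : ∀ {n} {r : Rel n} A B (s : Rel n) →
    E r A B ≡ E (λ x y → r x y ∧ s x y) A B + E (λ x y → r x y ∧ not (s x y)) A B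
  E-split-rel {r = r} A B s = trans (∑∑-cong (λ x y → lem (A x ) (B y) (r x y) (s x y))) (∑∑-+ _ _)
    where
    lem : ∀ a b w c → ⟦ a ∧ b ∧ w ⟧ ≡ ⟦ a ∧ b ∧ (w ∧ c) ⟧ + ⟦ a ∧ b ∧ (w ∧ not c) ⟧
    lem true  true  true  true  = refl
    lem true  true  true  false = refl
    lem true  true  false c     = refl
    lem true  false w     c     = refl
    lem false b     w     c     = refl

  E-rows : ∀ {n} {r : Rel n} A B → E r A B ≡ ∑ (λ x → ⟦ A x ⟧ * # (B ∩ r x))
  E-rows {n} {r} A B = ∑-cong (λ x → lem x (A x))
    where
    lem : ∀ x a → ∑ (λ y → ⟦ a ∧ B y ∧ r x y ⟧) ≡ ⟦ a ⟧ * # (B ∩ r x)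
    lem x true  = trans (sym (#-def (B ∩ r x))) (sym (+-identityʳ _))
    lem x false = ∑-zero {n} (λ y → refl)

  ∑-⟦⟧* : ∀ {n} (A : Sub n) c → ∑ (λ x → ⟦ A x ⟧ * c) ≡ c * # A
  ∑-⟦⟧* A c = trans (∑-cong (λ x → *-comm ⟦ A x ⟧ c))
      (trans (∑-* c (λ x → ⟦ A x ⟧)) (cong (c *_) (sym (#-def A))))

  E-full : ∀ {n} {r : Rel n} {κ} A → (∀ x → x ∈ A → # (r x) ≡ κ) → E r A full ≡ κ * # A
  E-full {n} {r} {κ} A h = trans (E-rows A full) (trans (∑-cong (λ x → lem x (bool? (A x)))) (∑-⟦⟧* A κ))
    where
    lem : ∀ x → (A x ≡ true ⊎ A x ≡ false) → ⟦ A x ⟧ * # (full ∩ r x) ≡ ⟦ A x ⟧ * κ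
    lem x (inj₁ p) = cong (⟦ A x ⟧ *_) (h x p)
    lem x (inj₂ p) rewrite p = refl

  E-rows-≤ : ∀ {n} {r : Rel n} {κ} A B → (∀ x → x ∈ A → # (B ∩ r x) ≤ κ) → E r A B ≤ κ * # A
  E-rows-≤ {n} {r} {κ} A B h = ≤-trans (≤≡ (E-rows A B))
      (≤-trans (∑-mono (λ x → lem x (bool? (A x)))) (≤≡ (∑-⟦⟧* A κ)))
    where
    lem : ∀ x → (A x ≡ true ⊎ A x ≡ false) → ⟦ A x ⟧ * # (B ∩ r x) ≤ ⟦ A x ⟧ * κ
    lem x (inj₁ p) = *-monoʳ-≤ ⟦ A x ⟧ (h x p)
    lem x (inj₂ p) rewrite p = z≤n

  E-rows-≥ : ∀ {n} {r : Rel n} {κ} A B → (∀ x → x ∈ A → κ ≤ # (B ∩ r x)) → κ * # A ≤ E r A B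
  E-rows-≥ {n} {r} {κ} A B h = ≤-trans (≥≡ (∑-⟦⟧* A κ))
      (≤-trans (∑-mono (λ x → lem x (bool? (A x)))) (≥≡ (E-rows A B)))
    where
    lem : ∀ x → (A x ≡ true ⊎ A x ≡ false) → ⟦ A x ⟧ * κ ≤ ⟦ A x ⟧ * # (B ∩ r x)
    lem x (inj₁ p) = *-monoʳ-≤ ⟦ A x ⟧ (h x p)
    lem x (inj₂ p) rewrite p = z≤n

  E-zero : ∀ {n} {r : Rel n} {A B} → (∀ x y → x ∈ A → y ∈ B → r x y ≡ true → ⊥) → E r A B ≡ 0
  E-zero h = ∑-zero (λ x → ∑-zero (λ y → cong ⟦_⟧ (≡false (λ p → let a , q = ∧⁻ p ; b , c = ∧⁻ q in h x y a b c))))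

  row≤E : ∀ {n} {r : Rel n} {A} x → x ∈ A → ∀ B → # (B ∩ r x) ≤ E r A B
  row≤E {r = r} {A} x p B = ≤-trans (≥≡ (trans (cong (λ a → ⟦ a ⟧ * _) p) (+-identityʳ _)))
    (≤-trans (term≤∑ (λ x → ⟦ A x ⟧ * # (B ∩ r x)) x) (≥≡ (E-rows A B)))

  edge≤E : ∀ {n} {r : Rel n} {A B} x y → x ∈ A → y ∈ B → r x y ≡ true → 1 ≤ E r A B
  edge≤E {r = r} {A} {B} x y p q w = ≤-trans (∈⇒1≤ {A = B ∩ r x} (∧⁺ q w)) (row≤E {r = r} {A} x p B)

  E-permute : ∀ {n} {r : Rel n} (π : Permutation′ n) → (∀ x y → r (π ⟨$⟩ʳ x) (π ⟨$⟩ʳ y) ≡ r x y) →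
              ∀ A B → E r (λ x → A (π ⟨$⟩ʳ x)) (λ x → B (π ⟨$⟩ʳ x)) ≡ E r A B
  E-permute {r = r} π h A B = trans
    (∑∑-cong (λ x y → cong (λ w → ⟦ A (π ⟨$⟩ʳ x) ∧ B (π ⟨$⟩ʳ y) ∧ w ⟧) (sym (h x y))))
    (trans (∑-cong (λ x → ∑-permute (λ y → ⟦ A (π ⟨$⟩ʳ x) ∧ B y ∧ r (π ⟨$⟩ʳ x) y ⟧) π))
           (∑-permute (λ x → ∑ (λ y → ⟦ A x ∧ B y ∧ r x y ⟧)) π))

  -- The inequality holds for each ordered pair of vertices separately, whatever the positions of
  -- the two ends.
  d-submodular : ∀ {n} {r : Rel n} A B → d r (A ∩ B) + d r (A ∪ B) ≤ d r A + d r B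
  d-submodular {r = r} A B = ≤-trans (≥≡ (∑∑-+ _ _))
    (≤-trans (∑∑-mono (λ x y → lem (A x) (B x) (A y) (B y) (r x y))) (≤≡ (∑∑-+ _ _)))
    where
    lem : ∀ a b a′ b′ w → ⟦ (a ∧ b) ∧ not (a′ ∧ b′) ∧ w ⟧ + ⟦ (a ∨ b) ∧ not (a′ ∨ b′) ∧ w ⟧
                        ≤ ⟦ a ∧ not a′ ∧ w ⟧ + ⟦ b ∧ not b′ ∧ w ⟧
    lem = toWitness {a? = ∀? λ a → ∀? λ b → ∀? λ c → ∀? λ d → ∀? λ w → _ ≤? _} tt

d-cong : ∀ {n} {r : Rel n} {A B} → A ≐ B → d r A ≡ d r B
d-cong h = E-cong h (λ x → cong not (h x))

d-∁ : ∀ {n} {r : Rel n} → Symm r → ∀ A → d r (∁ A) ≡ d r A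
d-∁ s A = trans (E-sym s (∁ A) (∁ (∁ A))) (E-cong (λ x → not-involutive (A x)) (λ _ → refl))

-- Submodularity for `A` and the complement of `B`: under a symmetric relation a set and its
-- complement have the same cut.
d-posimodular : ∀ {n} {r : Rel n} → Symm r → ∀ A B → d r (A ∖ B) + d r (B ∖ A) ≤ d r A + d r B
d-posimodular {r = r} s A B = ≤-trans
  (+-mono-≤ ≤-refl (≤≡ (trans (sym (d-∁ s (B ∖ A))) (d-cong (λ x → lem (A x) (B x))))))
  (≤-trans (d-submodular {r = r} A (∁ B)) (+-mono-≤ ≤-refl (≤≡ (d-∁ s B))))
  where
  lem : ∀ a b → not (b ∧ not a) ≡ a ∨ not b
  lem true  true  = refl
  lem true  false = refl
  lem false true  = refl
  lem false false = refl

d+E : ∀ {n} {r : Rel n} {κ} A → (∀ x → # (r x) ≡ κ) → d r A + E r A A ≡ κ * # A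
d+E {r = r} A h = trans (+-comm (d r A) (E r A A))
    (trans (sym (E-splitʳ A full A)) (E-full A (λ x _ → h x)))

-- Parity of edge counts

opaque
  unfolding E

  Even : ℕ → Set
  Even m = ∃[ h ] m ≡ h + h

  even⁺ : ∀ {m} h → m ≡ h + h → Even m
  even⁺ h p = h , p

  even⁻ : ∀ {m} → Even m → ∃[ h ] m ≡ h + h
  even⁻ e = e

  -- By induction on the matrix: its first row and first column have equal sums `c`, and their
  -- common entry is zero.
  ∑∑-even : ∀ {n} (f : Fin n → Fin n → ℕ) → (∀ x y → f x y ≡ f y x) → (∀ x → f x x ≡ 0) → Even
      (∑ (λ x → ∑ (f x)))
  ∑∑-even {zero}  f s z = 0 , ∑-nil _
  ∑∑-even {suc n} f s z with ∑∑-even (λ x y → f (suc x) (suc y)) (λ x y → s (suc x) (suc y)) (z ∘ suc)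
  ... | h , p = c + h , (begin
    ∑ (λ x → ∑ (f x)) ≡⟨ ∑-suc (λ x → ∑ (f x)) ⟩
    ∑ (f zero) + ∑ (λ x → ∑ (f (suc x))) ≡⟨ cong₂ _+_ (∑-suc (f zero)) (∑-cong (λ x → ∑-suc (f (suc x)))) ⟩
    (f zero zero + c) + ∑ (λ x → f (suc x) zero + ∑ (f (suc x) ∘ suc))
      ≡⟨ cong₂ (λ u v → (u + c) + v) (z zero) (∑-+ (λ x → f (suc x) zero) (λ x → ∑ (f (suc x) ∘ suc))) ⟩
    c + (∑ (λ x → f (suc x) zero) + ∑ (λ x → ∑ (f (suc x) ∘ suc)))
      ≡⟨ cong₂ (λ u v → c + (u + v)) (∑-cong (λ x → s (suc x) zero)) p ⟩
    c + (c + (h + h)) ≡⟨ arith c h ⟩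
    c + h + (c + h) ∎)
    where
    open ≡-Reasoning
    c : ℕ
    c = ∑ (f zero ∘ suc)
    arith : ∀ c h → c + (c + (h + h)) ≡ c + h + (c + h)
    arith c h = solve (c ∷ h ∷ [])

  E-even : ∀ {n} {r : Rel n} → Symm r → (∀ x → r x x ≡ false) → ∀ A → Even (E r A A)
  E-even {r = r} s z A = ∑∑-even _ (λ x y → trans (cong (λ w → ⟦ A x ∧ A y ∧ w ⟧) (s x y))
      (lem (A x) (A y) (r y x)))
                               (λ x → trans (cong (λ w → ⟦ A x ∧ A x ∧ w ⟧) (z x)) (lem′ (A x)))
    where
    lem : ∀ a b w → ⟦ a ∧ b ∧ w ⟧ ≡ ⟦ b ∧ a ∧ w ⟧
    lem true  b     w = refl
    lem false true  w = refl
    lem false false w = refl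
    lem′ : ∀ a → ⟦ a ∧ a ∧ false ⟧ ≡ 0
    lem′ true  = refl
    lem′ false = refl

odd≢even : ∀ h u → h + h ≡ suc (u + u) → ⊥
odd≢even (suc h) zero    e = case trans (sym (+-suc h h)) (suc-injective e) of λ ()
odd≢even (suc h) (suc u) e = odd≢even h u
    (suc-injective (suc-injective (trans (cong suc (sym (+-suc h h)))
    (trans e (cong suc (cong suc (+-suc u u)))))))

opaque
  unfolding Even

  even-or-odd : ∀ m → Even m ⊎ Even (suc m)
  even-or-odd zero = inj₁ (0 , refl)
  even-or-odd (suc m) with even-or-odd m
  ... | inj₁ (h , refl) = inj₂ (suc h , cong suc (sym (+-suc h h)))
  ... | inj₂ e = inj₁ e

  ¬even-suc : ∀ {m} → Even m → Even (suc m) → ⊥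
  ¬even-suc (h , p) (suc u , q) = odd≢even h u
      (suc-injective (trans (cong suc (sym p)) (trans q (cong suc (+-suc u u)))) )

  even-+ : ∀ {a b} → Even a → Even b → Even (a + b)
  even-+ (h , refl) (u , refl) = h + u , arith h u
    where
    arith : ∀ h u → h + h + (u + u) ≡ h + u + (h + u)
    arith h u = solve (h ∷ u ∷ [])

  even-* : ∀ m {b} → Even b → Even (m * b)
  even-* zero    e = 0 , refl
  even-* (suc m) e = even-+ e (even-* m e)

  even-+⁻ : ∀ {a b} → Even (a + b) → Even b → Even a
  even-+⁻ {a} {b} e f with even-or-odd a
  ... | inj₁ g = g
  ... | inj₂ g = ⊥-elim (¬even-suc e (even-+ g f))

even-0 : Even 0
even-0 = even⁺ 0 refl

opaque
  unfolding E

  -- A vertex that changes sides carries a single edge, so it adds at most one edge to the cut.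
  d-lipschitz : ∀ {n} {r : Rel n} → Symm r → (∀ x → # (r x) ≡ 1) →
                ∀ C C′ → d r C′ ≤ d r C + (# (C′ ∖ C) + # (C ∖ C′))
  d-lipschitz {r = r} s h C C′ = ≤-trans (∑∑-mono (λ x y → lem (C x) (C′ x) (C y) (C′ y) (r x y)))
    (≤≡ (trans (∑∑-+ _ _) (cong (d r C +_) (trans (∑∑-+ _ _) (cong₂ _+_
      (rows (C′ ∖ C)) (trans (E-sym s full (C ∖ C′)) (rows (C ∖ C′))))))))
    where
    rows : ∀ A → E r A full ≡ # A
    rows A = trans (E-full A (λ x _ → h x)) (+-identityʳ _)
    lem : ∀ a a′ b b′ w → ⟦ a′ ∧ not b′ ∧ w ⟧ ≤
          ⟦ a ∧ not b ∧ w ⟧ + (⟦ (a′ ∧ not a) ∧ true ∧ w ⟧ + ⟦ true ∧ (b ∧ not b′) ∧ w ⟧)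
    lem = toWitness {a? = ∀? λ a → ∀? λ b → ∀? λ c → ∀? λ d → ∀? λ w → _ ≤? _} tt

  E-mono′ : ∀ {n} {r s : Rel n} {A A′ B B′} →
            (∀ x y → x ∈ A → y ∈ B → r x y ≡ true → x ∈ A′ × y ∈ B′ × s x y ≡ true) → E r A B ≤ E s A′ B′
  E-mono′ h = ∑∑-mono (λ x y → ⟦⟧-mono (λ p → let a , q = ∧⁻ p ; b , c = ∧⁻ q ; a′ , b′ , c′ = h x y a b c in
    ∧⁺ a′ (∧⁺ b′ c′)))

  even-pred : ∀ {m} → Even (suc (suc m)) → Even m
  even-pred e = even-+⁻ (subst Even (+-comm 2 _) e) (even⁺ 1 refl)

  -- Summing deg x + deg y ≤ # A + 1 over the edges xy inside A bounds the
  -- sum of the squared degrees; the degrees also satisfy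
  -- (2 c + 1) deg x ≤ (deg x)² + c (c + 1).

  sparse : ∀ {n} {r : Rel n} → Symm r → ∀ A → (∀ x y → x ∈ A → y ∈ A → r x y ≡ true → # (r x ∩ r y) ≤ 1) →
           ∀ c → 2 * ((2 * c + 1) * E r A A) ≤ (# A + 1) * E r A A + 2 * (c * (c + 1) * # A)
  sparse {n} {r} s A codeg c = arith ((2 * c + 1) * E r A A) squares (c * (c + 1) * # A)
      ((# A + 1) * E r A A) below above
    where
    deg : Fin n → ℕ
    deg x = # (A ∩ r x)
    w : Fin n → Fin n → ℕ
    w x y = ⟦ A x ∧ A y ∧ r x y ⟧
    squares : ℕ
    squares = ∑ (λ x → ⟦ A x ⟧ * (deg x * deg x))
    row : ∀ x → ∑ (w x) ≡ ⟦ A x ⟧ * deg x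
    row x = lem (A x)
      where
      lem : ∀ a → ∑ (λ y → ⟦ a ∧ A y ∧ r x y ⟧) ≡ ⟦ a ⟧ * deg x
      lem true  = trans (sym (#-def (A ∩ r x))) (sym (+-identityʳ _))
      lem false = ∑-zero {n} (λ _ → refl)
    first : ∑ (λ x → ∑ (λ y → w x y * deg x)) ≡ squares
    first = ∑-cong (λ x → trans (∑-cong (λ y → *-comm (w x y) (deg x))) (trans (∑-* (deg x) (w x))
      (trans (cong (deg x *_) (row x)) (arith′ (deg x) ⟦ A x ⟧))))
      where
      arith′ : ∀ d a → d * (a * d) ≡ a * (d * d)
      arith′ d a = solve (d ∷ a ∷ [])
    second : ∑ (λ x → ∑ (λ y → w x y * deg y)) ≡ squares
    second = trans (∑-comm _) (trans
        (∑∑-cong (λ y x → cong (_* deg y) (trans (cong (λ t → ⟦ A x ∧ A y ∧ t ⟧) (s x y))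
        (lem (A x) (A y) (r y x))))) first)
      where
      lem : ∀ a b t → ⟦ a ∧ b ∧ t ⟧ ≡ ⟦ b ∧ a ∧ t ⟧
      lem true  b     t = refl
      lem false true  t = refl
      lem false false t = refl
    above : squares + squares ≤ (# A + 1) * E r A A
    above = ≤-trans (≥≡ (trans (∑∑-+ _ _) (cong₂ _+_ first second))) (≤-trans (∑∑-mono pointwise)
      (≤≡ (trans (∑-cong (λ x → ∑-* (# A + 1) (w x))) (∑-* (# A + 1) (λ x → ∑ (w x))))))
      where
      pointwise : ∀ x y → w x y * deg x + w x y * deg y ≤ (# A + 1) * w x y
      pointwise x y = lem (A x ∧ A y ∧ r x y) refl
        where
        lem : ∀ b → b ≡ A x ∧ A y ∧ r x y → ⟦ b ⟧ * deg x + ⟦ b ⟧ * deg y ≤ (# A + 1) * ⟦ b ⟧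
        lem false e = z≤n
        lem true  e = let a , q = ∧⁻ (sym e) ; a′ , t = ∧⁻ {A y} q in
          ≤-trans (≤≡ (cong₂ _+_ (+-identityʳ (deg x)) (+-identityʳ (deg y))))
          (≤-trans (≥≡ (#∩+#∪ (A ∩ r x) (A ∩ r y))) (≤-trans (≤-trans
            (≤-trans (#-mono {A = (A ∩ r x) ∩ (A ∩ r y)} {r x ∩ r y} λ z p → let u , v = ∧⁻ {A z ∧ r x z} p in ∧⁺ (proj₂ (∧⁻ {A z} u)) (proj₂ (∧⁻ {A z} v))) (codeg x y a a′ t)
             ⊞ #-mono {A = (A ∩ r x) ∪ (A ∩ r y)} {A} λ z p →
                 [ (λ u → proj₁ (∧⁻ u)) , (λ u → proj₁ (∧⁻ u)) ]′ (∨⁻ {A z ∧ r x z} p))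
            (≤≡ (+-comm 1 (# A)))) (≥≡ (*-identityʳ _))))
    below : (2 * c + 1) * E r A A ≤ squares + c * (c + 1) * # A
    below = ≤-trans (≤≡ (trans (cong ((2 * c + 1) *_) (E-rows A A))
        (sym (∑-* (2 * c + 1) (λ x → ⟦ A x ⟧ * deg x)))))
      (≤-trans (∑-mono (λ x → pointwise (A x) (deg x)))
          (≤≡ (trans (∑-+ _ _) (cong (squares +_) (∑-⟦⟧* A (c * (c + 1)))))))
      where
      convex : ∀ c d → (2 * c + 1) * d ≤ d * d + c * (c + 1)
      convex c d with ≤-total d c
      ... | inj₁ p = below′ (c ∸ d) (m+[n∸m]≡n p)
        where
        below′ : ∀ t → d + t ≡ c → (2 * c + 1) * d ≤ d * d + c * (c + 1)
        below′ t refl = by (t * t + t) (≤-refl {0}) (solve (d ∷ t ∷ []))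
      ... | inj₂ p with d ∸ c | m+[n∸m]≡n p
      ...   | zero  | refl = by 0 (≤-refl {0}) (solve (c ∷ []))
      ...   | suc t | refl = by (t * t + t) (≤-refl {0}) (solve (c ∷ t ∷ []))
      pointwise : ∀ a d → (2 * c + 1) * (⟦ a ⟧ * d) ≤ ⟦ a ⟧ * (d * d) + ⟦ a ⟧ * (c * (c + 1))
      pointwise false d = ≤≡ (*-zeroʳ (2 * c + 1))
      pointwise true  d = ≤-trans (≤≡ (cong ((2 * c + 1) *_) (+-identityʳ d)))
          (≤-trans (convex c d) (≥≡ (cong₂ _+_ (+-identityʳ (d * d)) (+-identityʳ (c * (c + 1))))))
    arith : ∀ a q b e → a ≤ q + b → q + q ≤ e → 2 * a ≤ e + 2 * b
    arith a q b e h₁ h₂ = by 0 (2 ⊠ h₁ ⊞ h₂) (solve (a ∷ q ∷ b ∷ e ∷ []))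

-- In the absence of loops a vertex is adjacent at most to the other vertices of `P`.
E-inner : ∀ {n} {r : Rel n} → (∀ x → r x x ≡ false) → ∀ P → E r P P + # P ≤ # P * # P
E-inner {r = r} irrefl P = bound (# P) λ x p → ≤-trans
    (≥≡ (#-insert {A = P ∩ r x} {x} (≡false λ q → true≢false (proj₂ (∧⁻ {P x} q)) (irrefl x))))
    (#-mono {A = (P ∩ r x) ∪ ⁅ x ⁆} {P} λ y q →
        [ (λ t → proj₁ (∧⁻ t)) , (λ t → subst (_∈ P) (∈⁅⁆⇒≡ t) p) ]′ (∨⁻ {P y ∧ r x y} q))
  where
  bound : ∀ m → (∀ x → x ∈ P → suc (# (P ∩ r x)) ≤ m) → E r P P + # P ≤ m * # P
  bound zero h with empty? P
  ... | inj₁ (x , p) = case h x p of λ ()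
  ... | inj₂ e = ≤≡ (cong₂ _+_ (E-zero {r = r} {P} {P} λ x y p _ _ → true≢false p (e x)) (∉⇒#≡0 e))
  bound (suc m) h = ≤-trans (E-rows-≤ P P (λ x p → s≤s⁻¹ (h x p)) ⊞ ≤-refl) (≤≡ (+-comm (m * # P) (# P)))

-- Neighbourhoods of sets

nbhd : ∀ {n} → Rel n → Sub n → Sub n
nbhd r A y = any (λ x → A x ∧ r x y)

nbhd⁺ : ∀ {n} {r : Rel n} {A} x y → x ∈ A → r x y ≡ true → y ∈ nbhd r A
nbhd⁺ x y p q = any⁺ x (∧⁺ p q)

nbhd⁻ : ∀ {n} {r : Rel n} {A} y → y ∈ nbhd r A → ∃[ x ] x ∈ A × r x y ≡ true
nbhd⁻ y p = let x , q = any⁻ p in x , ∧⁻ q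

nbhd-mono : ∀ {n} {r : Rel n} {A B} → A ⊆ B → nbhd r A ⊆ nbhd r B
nbhd-mono {r = r} {A} {B} f y p = let x , q , w = nbhd⁻ {r = r} {A} y p in nbhd⁺ {r = r} {B} x y (f x q) w

nbhd-∪ : ∀ {n} {r : Rel n} {A B} y → y ∈ nbhd r (A ∪ B) → y ∈ nbhd r A ⊎ y ∈ nbhd r B
nbhd-∪ {r = r} {A} {B} y p with nbhd⁻ {r = r} {A ∪ B} y p
... | x , q , w with ∨⁻ {A x} q
...   | inj₁ a = inj₁ (nbhd⁺ {r = r} {A} x y a w)
...   | inj₂ b = inj₂ (nbhd⁺ {r = r} {B} x y b w)

-- Neighbourhoods commute with unions, while the neighbourhood of an intersection is only contained
-- in the intersection of the neighbourhoods.
nbhd-submodular : ∀ {n} (r : Rel n) A B →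
  # (nbhd r (A ∩ B)) + # (nbhd r (A ∪ B)) ≤ # (nbhd r A) + # (nbhd r B)
nbhd-submodular r A B = ≤-trans
  (#-mono {A = nbhd r (A ∩ B)} {nbhd r A ∩ nbhd r B}
     (λ y p → ∧⁺ (nbhd-mono {r = r} {A ∩ B} {A} (λ x q → proj₁ (∧⁻ q)) y p)
                 (nbhd-mono {r = r} {A ∩ B} {B} (λ x q → proj₂ (∧⁻ {A x} q)) y p))
   ⊞ #-mono {A = nbhd r (A ∪ B)} {nbhd r A ∪ nbhd r B}
     (λ y p → [ (λ a → ∨⁺ˡ a) , (λ b → ∨⁺ʳ {nbhd r A y} b) ]′ (nbhd-∪ {r = r} {A} {B} y p)))
  (≤≡ (#∩+#∪ (nbhd r A) (nbhd r B)))

-- Partitions and blocks of a transitive group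

record Partition {n} (B : Rel n) : Set where
  field
    self  : ∀ x → x ∈ B x
    class : ∀ {x y} → y ∈ B x → B y ≐ B x
    size  : ℕ
    #B    : ∀ x → # (B x) ≡ size

  swap : ∀ {x y} → y ∈ B x → x ∈ B y
  swap {x} p = trans (class p x) (self x)

  join : ∀ {x y z} → y ∈ B x → z ∈ B y → z ∈ B x
  join {z = z} p q = trans (sym (class p z)) q

  symm : Symm B
  symm x y = bool-ext swap swap

  0<size : Fin n → 1 ≤ size
  0<size x = ≤-trans (∈⇒1≤ (self x)) (≤≡ (#B x))

  Saturated : Sub n → Set
  Saturated F = ∀ {x y} → x ∈ F → y ∈ B x → y ∈ F

  saturated-∁ : ∀ {F} → Saturated F → Saturated (∁ F)
  saturated-∁ {F} s {x} {y} p q = not⁺ (≡false (λ r → true≢false (s r (swap q)) (not⁻ p)))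

  saturated-∪ : ∀ {F F′} → Saturated F → Saturated F′ → Saturated (F ∪ F′)
  saturated-∪ {F} s s′ {x} {y} p q with ∨⁻ {F x} p
  ... | inj₁ a = ∨⁺ˡ (s a q)
  ... | inj₂ b = ∨⁺ʳ {F y} (s′ b q)

  saturated-class : ∀ x → Saturated (B x)
  saturated-class x p q = join p q

  size≤ : ∀ {F x} → Saturated F → x ∈ F → size ≤ # F
  size≤ {F} {x} s p = ≤-trans (≥≡ (#B x)) (#-mono {A = B x} {F} (λ y q → s p q))

  -- Whole classes are split off one at a time; `f` bounds the number of vertices left.
  size-divides : ∀ F → Saturated F → ∃[ m ] # F ≡ m * size
  size-divides F s = go (# F) F s ≤-refl
    where
    go : ∀ f F → Saturated F → # F ≤ f → ∃[ m ] # F ≡ m * size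
    go f F s p with empty? F
    ... | inj₂ e = 0 , ∉⇒#≡0 e
    go zero    F s p | inj₁ (x , x∈F) = ⊥-elim (n≮n 0 (≤-trans (∈⇒1≤ x∈F) p))
    go (suc f) F s p | inj₁ (x , x∈F) =
      let m , e = go f (F ∖ B x) s′ (bound _ _ _ _ (#∩+#∖ F (B x)) p (0<size x) eq) in
      suc m , trans (sym (#∩+#∖ F (B x))) (cong₂ _+_ eq e)
      where
      eq : # (F ∩ B x) ≡ size
      eq = trans (#-cong (⊆-antisym {A = F ∩ B x} {B x} (λ y q → proj₂ (∧⁻ {F y} q))
          (λ y q → ∧⁺ (s x∈F q) q))) (#B x)
      s′ : Saturated (F ∖ B x)
      s′ {y} {z} q r = ∧⁺ (s (proj₁ (∧⁻ q)) r)
        (not⁺ (≡false (λ t → true≢false (join t (swap r)) (not⁻ (proj₂ (∧⁻ {F y} q))))))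
      bound : ∀ i o t b → i + o ≡ t → t ≤ suc f → 1 ≤ b → i ≡ b → o ≤ f
      bound i o t b h₁ h₂ h₃ h₄ = by 0 (≤≡ h₁ ⊞ h₂ ⊞ h₃ ⊞ ≥≡ h₄) (solve (i ∷ o ∷ t ∷ b ∷ f ∷ []))

-- The group is kept apart from any relation it preserves, since it acts on the adjacency, on the
-- adjacency with loops, and on the block relations found later.
record Symmetry (n : ℕ) : Set₁ where
  field
    Aut        : Permutation′ n → Set
    Aut-flip   : ∀ {φ} → Aut φ → Aut (flip φ)
    Aut-∘      : ∀ {φ ψ} → Aut φ → Aut ψ → Aut (φ ∘ₚ ψ)
    transitive : ∀ x y → ∃[ φ ] Aut φ × φ ⟨$⟩ʳ x ≡ y

  Invariant : Rel n → Set
  Invariant r = ∀ φ → Aut φ → ∀ x y → r (φ ⟨$⟩ʳ x) (φ ⟨$⟩ʳ y) ≡ r x y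

  degree-const : ∀ {r} → Invariant r → ∀ x y → # (r x) ≡ # (r y)
  degree-const {r} inv x y with transitive x y
  ... | φ , a , refl = trans (#-cong (λ z → sym (inv φ a x z))) (#-permute (r (φ ⟨$⟩ʳ x)) φ)

  translate : Permutation′ n → Sub n → Sub n
  translate φ A x = A (φ ⟨$⟩ʳ x)

  #-translate : ∀ φ A → # (translate φ A) ≡ # A
  #-translate φ A = #-permute A φ

  d-translate : ∀ {r} → Invariant r → ∀ φ → Aut φ → ∀ A → d r (translate φ A) ≡ d r A
  d-translate inv φ a A = E-permute φ (inv φ a) A (∁ A)

  nbhd-translate : ∀ {r} → Invariant r → ∀ φ → Aut φ → ∀ A → nbhd r (translate φ A) ≐ translate φ (nbhd r A)
  nbhd-translate {r} inv φ a A y = bool-ext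
    (λ p → let x , q , w = nbhd⁻ {r = r} y p in nbhd⁺ {r = r} {A} (φ ⟨$⟩ʳ x) (φ ⟨$⟩ʳ y) q (trans (inv φ a x y) w))
    (λ p → let x , q , w = nbhd⁻ {r = r} {A} (φ ⟨$⟩ʳ y) p in
      nbhd⁺ {r = r} (φ ⟨$⟩ˡ x) y (trans (cong A (inverseʳ φ)) q)
        (trans (sym (inv φ a (φ ⟨$⟩ˡ x) y)) (trans (cong (λ z → r z (φ ⟨$⟩ʳ y)) (inverseʳ φ)) w)))

  -- The translates of `A` cover all vertices by transitivity, and two that meet coincide. `B x` is
  -- the translate along a chosen automorphism taking `x` to `a₀`; another choice gives the same
  -- set.
  module Block (A : Sub n) (a₀ : Fin n) (a₀∈A : a₀ ∈ A)
    (block : ∀ φ → Aut φ → ∀ x → x ∈ A → x ∈ translate φ A → translate φ A ≐ A) where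

    B : Rel n
    B x = translate (proj₁ (transitive x a₀)) A

    translates-meet : ∀ φ ψ → Aut φ → Aut ψ → ∀ x → x ∈ translate φ A → x ∈ translate ψ A →
        translate ψ A ≐ translate φ A
    translates-meet φ ψ a b x p q y = trans (cong (λ z → A (ψ ⟨$⟩ʳ z)) (sym (inverseˡ φ)))
      (block (flip φ ∘ₚ ψ) (Aut-∘ (Aut-flip a) b) (φ ⟨$⟩ʳ x) p
          (trans (cong (λ z → A (ψ ⟨$⟩ʳ z)) (inverseˡ φ)) q) (φ ⟨$⟩ʳ y))

    B-self : ∀ x → x ∈ B x
    B-self x = trans (cong A (proj₂ (proj₂ (transitive x a₀)))) a₀∈A

    partition : Partition B
    partition = record
      { self  = B-self
      ; class = λ {x} {y} p → translates-meet (proj₁ (transitive x a₀)) (proj₁ (transitive y a₀))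
                                (proj₁ (proj₂ (transitive x a₀))) (proj₁ (proj₂ (transitive y a₀)))
                                    y p (B-self y)
      ; size  = # A
      ; #B    = λ x → #-translate (proj₁ (transitive x a₀)) A
      }

    invariant : Invariant B
    invariant φ a x y = translates-meet (proj₁ (transitive x a₀)) (φ ∘ₚ proj₁ (transitive (φ ⟨$⟩ʳ x) a₀))
      (proj₁ (proj₂ (transitive x a₀))) (Aut-∘ a (proj₁ (proj₂ (transitive (φ ⟨$⟩ʳ x) a₀)))) x
          (B-self x) (B-self (φ ⟨$⟩ʳ x)) y

-- Vertex atoms: sets with least excess |N F| - |F|

extended-fragment-arith : ∀ u u′ nu nb nu′ i j b γ → u′ ≡ u + b → nu ≤ u + γ → nb ≡ b + γ → γ ≡ b →
    b ≤ i → i + j ≡ nu + nb → nu′ ≤ j → nu′ ≤ u′ + γ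
extended-fragment-arith u u′ nu nb nu′ i j b γ h₁ h₂ h₃ h₄ h₅ h₆ h₇ =
  by 0 (≥≡ h₁ ⊞ h₂ ⊞ ≤≡ h₃ ⊞ ≤≡ h₄ ⊞ h₅ ⊞ ≤≡ h₆ ⊞ h₇) (solve (u ∷ u′ ∷ nu ∷ nb ∷ nu′ ∷ i ∷ j ∷ b ∷ γ ∷ []))

shrinking-arith : ∀ f n u u′ v v′ b → u + v ≡ n → u′ + v′ ≡ n → u′ ≡ u + b → 1 ≤ b → v < suc f → v′ < f
shrinking-arith f n u u′ v v′ b h₁ h₂ h₃ h₄ h₅ =
  by 0 (≥≡ h₁ ⊞ ≤≡ h₂ ⊞ ≥≡ h₃ ⊞ h₄ ⊞ h₅) (solve (u ∷ u′ ∷ v ∷ v′ ∷ b ∷ f ∷ n ∷ []))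

fragment-arith : ∀ a na f nf γ → na ≡ a + γ → nf ≤ f + γ → nf + a ≤ na + f
fragment-arith a na f nf γ h₁ h₂ =
  by 0 (≥≡ h₁ ⊞ h₂) (solve (a ∷ na ∷ f ∷ nf ∷ γ ∷ []))

cross-arith : ∀ n a a′ f f′ na nf → a + a′ ≡ n → f + f′ ≡ n → na + a′ ≤ nf + f′ → na + f ≤ nf + a
cross-arith n a a′ f f′ na nf h₁ h₂ h₃ =
  by 0 (≥≡ h₁ ⊞ ≤≡ h₂ ⊞ h₃) (solve (a ∷ a′ ∷ f ∷ f′ ∷ na ∷ nf ∷ n ∷ []))

cross⁻-arith : ∀ n a a′ f f′ na nf → a + a′ ≡ n → f + f′ ≡ n → na + f ≤ nf + a → na + a′ ≤ nf + f′
cross⁻-arith n a a′ f f′ na nf h₁ h₂ h₃ =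
  by 0 (≤≡ h₁ ⊞ ≥≡ h₂ ⊞ h₃) (solve (a ∷ a′ ∷ f ∷ f′ ∷ na ∷ nf ∷ n ∷ []))

γ≤c-arith : ∀ γ a na f nf c → na ≡ a + γ → na + f ≤ nf + a → nf ≤ f + c → γ ≤ c
γ≤c-arith γ a na f nf c h₁ h₂ h₃ =
  by 0 (≥≡ h₁ ⊞ h₂ ⊞ h₃) (solve (a ∷ na ∷ f ∷ nf ∷ γ ∷ c ∷ []))

gap-arith : ∀ γ a na f nf → na ≡ a + γ → na + f ≤ nf + a → f + γ ≤ nf
gap-arith γ a na f nf h₁ h₂ =
  by 0 (≥≡ h₁ ⊞ h₂) (solve (a ∷ na ∷ f ∷ nf ∷ γ ∷ []))

odd-order-arith : ∀ u → u + (u + 3) ≡ suc (suc u + suc u)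
odd-order-arith u =
  solve (u ∷ [])

dual-fragment-arith : ∀ n f f′ nf nf′ a na x → nf + a ≤ na + f → x ≤ f′ → f + f′ ≡ n → nf + nf′ ≡ n
    → x + a ≤ na + nf′
dual-fragment-arith n f f′ nf nf′ a na x h₁ h₂ h₃ h₄ =
  by 0 (h₁ ⊞ h₂ ⊞ ≤≡ h₃ ⊞ ≥≡ h₄) (solve (f ∷ f′ ∷ nf ∷ nf′ ∷ a ∷ na ∷ x ∷ n ∷ []))

contained-arith : ∀ a f i j na nf ni nj → na + i < ni + a → ni + nj ≤ na + nf → nf + a ≤ na + f → na
    + j ≤ nj + a → i + j ≡ a + f → ⊥
contained-arith a f i j na nf ni nj h₁ h₂ h₃ h₄ h₅ =
  absurd 0 (h₁ ⊞ h₂ ⊞ h₃ ⊞ h₄ ⊞ ≥≡ h₅) (solve (a ∷ f ∷ i ∷ j ∷ na ∷ nf ∷ ni ∷ nj ∷ []))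

contained-full-arith : ∀ n a i na nf nf′ ni nj nj′ → na + i < ni + a → ni + nj ≤ na + nf → nj′ ≡ 0 →
    nj + nj′ ≡ n → nf + nf′ ≡ n → a ≤ nf′ → ⊥
contained-full-arith n a i na nf nf′ ni nj nj′ h₁ h₂ h₃ h₄ h₅ h₆ =
  absurd i (h₁ ⊞ h₂ ⊞ ≤≡ h₃ ⊞ ≥≡ h₄ ⊞ ≤≡ h₅ ⊞ h₆) (solve (a ∷ i ∷ na ∷ nf ∷ nf′ ∷ ni ∷ nj ∷ nj′ ∷ n ∷ []))

-- A pair of measures has a lexicographically minimal element, up to a
-- double negation which is harmless in the proof of an absurdity.

minimal : {X : Set} (P : X → Set) (μ : X → ℕ) → ∀ a → P a →
          (∀ b → P b → μ b ≤ μ a → (∀ c → P c → μ b ≤ μ c) → ⊥) → ⊥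
minimal {X} P μ a pa k = go (μ a) a pa ≤-refl ≤-refl
  where
  go : ∀ f b → P b → μ b ≤ f → μ b ≤ μ a → ⊥
  down : ∀ f b → μ b ≤ f → μ b ≤ μ a → ∀ c → P c → μ c < μ b → ⊥
  go f b pb b≤f b≤a = k b pb b≤a λ c pc → ≮⇒≥ (down f b b≤f b≤a c pc)
  down zero    b b≤f b≤a c pc lt = n≮n 0 (≤-trans (≤-trans (s≤s z≤n) lt) b≤f)
  down (suc f) b b≤f b≤a c pc lt = go f c pc (s≤s⁻¹ (≤-trans lt b≤f)) (≤-trans (<⇒≤ lt) b≤a)

lexmin : {X : Set} (P : X → Set) (μ ν : X → ℕ) → ∀ a → P a →
         (∀ b → P b → μ b ≤ μ a → (∀ c → P c → μ b ≤ μ c) → (∀ c → P c → μ c ≤ μ b → ν b ≤ ν c) → ⊥) → ⊥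
lexmin P μ ν a pa k = minimal P μ a pa λ b pb b≤a b-min →
  minimal (λ c → P c × μ c ≤ μ b) ν b (pb , ≤-refl) λ c (pc , c≤b) _ c-min →
    k c pc (≤-trans c≤b b≤a) (λ e pe → ≤-trans c≤b (b-min e pe))
        (λ e pe e≤c → c-min e (pe , ≤-trans e≤c c≤b))

record Homogeneous (n : ℕ) : Set₁ where
  field
    symmetry : Symmetry n
  open Symmetry symmetry public
  field
    r            : Rel n
    r-sym        : Symm r
    r-inv        : Invariant r
    κ            : ℕ
    regular      : ∀ x → # (r x) ≡ suc κ
    connected    : ∀ F → Nonempty F → (∀ x y → x ∈ F → r x y ≡ true → y ∈ F) → ∀ x → x ∈ F
    nonbipartite : ∀ (F : Sub n) → (∀ x y → r x y ≡ true → F x ≢ F y) → ⊥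

module VertexAtoms {n : ℕ} (H : Homogeneous n) where

  open Homogeneous H

  D : ℕ
  D = suc κ

  N : Sub n → Sub n
  N = nbhd r

  Admissible : Sub n → Set
  Admissible A = Nonempty A × Nonempty (∁ (N A))

  E-nbhd : ∀ A → E r A (N A) ≡ D * # A
  E-nbhd A = trans (trans (sym (+-identityʳ _)) (sym (cong (E r A (N A) +_) (E-zero {r = r} {A} {full ∖ N A}
      (λ x y p q w → true≢false (nbhd⁺ {r = r} {A} x y p w) (not⁻ q))))))
    (trans (sym (E-splitʳ A full (N A))) (E-full A (λ x _ → regular x)))

  -- Every edge from `A` ends in `N A`, so of the edge ends at `N A` exactly `D * # A` lead back to
  -- `A`.
  E-nbhd-back : ∀ A → D * # A + E r (N A) (∁ A) ≡ D * # (N A)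
  E-nbhd-back A = trans (cong (_+ E r (N A) (∁ A)) (trans (sym (E-nbhd A)) (E-sym r-sym A (N A))))
    (trans (sym (E-splitʳ (N A) full A)) (E-full (N A) (λ x _ → regular x)))

  expand : ∀ A → # A ≤ # (N A)
  expand A = *-cancelˡ-≤ D (≤-trans (m≤m+n _ _) (≤≡ (E-nbhd-back A)))

  -- A partition by the translates of an atom, i.e. of an admissible set A
  -- with γ = # (N A) - # A minimal and then with # A minimal.

  record AtomSystem (c : ℕ) : Set where
    field
      B         : Rel n
      partition : Partition B
      invariant : Invariant B
      γ         : ℕ
      γ≤c       : γ ≤ c
      gap       : ∀ F → Admissible F → # F + γ ≤ # (N F)
      sat       : ∀ F → Admissible F → # (N F) ≤ # F + γ → Partition.Saturated partition F
      sat-N     : ∀ F → Admissible F → # (N F) ≤ # F + γ → Partition.Saturated partition (N F)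
      class-adm : ∀ x → Admissible (B x)
      #N-class  : ∀ x → # (N (B x)) ≡ Partition.size partition + γ

  -- Excesses are compared by adding crosswise, which avoids subtraction: `low` is minimality of the
  -- excess, and `tiny` is minimality of the size among the sets of at most that excess.
  record Atom (A : Sub n) : Set where
    field
      adm  : Admissible A
      low  : ∀ F → Admissible F → # (N A) + # F ≤ # (N F) + # A
      tiny : ∀ F → Admissible F → # (N F) + # A ≤ # (N A) + # F → # A ≤ # F

  translate-adm : ∀ φ → Aut φ → ∀ {A} → Admissible A → Admissible (translate φ A)
  translate-adm φ a {A} ((x , p) , (y , q)) =
    (φ ⟨$⟩ˡ x , trans (cong A (inverseʳ φ)) p) ,
    (φ ⟨$⟩ˡ y , not⁺ (trans (nbhd-translate {r} r-inv φ a A _) (trans (cong (N A) (inverseʳ φ)) (not⁻ q))))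

  #N-translate : ∀ φ → Aut φ → ∀ A → # (N (translate φ A)) ≡ # (N A)
  #N-translate φ a A = trans (#-cong (nbhd-translate {r} r-inv φ a A)) (#-translate φ (N A))

  translate-atom : ∀ φ → Aut φ → ∀ {A} → Atom A → Atom (translate φ A)
  translate-atom φ a {A} at = record
    { adm  = translate-adm φ a (Atom.adm at)
    ; low  = λ F f → subst (λ w → # (N (translate φ A)) + # F ≤ # (N F) + w) (sym (#-translate φ A))
               (subst (λ w → w + # F ≤ # (N F) + # A) (sym (#N-translate φ a A)) (Atom.low at F f))
    ; tiny = λ F f p → subst (_≤ # F) (sym (#-translate φ A)) (Atom.tiny at F f
               (subst (λ w → # (N F) + # A ≤ w + # F) (#N-translate φ a A)
                 (subst (λ w → # (N F) + w ≤ # (N (translate φ A)) + # F) (#-translate φ A) p)))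
    }

  -- The complement of `N F` is a dual of `F`: no edge joins the two, so `F` lies outside the
  -- neighbourhood of its dual.
  dual-adm : ∀ {F} → Admissible F → Admissible (∁ (N F))
  dual-adm {F} ((x , p) , q) = q , (x , not⁺ (≡false λ s →
    let z , t , w = nbhd⁻ {r = r} {∁ (N F)} x s in true≢false (nbhd⁺ {r = r} {F} x z p (trans (r-sym x z) w)) (not⁻ t)))

  #N-dual : ∀ F → # (N (∁ (N F))) ≤ # (∁ F)
  #N-dual F = #-mono {A = N (∁ (N F))} {∁ F} (λ x s → not⁺ (≡false λ p →
    let z , t , w = nbhd⁻ {r = r} {∁ (N F)} x s in true≢false (nbhd⁺ {r = r} {F} x z p (trans (r-sym x z) w)) (not⁻ t)))

  -- The dual has excess at most (n - |F|) - (n - |N F|), which is the excess of `F`.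
  dual-fragment : ∀ {A} F → # (N F) + # A ≤ # (N A) + # F → # (N (∁ (N F))) + # A ≤ # (N A) + # (∁ (N F))
  dual-fragment {A} F p = (dual-fragment-arith n) (# F) (# (∁ F)) (# (N F)) (# (∁ (N F))) (# A)
      (# (N A)) _ p (#N-dual F) (#∁ F) (#∁ (N F))

  -- If `F` cut `A`, then `A ∩ F`, being smaller, would have larger excess than `A`, so by
  -- submodularity `A ∪ F` would have smaller excess. This contradicts `low` unless `N (A ∪ F)` is
  -- everything, and then the sizes contradict that the dual of `F` has at least `# A` vertices.
  contained : ∀ {A F} → Atom A → Admissible F → # (N F) + # A ≤ # (N A) + # F → ∀ x → x ∈ A → x ∈ F → A ⊆ F
  contained {A} {F} at f frag x x∈A x∈F with # A ≤? # (A ∩ F)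
  ... | yes p = λ y q → proj₂ (∧⁻ {A y} (⊆∧≥⇒⊇ {A = A ∩ F} {A} (λ z s → proj₁ (∧⁻ s)) p y q))
  ... | no ¬p = ⊥-elim (rest (empty? (∁ (N (A ∪ F)))))
    where
    open Atom at
    I-adm : Admissible (A ∩ F)
    I-adm = (x , ∧⁺ x∈A x∈F) , (proj₁ (proj₂ adm) , not⁺ (≡false λ s →
      true≢false (nbhd-mono {r = r} {A ∩ F} {A} (λ _ t → proj₁ (∧⁻ t)) _ s) (not⁻ (proj₂ (proj₂ adm)))))
    I-big : # (N A) + # (A ∩ F) < # (N (A ∩ F)) + # A
    I-big = ≰⇒> (λ q → ¬p (tiny (A ∩ F) I-adm q))
    rest : Nonempty (∁ (N (A ∪ F))) ⊎ (∀ y → y ∉ ∁ (N (A ∪ F))) → ⊥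
    rest (inj₁ e) = contained-arith (# A) (# F) (# (A ∩ F)) (# (A ∪ F)) (# (N A)) (# (N F))
        (# (N (A ∩ F))) (# (N (A ∪ F))) I-big (nbhd-submodular r A F) frag
      (low (A ∪ F) ((x , ∨⁺ˡ x∈A) , e)) (#∩+#∪ A F)
    rest (inj₂ e) = (contained-full-arith n) (# A) (# (A ∩ F)) (# (N A)) (# (N F)) (# (∁ (N F)))
        (# (N (A ∩ F))) (# (N (A ∪ F))) (# (∁ (N (A ∪ F)))) I-big (nbhd-submodular r A F) (∉⇒#≡0 e)
        (#∁ (N (A ∪ F))) (#∁ (N F))
      (tiny (∁ (N F)) (dual-adm f) (dual-fragment F frag))

  atom-system : ∀ {c} F → Admissible F → # (N F) ≤ # F + c → (AtomSystem c → ⊥) → ⊥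
  atom-system {c} F₀ f₀ F₀≤ k = lexmin Admissible μ # F₀ f₀ λ A adm A≤F₀ μ-min #-min → k
      (system A adm A≤F₀ μ-min #-min)
    where
    -- The excess is shifted by `n` to make it a natural number.
    μ : Sub n → ℕ
    μ A = # (N A) + # (∁ A)
    cross : ∀ A F → μ A ≤ μ F → # (N A) + # F ≤ # (N F) + # A
    cross A F p = (cross-arith n) (# A) (# (∁ A)) (# F) (# (∁ F)) (# (N A)) (# (N F)) (#∁ A) (#∁ F) p
    cross⁻ : ∀ A F → # (N A) + # F ≤ # (N F) + # A → μ A ≤ μ F
    cross⁻ A F p = (cross⁻-arith n) (# A) (# (∁ A)) (# F) (# (∁ F)) (# (N A)) (# (N F)) (#∁ A) (#∁ F) p
    system : ∀ A → Admissible A → μ A ≤ μ F₀ → (∀ F → Admissible F → μ A ≤ μ F) →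
             (∀ F → Admissible F → μ F ≤ μ A → # A ≤ # F) → AtomSystem c
    system A adm A≤F₀ μ-min #-min = record
      { B = B ; partition = partition ; invariant = invariant ; γ = γ
      ; γ≤c = γ≤c-arith γ (# A) (# (N A)) (# F₀) (# (N F₀)) c γ-eq (cross A F₀ A≤F₀) F₀≤
      ; gap = λ F f → gap-arith γ (# A) (# (N A)) (# F) (# (N F)) γ-eq (cross A F (μ-min F f))
      ; sat = fragment-sat
      -- `N F` is the complement of the dual of `F`, and that dual is again a minimiser.
      ; sat-N = λ F f p {x} {y} q s → trans (sym (not-involutive (N F y)))
          (Partition.saturated-∁ partition {∁ (N F)}
             (λ {u} {v} → fragment-sat′ (∁ (N F)) (dual-adm f) (dual-fragment F (frag F p)) {u} {v})
             (trans (not-involutive (N F x)) q) s)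
      ; class-adm = λ x → translate-adm _ (proj₁ (proj₂ (transitive x a₀))) adm
      ; #N-class = λ x → trans (#N-translate _ (proj₁ (proj₂ (transitive x a₀))) A) γ-eq
      }
      where
      a₀ : Fin n
      a₀ = proj₁ (proj₁ adm)
      atom : Atom A
      atom = record { adm = adm ; low = λ F f → cross A F (μ-min F f) ; tiny = λ F f p → #-min F f
          (cross⁻ F A p) }
      open Block A a₀ (proj₂ (proj₁ adm)) (λ φ a x p q → ⊆-antisym
        (contained (translate-atom φ a atom) adm
            (≤≡ (trans (+-comm (# (N A)) _)
            (trans (cong₂ _+_ (#-translate φ A) (sym (#N-translate φ a A))) (+-comm (# A) _)))) x q p)
        (contained atom (translate-adm φ a adm)
            (≤≡ (cong₂ _+_ (#N-translate φ a A) (sym (#-translate φ A)))) x p q))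
      F-gap : # A ≤ # (N A)
      F-gap = expand A
      γ : ℕ
      γ = # (N A) ∸ # A
      γ-eq : # (N A) ≡ # A + γ
      γ-eq = sym (m+[n∸m]≡n F-gap)
      frag : ∀ F → # (N F) ≤ # F + γ → # (N F) + # A ≤ # (N A) + # F
      frag F p = fragment-arith (# A) (# (N A)) (# F) (# (N F)) γ γ-eq p
      fragment-sat′ : ∀ F → Admissible F → # (N F) + # A ≤ # (N A) + # F → Partition.Saturated partition F
      fragment-sat′ F f p {x} {y} q s = contained (translate-atom φ a atom) f
        (≤-trans (≤≡ (cong (# (N F) +_) (#-translate φ A)))
            (≤-trans p (≥≡ (cong (_+ # F) (#N-translate φ a A)))))
        x (Partition.self partition x) q y s
        where
        φ = proj₁ (transitive x a₀)
        a = proj₁ (proj₂ (transitive x a₀))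
      fragment-sat : ∀ F → Admissible F → # (N F) ≤ # F + γ → Partition.Saturated partition F
      fragment-sat F f p = fragment-sat′ F f (frag F p)

  module _ {c} (S : AtomSystem c) where
    open AtomSystem S
    open Partition partition

    #N-class′ : ∀ x → # (N (B x)) ≡ # (B x) + γ
    #N-class′ x = trans (#N-class x) (cong (_+ γ) (sym (#B x)))

    N-class-sat : ∀ x → Saturated (N (B x))
    N-class-sat x = sat-N (B x) (class-adm x) (≤≡ (#N-class′ x))

    D≤size+γ : Fin n → D ≤ size + γ
    D≤size+γ x = ≤-trans (≥≡ (regular x)) (≤-trans
      (#-mono {A = r x} {N (B x)} (λ y w → nbhd⁺ {r = r} {B x} x y (self x) w)) (≤≡ (#N-class x)))

    -- `N` of a class is a union of classes with `size + γ` vertices.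
    γ-multiple : Fin n → ∃[ m ] γ ≡ m * size
    γ-multiple x with size-divides (N (B x)) (λ {u} {v} → N-class-sat x {u} {v})
    ... | suc m , e = m , +-cancelˡ-≡ size γ (m * size) (trans (sym (#N-class x)) e)
    ... | zero  , e = ⊥-elim (n≮n 0
        (≤-trans (0<size x) (≤-trans (m≤m+n size γ) (≤≡ (trans (sym (#N-class x)) e)))))

    not-full : ∀ x → (∀ y → y ∈ N (B x)) → ⊥
    not-full x f = let y , p = proj₂ (class-adm x) in true≢false (f y) (not⁻ p)

    -- For `γ = 0` all edges from `N A` return to `A`. Then either `A ∩ N A` is nonempty and closed
    -- under adjacency, hence everything, or `A` and `N A` form a bipartition.
    1≤γ : Fin n → 1 ≤ γ
    1≤γ x with 1 ≤? γ
    ... | yes p = p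
    ... | no ¬p = ⊥-elim (rest (empty? (A ∩ N A)))
      where
      A : Sub n
      A = B x
      #N≡ : # (N A) ≡ # A
      #N≡ = trans (#N-class′ x) (trans (cong (# A +_) (n≤0⇒n≡0 (s≤s⁻¹ (≰⇒> ¬p)))) (+-identityʳ _))
      back : ∀ u v → u ∈ N A → r u v ≡ true → v ∈ A
      back u v p w with bool? (A v)
      ... | inj₁ q = q
      ... | inj₂ q = ⊥-elim (n≮n 0 (≤-trans (edge≤E u v p (not⁺ q) w) (≤≡
        (+-cancelˡ-≡ (D * # A) (E r (N A) (∁ A)) 0
            (trans (E-nbhd-back A) (trans (cong (D *_) #N≡) (sym (+-identityʳ _))))))))
      rest : Nonempty (A ∩ N A) ⊎ (∀ y → y ∉ A ∩ N A) → ⊥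
      rest (inj₁ i) = not-full x (λ y → proj₂ (∧⁻ {A y} (connected (A ∩ N A) i
        (λ u v p w → ∧⁺ (back u v (proj₂ (∧⁻ {A u} p)) w) (nbhd⁺ {r = r} {A} u v (proj₁ (∧⁻ p)) w)) y)))
      rest (inj₂ e) = nonbipartite A λ u v w p → case ∨⁻ {A u} (everything u) of λ where
          (inj₁ a) → true≢false (∧⁺ (trans (sym p) a) (nbhd⁺ {r = r} {A} u v a w)) (e v)
          (inj₂ b) → true≢false (∧⁺ (trans p (back u v b w)) b) (e u)
        where
        everything : ∀ y → y ∈ A ∪ N A
        everything = connected (A ∪ N A) (x , ∨⁺ˡ (self x)) λ u v p w → case ∨⁻ {A u} p of λ where
          (inj₁ a) → ∨⁺ʳ {A v} (nbhd⁺ {r = r} {A} u v a w)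
          (inj₂ b) → ∨⁺ˡ (back u v b w)

    -- Here `N A` consists of two classes. Were `A` one of them, the other would by transitivity
    -- also lie in its own neighbourhood, and it is adjacent to `A`; both classes then have the
    -- neighbourhood `N A`, which is closed under adjacency although it is not everything.
    loopless : γ ≡ size → ∀ x → x ∈ N (B x) → ⊥
    loopless e x p = not-full x (connected (N A) (x , p) closed)
      where
      A A₂ : Sub n
      A = B x
      A₂ = N A ∖ A
      A⊆NA : A ⊆ N A
      A⊆NA y q = N-class-sat x p q
      #A₂ : # A₂ ≡ size
      #A₂ = +-cancelˡ-≡ size _ _ (trans (cong (_+ # A₂) (sym (trans (#-cong (⊆-antisym {A = N A ∩ A} {A}
        (λ y q → proj₂ (∧⁻ {N A y} q)) (λ y q → ∧⁺ (A⊆NA y q) q))) (#B x))))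
        (trans (#∩+#∖ (N A) A) (trans (#N-class x) (cong (size +_) e))))
      y₀ : Nonempty A₂
      y₀ = nonempty A₂ (≤-trans (0<size x) (≥≡ #A₂))
      y : Fin n
      y = proj₁ y₀
      y∈NA : y ∈ N A
      y∈NA = proj₁ (∧⁻ (proj₂ y₀))
      A₂-sat : Saturated A₂
      A₂-sat {u} q s = ∧⁺ (N-class-sat x (proj₁ (∧⁻ q)) s)
          (saturated-∁ {A} (saturated-class x) (proj₂ (∧⁻ {N A u} q)) s)
      A₂⊆By : A₂ ⊆ B y
      A₂⊆By = ⊆∧≥⇒⊇ {A = B y} {A₂} (λ z q → A₂-sat (proj₂ y₀) q) (≤≡ (trans #A₂ (sym (#B y))))
      y∈NBy : y ∈ N (B y)
      y∈NBy with transitive x y | nbhd⁻ {r = r} {A} x p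
      ... | φ , a , eq | z , q , w = nbhd⁺ {r = r} {B y} (φ ⟨$⟩ʳ z) y
        (subst (λ t → B t (φ ⟨$⟩ʳ z) ≡ true) eq (trans (invariant φ a x z) q))
        (subst (λ t → r (φ ⟨$⟩ʳ z) t ≡ true) eq (trans (r-inv φ a z x) w))
      NA⊆NBy : N A ⊆ N (B y)
      NA⊆NBy z q with bool? (A z)
      ... | inj₂ s = N-class-sat y y∈NBy (A₂⊆By z (∧⁺ q (not⁺ s)))
      ... | inj₁ s with nbhd⁻ {r = r} {A} y y∈NA
      ...   | v , t , w = N-class-sat y (nbhd⁺ {r = r} {B y} y v (self y) (trans (r-sym y v) w))
          (join (swap t) s)
      NBy⊆NA : N (B y) ⊆ N A
      NBy⊆NA = ⊆∧≥⇒⊇ {A = N A} {N (B y)} NA⊆NBy (≤≡ (trans (#N-class y) (sym (#N-class x))))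
      closed : ∀ u v → u ∈ N A → r u v ≡ true → v ∈ N A
      closed u v q w with bool? (A u)
      ... | inj₁ s = nbhd⁺ {r = r} {A} u v s w
      ... | inj₂ s = NBy⊆NA v (nbhd⁺ {r = r} {B y} u v (A₂⊆By u (∧⁺ q (not⁺ s))) w)

    -- The quotient by the classes is then a cycle.  An independent union U
    -- of classes with # (N U) = # U + γ grows until it exhausts the graph
    -- together with N U, and then n = 2 # U + γ.

    even-order : γ ≡ size → (∀ h → n ≡ h + h → ∀ u → n ≡ u + (u + γ) → ⊥) → Even n → Fin n → ⊥
    even-order γ≡size odd even x₀ = grow _ (B x₀) (class-adm x₀) (≤≡ (#N-class′ x₀)) (class-indep x₀) ≤-refl
      where
      class-indep : ∀ x y → y ∈ B x → y ∈ N (B x) → ⊥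
      class-indep x y p q = loopless γ≡size x (N-class-sat x q (swap p))
      grow : ∀ f U → Admissible U → # (N U) ≤ # U + γ → (∀ x → x ∈ U → x ∈ N U → ⊥) → # (∁ U) < f → ⊥
      grow (suc f) U adm frag indep le = rest (empty? (R ∩ N W))
        where
        W R : Sub n
        W = U ∪ N U
        R = ∁ W
        W-sat : Saturated W
        W-sat {u} {v} = saturated-∪ {U} {N U} (λ {u} {v} → sat U adm frag {u} {v})
            (λ {u} {v} → sat-N U adm frag {u} {v}) {u} {v}
        rest : Nonempty (R ∩ N W) ⊎ (∀ y → y ∉ R ∩ N W) → ⊥
        rest (inj₂ e) = odd (proj₁ (even⁻ even)) (proj₂ (even⁻ even)) (# U)
          (trans (sym (#∁ W)) (trans (cong₂ _+_ #W
              (∉⇒#≡0 {A = R} (λ y → ≡false λ p → true≢false (all y) (not⁻ p)))) (+-identityʳ _)))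
          where
          #W : # W ≡ # U + (# U + γ)
          #W = trans (disjoint-∪ U (N U) indep) (cong (# U +_) (≤-antisym frag (gap U adm)))
          all : ∀ y → y ∈ W
          all = connected W (proj₁ (proj₁ adm) , ∨⁺ˡ (proj₂ (proj₁ adm))) λ u v p w → case bool? (W v) of λ where
            (inj₁ q) → q
            (inj₂ q) → ⊥-elim (true≢false (∧⁺ (not⁺ q) (nbhd⁺ {r = r} {W} u v p w)) (e v))
        rest (inj₁ (y , p)) = grow f U′ adm′ frag′ indep′ less
          where
          U′ : Sub n
          U′ = U ∪ B y
          By⊆R : ∀ z → z ∈ B y → z ∈ W → ⊥
          By⊆R z q s = true≢false (W-sat s (swap q)) (not⁻ (proj₁ (∧⁻ p)))
          U∩NBy : ∀ u → u ∈ U → u ∈ N (B y) → ⊥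
          U∩NBy u q s with nbhd⁻ {r = r} {B y} u s
          ... | z , t , w = By⊆R z t (∨⁺ʳ {U z} (nbhd⁺ {r = r} {U} u z q (trans (r-sym u z) w)))
          x∈ : ∃[ x ] x ∈ N U × x ∈ N (B y)
          x∈ with nbhd⁻ {r = r} {W} y (proj₂ (∧⁻ {R y} p))
          ... | x , q , w with ∨⁻ {U x} q
          ...   | inj₁ s = ⊥-elim (By⊆R y (self y) (∨⁺ʳ {U y} (nbhd⁺ {r = r} {U} x y s w)))
          ...   | inj₂ s = x , s , nbhd⁺ {r = r} {B y} y x (self y) (trans (r-sym y x) w)
          #U′ : # U′ ≡ # U + size
          #U′ = trans (disjoint-∪ U (B y) (λ z q s → By⊆R z s (∨⁺ˡ q))) (cong (# U +_) (#B y))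
          -- Both neighbourhoods are unions of classes, so a common vertex brings a common class;
          -- `N U` thus grows by at most one class, as `U` does.
          common : size ≤ # (N U ∩ N (B y))
          common = let x , q , s = x∈ in ≤-trans (≥≡ (#B x)) (#-mono {A = B x} {N U ∩ N (B y)}
            (λ z t → ∧⁺ (sat-N U adm frag q t) (N-class-sat y s t)))
          frag′ : # (N U′) ≤ # U′ + γ
          frag′ = extended-fragment-arith (# U) (# U′) (# (N U)) (# (N (B y))) (# (N U′))
              (# (N U ∩ N (B y))) (# (N U ∪ N (B y))) size γ
            #U′ frag (#N-class y) γ≡size common (#∩+#∪ (N U) (N (B y)))
            (#-mono {A = N U′} {N U ∪ N (B y)} (λ z q → [ (λ a → ∨⁺ˡ a) , (λ b → ∨⁺ʳ {N U z} b) ]′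
                (nbhd-∪ {r = r} {U} {B y} z q)))
          adm′ : Admissible U′
          adm′ = let u , q = proj₁ adm in (u , ∨⁺ˡ q) , (u , not⁺ (≡false λ s →
            [ indep u q , U∩NBy u q ]′ (nbhd-∪ {r = r} {U} {B y} u s)))
          indep′ : ∀ x → x ∈ U′ → x ∈ N U′ → ⊥
          indep′ x q s with ∨⁻ {U x} q | nbhd-∪ {r = r} {U} {B y} x s
          ... | inj₁ a | inj₁ b = indep x a b
          ... | inj₁ a | inj₂ b = U∩NBy x a b
          ... | inj₂ a | inj₁ b = By⊆R x a (∨⁺ʳ {U x} b)
          ... | inj₂ a | inj₂ b = class-indep y x a b
          less : # (∁ U′) < f
          less = (shrinking-arith f n) (# U) (# U′) (# (∁ U)) (# (∁ U′)) size (#∁ U) (#∁ U′) #U′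
              (0<size y) le

  module _ {c} (S : AtomSystem c) (x : Fin n) where
    open AtomSystem S
    open Partition partition

    -- The neighbours of one vertex fit into `N` of its class, and `γ` is a positive multiple of
    -- `size`. The strict bounds by `suc c` are the form over which `check` enumerates.
    shape : ∃[ m ] γ ≡ m * size × γ < suc c × size < suc c × m < suc c × 1 ≤ γ × D ≤ size + γ
    shape with γ-multiple S x
    ... | m , e = m , e , s≤s γ≤c , s≤s (≤-trans (size≤γ m e (1≤γ S x)) γ≤c) , s≤s (≤-trans (m≤γ m e) γ≤c) ,
                  1≤γ S x , D≤size+γ S x
      where
      size≤γ : ∀ m → γ ≡ m * size → 1 ≤ γ → size ≤ γ
      size≤γ zero    e p = ⊥-elim (n≮n 0 (≤-trans p (≤≡ e)))
      size≤γ (suc m) e p = ≤-trans (m≤m+n size (m * size)) (≥≡ e)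
      m≤γ : ∀ m → γ ≡ m * size → m ≤ γ
      m≤γ m e = ≤-trans (≤-trans (≥≡ (*-identityʳ m)) (m ⊠ 0<size x)) (≥≡ e)

  private
    check : ∀ c D (Q : ℕ → ℕ → Set) (Q? : ∀ γ b → Dec (Q γ b)) →
            Dec (∀ {γ} → γ < c → ∀ {b} → b < c → ∀ {m} → m < c → γ ≡ m * b → 1 ≤ γ → D ≤ b + γ → Q γ b)
    check c D Q Q? = allUpTo? (λ γ → allUpTo? (λ b → allUpTo? (λ m →
      (γ ≟ᴺ m * b) →-dec ((1 ≤? γ) →-dec ((D ≤? b + γ) →-dec Q? γ b))) c) c) c

  -- For `γ` at most 3 only `γ = size = 3` survives, and then `n` would be `u + (u + 3)`, an odd
  -- number.
  gap≥4 : 5 ≤ D → Even n → ∀ F → Admissible F → # (N F) ≤ # F + 3 → ⊥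
  gap≥4 5≤D even F adm p = atom-system F adm p λ S → case shape S x of λ where
      (m , e , a , b , c , d , f) → case toWitness
          {a? = check 4 5 (λ γ b → γ ≡ b × b ≡ 3) (λ γ b → (γ ≟ᴺ b) ×-dec (b ≟ᴺ 3))} tt
          a b c e d (≤-trans 5≤D f) of λ where
        (γ≡size , size≡3) → even-order S γ≡size
          (λ h n≡ u n≡′ → parity h u (trans (sym n≡)
              (trans n≡′ (cong (λ w → u + (u + w)) (trans γ≡size size≡3))))) even x
    where
    x : Fin n
    x = proj₁ (proj₁ adm)
    parity : ∀ h u → h + h ≡ u + (u + 3) → ⊥
    parity h u e = odd≢even h (suc u) (trans e (odd-order-arith u))

  -- Besides `γ = size = 3`, which is excluded as above, only `γ = 4` with classes of 2 or 4
  -- vertices survives, and a set of excess 4 is then a union of even classes.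
  even≥4 : 6 ≤ D → Even n → ∀ F → Admissible F → # (N F) ≤ # F + 4 → (Even (# F) → ⊥) → ⊥
  even≥4 6≤D even F adm p k = atom-system F adm p λ S → case shape S x of λ where
      (m , e , a , b , c , d , f) → case toWitness
          {a? = check 5 6 (λ γ b → (γ ≡ b × b ≡ 3) ⊎ (γ ≡ 4 × (b ≡ 2 ⊎ b ≡ 4)))
          (λ γ b → ((γ ≟ᴺ b) ×-dec (b ≟ᴺ 3)) ⊎-dec ((γ ≟ᴺ 4) ×-dec ((b ≟ᴺ 2) ⊎-dec (b ≟ᴺ 4))))} tt
          a b c e d (≤-trans 6≤D f) of λ where
        (inj₁ (γ≡size , size≡3)) → gap≥4 (≤-trans (n≤1+n 5) 6≤D) even (AtomSystem.B S x)
            (AtomSystem.class-adm S x)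
          (≤≡ (trans (#N-class′ S x) (cong (# (AtomSystem.B S x) +_) (trans γ≡size size≡3))))
        (inj₂ (γ≡4 , q)) → k (union-even S γ≡4 q)
    where
    x : Fin n
    x = proj₁ (proj₁ adm)
    union-even : (S : AtomSystem 4) → AtomSystem.γ S ≡ 4 →
      (Partition.size (AtomSystem.partition S) ≡ 2 ⊎ Partition.size (AtomSystem.partition S) ≡ 4) →
          Even (# F)
    union-even S γ≡4 q = let m , e = size-divides F (λ {u} {v} → sat F adm (≤-trans p (≥≡ (cong (# F +_) γ≡4))) {u} {v}) in
      subst Even (sym e) (even-* m ([ (λ e → even⁺ 1 e) , (λ e → even⁺ 2 e) ]′ q))
      where
      open AtomSystem S
      open Partition partition

  module _ (reflexive : ∀ x → r x x ≡ true) where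

    loop : ∀ {c} (S : AtomSystem c) (x : Fin n) → x ∈ N (AtomSystem.B S x)
    loop S x = nbhd⁺ {r = r} {AtomSystem.B S x} x x (Partition.self (AtomSystem.partition S) x)
        (reflexive x)

    -- With loops a class meets its own neighbourhood, which rules out `γ = size`; what survives is
    -- `γ = 4` with classes of two vertices.
    reflexive-even≥4 : 6 ≤ D → ∀ F → Admissible F → # (N F) ≤ # F + 4 → (Even (# F) → ⊥) → ⊥
    reflexive-even≥4 6≤D F adm p k = atom-system F adm p λ S → case shape S x of λ where
        (m , e , a , b , c , d , f) → case toWitness {a? = check 5 6 (λ γ b → γ ≡ b ⊎ (γ ≡ 4 × b ≡ 2))
            (λ γ b → (γ ≟ᴺ b) ⊎-dec ((γ ≟ᴺ 4) ×-dec (b ≟ᴺ 2)))} tt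
            a b c e d (≤-trans 6≤D f) of λ where
          (inj₁ γ≡size)    → loopless S γ≡size x (loop S x)
          (inj₂ (γ≡4 , q)) → k (union-even S γ≡4 q)
      where
      x : Fin n
      x = proj₁ (proj₁ adm)
      union-even : (S : AtomSystem 4) → AtomSystem.γ S ≡ 4 → Partition.size (AtomSystem.partition S)
          ≡ 2 → Even (# F)
      union-even S γ≡4 q = let m , e = size-divides F (λ {u} {v} → sat F adm (≤-trans p (≥≡ (cong (# F +_) γ≡4))) {u} {v}) in
        subst Even (sym e) (even-* m (even⁺ 1 q))
        where
        open AtomSystem S
        open Partition partition

    -- Among the divisors of a `γ` up to 5, only `size = γ` gives `size + γ` at least 7, and loops
    -- exclude it.
    reflexive-gap≥6 : 7 ≤ D → ∀ F → Admissible F → # (N F) ≤ # F + 5 → ⊥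
    reflexive-gap≥6 7≤D F adm p = atom-system F adm p λ S → case shape S x of λ where
        (m , e , a , b , c , d , f) → loopless S
            (toWitness {a? = check 6 7 (λ γ b → γ ≡ b) (λ γ b → γ ≟ᴺ b)} tt
          a b c e d (≤-trans 7≤D f)) x (loop S x)
      where
      x : Fin n
      x = proj₁ (proj₁ adm)

-- Edge atoms: sets with least cut

union-admissible-arith : ∀ n a b a′ i j j′ → a′ ≡ a → a ≤ b → a + b ≡ n → j + j′ ≡ n → i + j ≡ a +
    a′ → i ≤ j′
union-admissible-arith n a b a′ i j j′ h₁ h₂ h₃ h₄ h₅ =
  by 0 (≤≡ h₁ ⊞ h₂ ⊞ ≤≡ h₃ ⊞ ≥≡ h₄ ⊞ ≤≡ h₅) (solve (a ∷ b ∷ a′ ∷ i ∷ j ∷ j′ ∷ n ∷ []))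

submodular-arith : ∀ a a′ i j → i + j ≤ a + a′ → a′ ≡ a → a < i → a ≤ j → ⊥
submodular-arith a a′ i j h₁ h₂ h₃ h₄ =
  absurd 0 (h₁ ⊞ ≤≡ h₂ ⊞ h₃ ⊞ h₄) (solve (a ∷ a′ ∷ i ∷ j ∷ []))

difference-size-arith : ∀ s a i k → i + k ≡ a → 1 ≤ i → i < s → 2 * s ≤ suc a → s ≤ k × k < a
difference-size-arith s a i k h₁ h₂ h₃ h₄ =
  by 0 (≥≡ h₁ ⊞ h₃ ⊞ h₄) (solve (a ∷ i ∷ k ∷ s ∷ [])) , by 0 (≤≡ h₁ ⊞ h₂) (solve (a ∷ i ∷ k ∷ []))

posimodular-arith : ∀ a a′ i j → i + j ≤ a + a′ → a′ ≡ a → a < i → a < j → ⊥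
posimodular-arith a a′ i j h₁ h₂ h₃ h₄ =
  absurd 1 (h₁ ⊞ ≤≡ h₂ ⊞ h₃ ⊞ h₄) (solve (a ∷ a′ ∷ i ∷ j ∷ []))

module EdgeAtoms {n : ℕ} (H : Homogeneous n) (s : ℕ) (1≤s : 1 ≤ s) where

  open Homogeneous H

  Admissible : Sub n → Set
  Admissible A = s ≤ # A × s ≤ # (∁ A)

  record AtomSystem (c : ℕ) : Set where
    field
      B         : Rel n
      partition : Partition B
      invariant : Invariant B
      δ         : ℕ
      δ≤c       : δ ≤ c
      d-class   : ∀ x → d r (B x) ≡ δ
      class-adm : ∀ x → Admissible (B x)
      low       : ∀ F → Admissible F → δ ≤ d r F

  -- Uncrossing: when `A` and a translate share at least `s` vertices, submodularity is applied to
  -- their intersection and union; otherwise both differences keep at least `s` vertices by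
  -- `2 * s ≤ suc (# A)`, and posimodularity applies. Smaller admissible sets have strictly larger
  -- cuts, so translates that meet are equal.
  atom-system : ∀ {c} F → Admissible F → d r F ≤ c → (∀ A → Admissible A → d r A ≤ c → 2 * s ≤ suc (# A)) →
                (AtomSystem c → ⊥) → ⊥
  atom-system {c} F₀ f₀ F₀≤c large k = lexmin Admissible (d r) # F₀ f₀ λ A adm A≤F₀ d-min #-min → k
      (system A adm (≤-trans A≤F₀ F₀≤c) d-min #-min)
    where
    system : ∀ A → Admissible A → d r A ≤ c → (∀ F → Admissible F → d r A ≤ d r F) →
             (∀ F → Admissible F → d r F ≤ d r A → # A ≤ # F) → AtomSystem c
    system A adm A≤c d-min #-min = record
      { B = B ; partition = partition ; invariant = invariant ; δ = d r A ; δ≤c = A≤c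
      ; d-class = λ x → d-translate {r} r-inv _ (proj₁ (proj₂ (transitive x a₀))) A
      ; class-adm = λ x → translate-adm (proj₁ (transitive x a₀))
      ; low = d-min
      }
      where
      translate-adm : ∀ φ → Admissible (translate φ A)
      translate-adm φ = ≤-trans (proj₁ adm) (≥≡ (#-translate φ A)) , ≤-trans (proj₂ adm)
          (≥≡ (#-translate φ (∁ A)))
      -- The complement has the same cut and so competes for least size; hence the complement of a
      -- union of two translates is at least as large as their intersection.
      half : # A ≤ # (∁ A)
      half = #-min (∁ A) (proj₂ adm , ≤-trans (proj₁ adm)
          (#-mono {A = A} (λ x p → trans (not-involutive (A x)) p))) (≤≡ (d-∁ r-sym A))
      heavier : ∀ F → Admissible F → # F < # A → d r A < d r F
      heavier F f p = ≰⇒> λ q → n≮n _ (≤-trans p (#-min F f q))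
      block : ∀ φ → Aut φ → ∀ x → x ∈ A → x ∈ translate φ A → translate φ A ≐ A
      block φ a x p q with # A ≤? # (A ∩ translate φ A)
      ... | yes le = ⊆-antisym {A = A′} {A} (⊆∧≥⇒⊇ {A = A} {A′} A⊆A′ (≤≡ (#-translate φ A))) A⊆A′
        where
        A′ = translate φ A
        A⊆A′ : A ⊆ A′
        A⊆A′ y t = proj₂ (∧⁻ {A y} (⊆∧≥⇒⊇ {A = A ∩ A′} {A} (λ z u → proj₁ (∧⁻ u)) le y t))
      ... | no ¬le with s ≤? # (A ∩ translate φ A)
      ...   | yes s≤I = ⊥-elim (submodular-arith (d r A) (d r A′) (d r (A ∩ A′)) (d r (A ∪ A′))
          (d-submodular {r = r} A A′) dA′
                (heavier (A ∩ A′) I-adm (≰⇒> ¬le)) (d-min (A ∪ A′) J-adm))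
        where
        A′ = translate φ A
        dA′ : d r A′ ≡ d r A
        dA′ = d-translate {r} r-inv φ a A
        I-adm : Admissible (A ∩ A′)
        I-adm = s≤I , ≤-trans (proj₂ adm)
            (#-mono {A = ∁ A} {∁ (A ∩ A′)} (λ y t → not⁺ (≡false λ u → true≢false (proj₁ (∧⁻ u)) (not⁻ t))))
        J-adm : Admissible (A ∪ A′)
        J-adm = ≤-trans (proj₁ adm) (#-mono {A = A} {A ∪ A′} (λ y t → ∨⁺ˡ t)) ,
          ≤-trans s≤I ((union-admissible-arith n) (# A) (# (∁ A)) (# A′) (# (A ∩ A′)) (# (A ∪ A′))
              (# (∁ (A ∪ A′))) (#-translate φ A) half (#∁ A) (#∁ (A ∪ A′)) (#∩+#∪ A A′))
      ...   | no s≰I = ⊥-elim (posimodular-arith (d r A) (d r A′) (d r (A ∖ A′)) (d r (A′ ∖ A))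
          (d-posimodular {r = r} r-sym A A′) dA′
                (heavier (A ∖ A′) (proj₁ K-adm) (proj₂ K-adm))
                    (heavier (A′ ∖ A) (proj₁ K′-adm) (proj₂ K′-adm)))
        where
        A′ = translate φ A
        dA′ : d r A′ ≡ d r A
        dA′ = d-translate {r} r-inv φ a A
        1≤I : 1 ≤ # (A ∩ A′)
        1≤I = ∈⇒1≤ {A = A ∩ A′} (∧⁺ p q)
        adm∖ : ∀ {F F′ : Sub n} → s ≤ # (F ∖ F′) → s ≤ # (∁ F) → Admissible (F ∖ F′)
        adm∖ {F} {F′} h₁ h₂ = h₁ , ≤-trans h₂
            (#-mono {A = ∁ F} {∁ (F ∖ F′)} (λ y t → not⁺ (≡false λ u → true≢false (proj₁ (∧⁻ u)) (not⁻ t))))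
        K-adm : Admissible (A ∖ A′) × # (A ∖ A′) < # A
        K-adm = let h₁ , h₂ = (difference-size-arith s) _ _ (# (A ∖ A′)) (#∩+#∖ A A′) 1≤I (≰⇒> s≰I) (large A adm A≤c) in adm∖ h₁ (proj₂ adm) , h₂
        K′-adm : Admissible (A′ ∖ A) × # (A′ ∖ A) < # A
        K′-adm = let h₁ , h₂ = (difference-size-arith s) _ _ (# (A′ ∖ A)) (trans (#∩+#∖ A′ A) (#-translate φ A))
                                 (≤-trans 1≤I (≤≡ I≡)) (≤-trans (≥≡ (cong suc I≡)) (≰⇒> s≰I))
                                     (large A adm A≤c)
                 in adm∖ h₁ (proj₂ (translate-adm φ)) , h₂
          where
          I≡ : # (A ∩ A′) ≡ # (A′ ∩ A)
          I≡ = #-cong (∩-comm A A′)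
      a₀₀ : Nonempty A
      a₀₀ = nonempty A (≤-trans 1≤s (proj₁ adm))
      a₀ : Fin n
      a₀ = proj₁ a₀₀
      open Block A a₀ (proj₂ a₀₀) block

-- Cuts in classes joined by a perfect matching

three-cuts-arith : ∀ κ a b e d → κ ≤ a → κ ≤ b → κ ≤ e → a + (b + e) ≤ d → 3 * κ ≤ d
three-cuts-arith κ a b e d h₁ h₂ h₃ h₄ =
  by 0 (h₁ ⊞ h₂ ⊞ h₃ ⊞ h₄) (solve (κ ∷ a ∷ b ∷ e ∷ d ∷ []))

two-middle-arith : ∀ κ a b d → 4 ≤ κ → 2 * κ ≤ a + 2 → 2 * κ ≤ b + 2 → a + b ≤ d → 3 * κ ≤ d
two-middle-arith κ a b d h₁ h₂ h₃ h₄ =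
  by 0 (h₁ ⊞ h₂ ⊞ h₃ ⊞ h₄) (solve (κ ∷ a ∷ b ∷ d ∷ []))

single-rest-arith : ∀ c i o a → 3 ≤ c → i + o ≡ a → i ≤ 1 → c ≤ a → 1 ≤ o
single-rest-arith c i o a 3≤c h₁ h₂ h₃ =
  by 1 (≥≡ h₁ ⊞ h₂ ⊞ h₃ ⊞ 3≤c) (solve (i ∷ o ∷ a ∷ c ∷ []))

middle-arith : ∀ c m i o b → i + o ≡ b → 2 * c ≤ suc b → b ≤ m + i → b ≤ m + o → c ≤ m
middle-arith c m i o b h₁ h₂ h₃ h₄ =
  ≮⇒≥ λ (m<c : m < c) → absurd 0 (≤≡ h₁ ⊞ h₂ ⊞ h₃ ⊞ h₄ ⊞ 2 ⊠ m<c) (solve (i ∷ o ∷ b ∷ m ∷ c ∷ []))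

single-out-arith : ∀ m m₀ i b → m₀ ≤ m + 1 → b ≤ m₀ + i → i ≤ 1 → b ≤ m + 2
single-out-arith m m₀ i b h₁ h₂ h₃ =
  by 0 (h₁ ⊞ h₂ ⊞ h₃) (solve (m ∷ m₀ ∷ i ∷ b ∷ []))

two-single-arith : ∀ κ a b d → κ ≤ a → κ ≤ b → a + b ≤ d → 2 * κ ≤ d
two-single-arith κ a b d h₁ h₂ h₃ =
  by 0 (h₁ ⊞ h₂ ⊞ h₃) (solve (κ ∷ a ∷ b ∷ d ∷ []))

single-middle-arith : ∀ κ a b d → κ ≤ a → 2 * κ ≤ b + 2 → a + b ≤ d → 3 * κ ≤ d + 2
single-middle-arith κ a b d h₁ h₂ h₃ =
  by 0 (h₁ ⊞ h₂ ⊞ h₃) (solve (κ ∷ a ∷ b ∷ d ∷ []))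

middle-out-arith : ∀ m m₀ i o b → m₀ ≤ m + 1 → b ≤ m₀ + i → i + o ≡ b → 2 ≤ o → 1 ≤ m
middle-out-arith m m₀ i o b h₁ h₂ h₃ h₄ =
  by 0 (h₁ ⊞ h₂ ⊞ ≤≡ h₃ ⊞ h₄) (solve (m ∷ m₀ ∷ i ∷ o ∷ b ∷ []))

two-single-rest-arith : ∀ a i i′ o o′ → 3 ≤ a → i ≤ 1 → i′ ≤ 1 → i + o′ ≡ a → i′ + o ≡ o′ → 1 ≤ o
two-single-rest-arith a i i′ o o′ h₁ h₂ h₃ h₄ h₅ =
  by 0 (h₁ ⊞ h₂ ⊞ h₃ ⊞ ≥≡ h₄ ⊞ ≥≡ h₅) (solve (a ∷ i ∷ i′ ∷ o ∷ o′ ∷ []))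

-- A graph split into classes joined by a perfect matching
-- out; κ is the degree inside the classes.

record Matched {n : ℕ} (B : Rel n) : Set where
  field
    partition : Partition B
  open Partition partition public
  field
    in′ out      : Rel n
    in⊆B         : ∀ x y → in′ x y ≡ true → y ∈ B x
    out⊆∁B       : ∀ x y → out x y ≡ true → y ∈ B x → ⊥
    out-sym      : Symm out
    #out         : ∀ x → # (out x) ≡ 1
    κ            : ℕ
    4≤κ          : 4 ≤ κ
    union-bound  : ∀ F → Saturated F → Nonempty F → Nonempty (∁ F) → size ≤ d out F
    piece-bound  : ∀ z P → P ⊆ B z → 1 ≤ # P → 1 ≤ # (B z ∖ P) → κ ≤ d in′ P
    middle-bound : ∀ z P → P ⊆ B z → 2 ≤ # P → 2 ≤ # (B z ∖ P) → 2 * κ ≤ d in′ P + 2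
    -- Both sides of the sets to be measured will have at least `c` vertices; being at most half a
    -- class, rounded up, it bounds the matching edges in the case `middle`.
    c            : ℕ
    3≤c          : 3 ≤ c
    2c≤size      : 2 * c ≤ suc size

module Profiles {n : ℕ} {B : Rel n} (M : Matched B) where

  open Matched M

  -- For a set left by m edges of out and i edges of in′.  A piece of a class
  -- is single if it, or the rest of the class, is one vertex.

  data Profile (m i : ℕ) : Set where
    union         : size ≤ m → Profile m i
    single        : size ≤ m + 1 → κ ≤ i → Profile m i
    middle        : c ≤ m → 2 * κ ≤ i + 2 → Profile m i
    single-single : size ≤ m + 2 → 2 * κ ≤ i → Profile m i
    single-middle : 1 ≤ m → 3 * κ ≤ i + 2 → Profile m i
    inner         : 3 * κ ≤ i → Profile m i

  -- No class other than `B z` is split by `C`, so that removing or adding `B z` gives a union of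
  -- classes.
  OnlyIn : Sub n → Fin n → Set
  OnlyIn C z = ∀ {x y} → x ∈ C → y ∈ B x → y ∉ C → x ∈ B z

  down-saturated : ∀ {C z} → OnlyIn C z → Saturated (C ∖ B z)
  down-saturated {C} {z} h {x} {y} p q with ∧⁻ {C x} p | bool? (C y)
  ... | x∈C , x∉z | inj₁ y∈C = ∧⁺ y∈C (saturated-∁ {B z} (saturated-class z) x∉z q)
  ... | x∈C , x∉z | inj₂ y∉C = ⊥-elim (true≢false (h x∈C q y∉C) (not⁻ x∉z))

  up-saturated : ∀ {C z} → OnlyIn C z → Saturated (C ∪ B z)
  up-saturated {C} {z} h {x} {y} p q with bool? (B z x)
  ... | inj₁ x∈z = ∨⁺ʳ {C y} (join x∈z q)
  ... | inj₂ x∉z with ∨⁻ {C x} p | bool? (C y)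
  ...   | inj₂ s | _ = ⊥-elim (true≢false s x∉z)
  ...   | inj₁ s | inj₁ t = ∨⁺ˡ t
  ...   | inj₁ s | inj₂ t = ⊥-elim (true≢false (h s q t) x∉z)

  d-down : ∀ C z → d out (C ∖ B z) ≤ d out C + # (C ∩ B z)
  d-down C z = ≤-trans (d-lipschitz out-sym #out C (C ∖ B z)) (≤≡ (cong (d out C +_) (cong₂ _+_
    (∉⇒#≡0 {A = (C ∖ B z) ∖ C} (λ x → lem₁ (C x) (B z x))) (#-cong (λ x → lem₂ (C x) (B z x))))))
    where
    lem₁ : ∀ a b → (a ∧ not b) ∧ not a ≡ false
    lem₁ true  true  = refl
    lem₁ true  false = refl
    lem₁ false b     = refl
    lem₂ : ∀ a b → a ∧ not (a ∧ not b) ≡ a ∧ b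
    lem₂ true  b = not-involutive b
    lem₂ false b = refl

  d-up : ∀ C z → d out (C ∪ B z) ≤ d out C + # (B z ∖ C)
  d-up C z = ≤-trans (d-lipschitz out-sym #out C (C ∪ B z)) (≤≡ (cong (d out C +_) (trans (cong₂ _+_
    (#-cong (λ x → lem₁ (C x) (B z x))) (∉⇒#≡0 {A = C ∖ (C ∪ B z)} (λ x → lem₂ (C x) (B z x))))
        (+-identityʳ _))))
    where
    lem₁ : ∀ a b → (a ∨ b) ∧ not a ≡ b ∧ not a
    lem₁ true  true  = refl
    lem₁ true  false = refl
    lem₁ false b     = refl
    lem₂ : ∀ a b → a ∧ not (a ∨ b) ≡ false
    lem₂ true  b = refl
    lem₂ false b = refl

  -- What remains without `B z` is a union of classes with cut at least `size`, and each vertex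
  -- removed accounts for at most one edge of it.
  out-down : ∀ {C z} → OnlyIn C z → Nonempty (C ∖ B z) → size ≤ d out C + # (C ∩ B z)
  out-down {C} {z} h e = ≤-trans (union-bound (C ∖ B z) (down-saturated {C} {z} h) e
    (z , not⁺ (≡false λ p → true≢false (self z) (not⁻ (proj₂ (∧⁻ {C z} p)))))) (d-down C z)

  out-up : ∀ {C z} → OnlyIn C z → Nonempty (∁ (C ∪ B z)) → size ≤ d out C + # (B z ∖ C)
  out-up {C} {z} h e = ≤-trans (union-bound (C ∪ B z) (up-saturated {C} {z} h)
      (z , ∨⁺ʳ {C z} (self z)) e) (d-up C z)

  -- Edges of `in′` stay in their class, so one that leaves the piece leaves all of `C`.
  cut : ∀ C z → d in′ (C ∩ B z) ≤ E in′ (C ∩ B z) (∁ C)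
  cut C z = E-mono′ λ x y p q w → p , not⁺
      (≡false λ s → true≢false (∧⁺ s (join (proj₂ (∧⁻ {C x} p)) (in⊆B x y w))) (not⁻ q)) , w

  two-cuts : ∀ C z₁ z₂ → z₂ ∉ B z₁ → d in′ (C ∩ B z₁) + d in′ (C ∩ B z₂) ≤ d in′ C
  two-cuts C z₁ z₂ h = ≤-trans (cut C z₁ ⊞ ≤-trans (cut C z₂)
    (E-mono′ {A′ = C ∖ B z₁} {B′ = ∁ C} λ x y p q w → ∧⁺ (proj₁ (∧⁻ p)) (not⁺ (≡false λ s →
      true≢false (join s (swap (proj₂ (∧⁻ {C x} p)))) h)) , q , w)) (≥≡ (E-splitˡ C (∁ C) (B z₁)))

  three-cuts : ∀ C z₁ z₂ z₃ → z₂ ∉ B z₁ → z₃ ∉ B z₁ → z₃ ∉ B z₂ →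
               d in′ (C ∩ B z₁) + (d in′ (C ∩ B z₂) + d in′ (C ∩ B z₃)) ≤ d in′ C
  three-cuts C z₁ z₂ z₃ h₁₂ h₁₃ h₂₃ = ≤-trans (cut C z₁ ⊞ (≤-trans (cut C z₂)
      (E-mono′ {A′ = (C ∖ B z₁) ∩ B z₂} {B′ = ∁ C} λ x y p q w → ∧⁺
          (∧⁺ (proj₁ (∧⁻ p)) (apart h₁₂ (proj₂ (∧⁻ {C x} p)))) (proj₂ (∧⁻ {C x} p)) , q , w)
    ⊞ ≤-trans (cut C z₃)
      (E-mono′ {A′ = (C ∖ B z₁) ∖ B z₂} {B′ = ∁ C} λ x y p q w → ∧⁺
          (∧⁺ (proj₁ (∧⁻ p)) (apart h₁₃ (proj₂ (∧⁻ {C x} p)))) (apart h₂₃ (proj₂ (∧⁻ {C x} p))) , q , w)))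
    (≤-trans (≤-refl ⊞ ≥≡ (E-splitˡ (C ∖ B z₁) (∁ C) (B z₂))) (≥≡ (E-splitˡ C (∁ C) (B z₁))))
    where
    apart : ∀ {z z′ x} → z′ ∉ B z → x ∈ B z′ → not (B z x) ≡ true
    apart h p = not⁺ (≡false λ s → true≢false (join s (swap p)) h)

  #piece : ∀ C z → # (C ∩ B z) + # (B z ∖ C) ≡ size
  #piece C z = trans (cong (_+ # (B z ∖ C)) (#-cong (∩-comm C (B z)))) (trans (#∩+#∖ (B z) C) (#B z))

  Crossing : Sub n → Fin n → Set
  Crossing C z = 1 ≤ # (C ∩ B z) × 1 ≤ # (B z ∖ C)

  #rest : ∀ C z → # (B z ∖ (C ∩ B z)) ≡ # (B z ∖ C)
  #rest C z = #-cong (λ x → lem (C x) (B z x))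
    where
    lem : ∀ a b → b ∧ not (a ∧ b) ≡ b ∧ not a
    lem true  true  = refl
    lem false true  = refl
    lem a     false = refl

  crossing-cut : ∀ {C z} → Crossing C z → κ ≤ d in′ (C ∩ B z)
  crossing-cut {C} {z} (p , q) = piece-bound z (C ∩ B z) (λ x s → proj₂ (∧⁻ {C x} s)) p
      (≤-trans q (≥≡ (#rest C z)))

  middle-cut : ∀ {C z} → 2 ≤ # (C ∩ B z) → 2 ≤ # (B z ∖ C) → 2 * κ ≤ d in′ (C ∩ B z) + 2
  middle-cut {C} {z} p q = middle-bound z (C ∩ B z) (λ x s → proj₂ (∧⁻ {C x} s)) p
      (≤-trans q (≥≡ (#rest C z)))

  -- The matching edge at each vertex of `C` leaves the class and hence `C`.
  inside-class : ∀ {C z} → C ⊆ B z → # C ≤ d out C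
  inside-class {C} {z} h = ≤-trans (≥≡ (+-identityʳ _)) (E-rows-≥ C (∁ C) λ x p → ≤-trans (≥≡ (#out x))
    (#-mono {A = out x} {∁ C ∩ out x} λ y w → ∧⁺
        (not⁺ (≡false λ q → out⊆∁B x y w (join (swap (h x p)) (h y q)))) w))

  one-cut : ∀ C z → d in′ (C ∩ B z) ≤ d in′ C
  one-cut C z = ≤-trans (cut C z) (≤-trans (m≤m+n _ _) (≥≡ (E-splitˡ C (∁ C) (B z))))

  #∁-split : ∀ C z → # (B z ∖ C) + # (∁ (C ∪ B z)) ≡ # (∁ C)
  #∁-split C z = trans (cong₂ _+_ (#-cong (∩-comm (B z) (∁ C))) (#-cong (λ x → lem (C x) (B z x))))
      (#∩+#∖ (∁ C) (B z))
    where
    lem : ∀ a b → not (a ∨ b) ≡ not a ∧ not b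
    lem true  b = refl
    lem false b = refl

  -- A piece of one vertex is removed, or a rest of one vertex added, at the price of one matching
  -- edge. When both have two or more vertices, the bounds from removing and from adding sum to
  -- `size ≤ 2 * d out C`, unless `C` or its complement lies within the class.
  profile₁ : ∀ {C z} → c ≤ # C → c ≤ # (∁ C) → OnlyIn C z → Crossing C z → Profile (d out C) (d in′ C)
  profile₁ {C} {z} c≤C c≤∁C only cross with 2 ≤? # (C ∩ B z) | 2 ≤? # (B z ∖ C)
  ... | no p | _ = single (≤-trans
      (out-down {C} {z} only (nonempty (C ∖ B z) (single-rest-arith c _ _ _ 3≤c (#∩+#∖ C (B z))
      (s≤s⁻¹ (≰⇒> p)) c≤C)))
                     (≤-refl ⊞ s≤s⁻¹ (≰⇒> p))) (≤-trans (crossing-cut cross) (one-cut C z))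
  ... | yes _ | no q = single (≤-trans
      (out-up {C} {z} only (nonempty (∁ (C ∪ B z)) (single-rest-arith c _ _ _ 3≤c (#∁-split C z)
      (s≤s⁻¹ (≰⇒> q)) c≤∁C)))
                     (≤-refl ⊞ s≤s⁻¹ (≰⇒> q))) (≤-trans (crossing-cut cross) (one-cut C z))
  ... | yes p | yes q = middle (bound (empty? (C ∖ B z)) (empty? (∁ (C ∪ B z))))
                          (≤-trans (middle-cut {C} {z} p q) (one-cut C z ⊞ ≤-refl))
    where
    bound : Nonempty (C ∖ B z) ⊎ (∀ y → y ∉ C ∖ B z) → Nonempty (∁ (C ∪ B z)) ⊎
        (∀ y → y ∉ ∁ (C ∪ B z)) → c ≤ d out C
    bound (inj₁ e) (inj₁ f) = (middle-arith c) (d out C) (# (C ∩ B z)) (# (B z ∖ C)) size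
        (#piece C z) 2c≤size (out-down {C} {z} only e) (out-up {C} {z} only f)
    bound (inj₂ e) _ = ≤-trans c≤C (inside-class {C} {z} λ x p → case bool? (B z x) of λ where
      (inj₁ s) → s
      (inj₂ s) → ⊥-elim (true≢false (∧⁺ p (not⁺ s)) (e x)))
    bound (inj₁ _) (inj₂ f) = ≤-trans c≤∁C (≤-trans (inside-class {∁ C} {z} λ x p → case bool? (B z x) of λ where
      (inj₁ s) → s
      (inj₂ s) → ⊥-elim (true≢false (not⁺
          (≡false λ t → [ (λ u → true≢false u (not⁻ p)) , (λ u → true≢false u s) ]′ (∨⁻ {C x} t))) (f x)))
      (≤≡ (d-∁ out-sym C)))

  OnlyIn₂ : Sub n → Fin n → Fin n → Set
  OnlyIn₂ C z₁ z₂ = ∀ {x y} → x ∈ C → y ∈ B x → y ∉ C → x ∈ B z₁ ⊎ x ∈ B z₂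

  -- The set C₀ is C with the class of z₁ removed or added, at the price of
  -- at most one out-edge.

  flattened : ∀ {C z₁ z₂} C₀ → 3 ≤ # C → 3 ≤ # (∁ C) → d out C₀ ≤ d out C + 1 → OnlyIn C₀ z₂ →
              # (C₀ ∩ B z₂) ≡ # (C ∩ B z₂) → # (B z₂ ∖ C₀) ≡ # (B z₂ ∖ C) → Crossing C z₁ → Crossing
                  C z₂ → z₂ ∉ B z₁ →
              (# (C ∩ B z₂) ≤ 1 → Nonempty (C₀ ∖ B z₂)) → (# (B z₂ ∖ C) ≤ 1 → Nonempty (∁ (C₀ ∪ B z₂))) →
              Nonempty (C₀ ∖ B z₂) ⊎ Nonempty (∁ (C₀ ∪ B z₂)) →
              Profile (d out C) (d in′ C)
  flattened {C} {z₁} {z₂} C₀ 3≤C 3≤∁C d₀ only same₁ same₂ x₁ x₂ apart ne₁ ne₂ ne with 2 ≤? #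
      (C ∩ B z₂) | 2 ≤? # (B z₂ ∖ C)
  ... | no p | _ = single-single
          (single-out-arith (d out C) (d out C₀) (# (C ∩ B z₂)) size d₀
              (≤-trans (out-down {C₀} {z₂} only (ne₁ (s≤s⁻¹ (≰⇒> p)))) (≤-refl ⊞ ≤≡ same₁)) (s≤s⁻¹ (≰⇒> p)))
          (two-single-arith κ (d in′ (C ∩ B z₁)) (d in′ (C ∩ B z₂)) (d in′ C) (crossing-cut x₁)
              (crossing-cut x₂) (two-cuts C z₁ z₂ apart))
  ... | yes _ | no q = single-single
          (single-out-arith (d out C) (d out C₀) (# (B z₂ ∖ C)) size d₀
              (≤-trans (out-up {C₀} {z₂} only (ne₂ (s≤s⁻¹ (≰⇒> q)))) (≤-refl ⊞ ≤≡ same₂)) (s≤s⁻¹ (≰⇒> q)))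
          (two-single-arith κ (d in′ (C ∩ B z₁)) (d in′ (C ∩ B z₂)) (d in′ C) (crossing-cut x₁)
              (crossing-cut x₂) (two-cuts C z₁ z₂ apart))
  ... | yes p | yes q = single-middle (bound ne)
          (single-middle-arith κ (d in′ (C ∩ B z₁)) (d in′ (C ∩ B z₂)) (d in′ C) (crossing-cut x₁)
              (middle-cut {C} {z₂} p q) (two-cuts C z₁ z₂ apart))
    where
    bound : Nonempty (C₀ ∖ B z₂) ⊎ Nonempty (∁ (C₀ ∪ B z₂)) → 1 ≤ d out C
    bound (inj₁ e) = middle-out-arith (d out C) (d out C₀) (# (C ∩ B z₂)) (# (B z₂ ∖ C)) size d₀
      (≤-trans (out-down {C₀} {z₂} only e) (≤-refl ⊞ ≤≡ same₁)) (#piece C z₂) q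
    bound (inj₂ e) = middle-out-arith (d out C) (d out C₀) (# (B z₂ ∖ C)) (# (C ∩ B z₂)) size d₀
      (≤-trans (out-up {C₀} {z₂} only e) (≤-refl ⊞ ≤≡ same₂))
          (trans (+-comm (# (B z₂ ∖ C)) _) (#piece C z₂)) p

  -- After the class of `z₁` is flattened only the class of `z₂` is split. Its removal or addition
  -- cannot empty `C₀` or fill everything, because the flattened class stays on the other side.
  profile₂ : ∀ {C z₁ z₂} → 3 ≤ # C → 3 ≤ # (∁ C) → OnlyIn₂ C z₁ z₂ → Crossing C z₁ → Crossing C z₂ →
      z₂ ∉ B z₁ →
             # (C ∩ B z₁) ≤ 1 ⊎ # (B z₁ ∖ C) ≤ 1 → Profile (d out C) (d in′ C)
  profile₂ {C} {z₁} {z₂} 3≤C 3≤∁C only x₁ x₂ apart (inj₁ p) = flattened {C} {z₁} {z₂} (C ∖ B z₁) 3≤C 3≤∁C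
      (≤-trans (d-down C z₁) (≤-refl ⊞ p)) only₀ (#-cong same₁) (#-cong same₂) x₁ x₂ apart
      (λ q → nonempty ((C ∖ B z₁) ∖ B z₂) (two-single-rest-arith _ _ _ _ (# (C ∖ B z₁)) 3≤C p q
          (#∩+#∖ C (B z₁)) (trans (cong (_+ # ((C ∖ B z₁) ∖ B z₂)) (sym (#-cong same₁)))
          (#∩+#∖ (C ∖ B z₁) (B z₂)))))
      (λ _ → z₁∉) (inj₂ z₁∉)
    where
    apart′ : ∀ x → x ∈ B z₂ → x ∉ B z₁
    apart′ x s = ≡false λ t → true≢false (join t (swap s)) apart
    same₁ : (C ∖ B z₁) ∩ B z₂ ≐ C ∩ B z₂
    same₁ x with bool? (B z₂ x)
    ... | inj₁ s rewrite s | apart′ x s = lem (C x)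
      where
      lem : ∀ a → (a ∧ true) ∧ true ≡ a ∧ true
      lem true  = refl
      lem false = refl
    ... | inj₂ s rewrite s = trans (∧-comm _ false) (∧-comm false _)
    same₂ : B z₂ ∖ (C ∖ B z₁) ≐ B z₂ ∖ C
    same₂ x with bool? (B z₂ x)
    ... | inj₁ s rewrite s | apart′ x s = lem (C x)
      where
      lem : ∀ a → not (a ∧ true) ≡ not a
      lem true  = refl
      lem false = refl
    ... | inj₂ s rewrite s = refl
    only₀ : OnlyIn (C ∖ B z₁) z₂
    only₀ {x} {y} q s t with ∧⁻ {C x} q | bool? (C y)
    ... | x∈C , x∉z₁ | inj₁ y∈C = ⊥-elim
        (true≢false (∧⁺ y∈C (saturated-∁ {B z₁} (saturated-class z₁) x∉z₁ s)) t)
    ... | x∈C , x∉z₁ | inj₂ y∉C with only x∈C s y∉C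
    ...   | inj₁ u = ⊥-elim (true≢false u (not⁻ x∉z₁))
    ...   | inj₂ u = u
    z₁∉ : Nonempty (∁ ((C ∖ B z₁) ∪ B z₂))
    z₁∉ = z₁ , not⁺ (≡false λ s → case ∨⁻ {C z₁ ∧ not (B z₁ z₁)} s of λ where
      (inj₁ t) → true≢false (self z₁) (not⁻ (proj₂ (∧⁻ {C z₁} t)))
      (inj₂ t) → true≢false (swap t) apart)
  profile₂ {C} {z₁} {z₂} 3≤C 3≤∁C only x₁ x₂ apart (inj₂ p) = flattened {C} {z₁} {z₂} (C ∪ B z₁) 3≤C 3≤∁C
      (≤-trans (d-up C z₁) (≤-refl ⊞ p)) only₀ (#-cong same₁) (#-cong same₂) x₁ x₂ apart
      (λ _ → z₁∈)
      (λ q → nonempty (∁ ((C ∪ B z₁) ∪ B z₂)) (two-single-rest-arith _ _ _ _ (# (∁ (C ∪ B z₁))) 3≤∁C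
          p q (#∁-split C z₁) (trans (cong (_+ # (∁ ((C ∪ B z₁) ∪ B z₂))) (sym (#-cong same₂)))
          (#∁-split (C ∪ B z₁) z₂))))
      (inj₁ z₁∈)
    where
    apart′ : ∀ x → x ∈ B z₂ → x ∉ B z₁
    apart′ x s = ≡false λ t → true≢false (join t (swap s)) apart
    same₁ : (C ∪ B z₁) ∩ B z₂ ≐ C ∩ B z₂
    same₁ x with bool? (B z₂ x)
    ... | inj₁ s rewrite s | apart′ x s = lem (C x)
      where
      lem : ∀ a → (a ∨ false) ∧ true ≡ a ∧ true
      lem true  = refl
      lem false = refl
    ... | inj₂ s rewrite s = trans (∧-comm _ false) (∧-comm false _)
    same₂ : B z₂ ∖ (C ∪ B z₁) ≐ B z₂ ∖ C
    same₂ x with bool? (B z₂ x)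
    ... | inj₁ s rewrite s | apart′ x s = lem (C x)
      where
      lem : ∀ a → not (a ∨ false) ≡ not a
      lem true  = refl
      lem false = refl
    ... | inj₂ s rewrite s = refl
    only₀ : OnlyIn (C ∪ B z₁) z₂
    only₀ {x} {y} q s t with ∨⁻ {C x} q
    ... | inj₂ u = ⊥-elim (true≢false (∨⁺ʳ {C y} (join u s)) t)
    ... | inj₁ u with only u s (≡false λ w → true≢false (∨⁺ˡ w) t)
    ...   | inj₁ v = ⊥-elim (true≢false (∨⁺ʳ {C y} (join v s)) t)
    ...   | inj₂ v = v
    z₁∈ : Nonempty ((C ∪ B z₁) ∖ B z₂)
    z₁∈ = z₁ , ∧⁺ (∨⁺ʳ {C z₁} (self z₁)) (not⁺ (≡false λ t → true≢false (swap t) apart))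

  -- By the number of split classes. Three of them cost `3 * κ` in `in′`; so do two with large
  -- pieces and rests, as twice `2 * κ - 2` is at least `3 * κ` for `κ` at least 4.
  profile : ∀ C → c ≤ # C → c ≤ # (∁ C) → Profile (d out C) (d in′ C)
  profile C c≤C c≤∁C = go₀ (empty? crosses)
    where
    crosses : Sub n
    crosses z = any (C ∩ B z) ∧ any (B z ∖ C)
    crossing : ∀ {z} → z ∈ crosses → Crossing C z
    crossing {z} p = let s , t = ∧⁻ {any (C ∩ B z)} p in
      ∈⇒1≤ {A = C ∩ B z} (proj₂ (any⁻ {f = C ∩ B z} s)) , ∈⇒1≤ {A = B z ∖ C} (proj₂ (any⁻ {f = B z ∖ C} t))
    crosses⁺ : ∀ {x y} → x ∈ C → y ∈ B x → y ∉ C → x ∈ crosses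
    crosses⁺ {x} {y} p q s = ∧⁺ (any⁺ x (∧⁺ p (self x))) (any⁺ y (∧⁺ q (not⁺ s)))
    C≢∅ : Nonempty C
    C≢∅ = nonempty C (≤-trans (s≤s z≤n) (≤-trans 3≤c c≤C))
    C≢V : Nonempty (∁ C)
    C≢V = nonempty (∁ C) (≤-trans (s≤s z≤n) (≤-trans 3≤c c≤∁C))
    go₂ : ∀ z₁ z₂ → z₁ ∈ crosses → z₂ ∈ crosses → z₂ ∉ B z₁ →
          Nonempty ((crosses ∖ B z₁) ∖ B z₂) ⊎ (∀ y → y ∉ (crosses ∖ B z₁) ∖ B z₂) → Profile
              (d out C) (d in′ C)
    go₂ z₁ z₂ x₁ x₂ apart (inj₁ (z₃ , p)) = inner
        (three-cuts-arith κ _ _ _ _ (crossing-cut (crossing x₁)) (crossing-cut (crossing x₂))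
        (crossing-cut (crossing (proj₁ (∧⁻ (proj₁ (∧⁻ p))))))
            (three-cuts C z₁ z₂ z₃ apart (not⁻ (proj₂ (∧⁻ {crosses z₃} (proj₁ (∧⁻ p)))))
            (not⁻ (proj₂ (∧⁻ {crosses z₃ ∧ not (B z₁ z₃)} p)))))
    go₂ z₁ z₂ x₁ x₂ apart (inj₂ e) = split (2 ≤? # (C ∩ B z₁)) (2 ≤? # (B z₁ ∖ C))
        (2 ≤? # (C ∩ B z₂)) (2 ≤? # (B z₂ ∖ C))
      where
      only : OnlyIn₂ C z₁ z₂
      only {x} {y} p q s with bool? (B z₁ x) | bool? (B z₂ x)
      ... | inj₁ t | _      = inj₁ t
      ... | inj₂ t | inj₁ u = inj₂ u
      ... | inj₂ t | inj₂ u = ⊥-elim (true≢false (∧⁺ (∧⁺ (crosses⁺ p q s) (not⁺ t)) (not⁺ u)) (e x))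
      only′ : OnlyIn₂ C z₂ z₁
      only′ p q s = [ inj₂ , inj₁ ]′ (only p q s)
      3≤C : 3 ≤ # C
      3≤C = ≤-trans 3≤c c≤C
      3≤∁C : 3 ≤ # (∁ C)
      3≤∁C = ≤-trans 3≤c c≤∁C
      first : # (C ∩ B z₁) ≤ 1 ⊎ # (B z₁ ∖ C) ≤ 1 → Profile (d out C) (d in′ C)
      first = profile₂ {C} {z₁} {z₂} 3≤C 3≤∁C only (crossing x₁) (crossing x₂) apart
      second : # (C ∩ B z₂) ≤ 1 ⊎ # (B z₂ ∖ C) ≤ 1 → Profile (d out C) (d in′ C)
      second = profile₂ {C} {z₂} {z₁} 3≤C 3≤∁C only′ (crossing x₂) (crossing x₁)
          (≡false λ t → true≢false (swap t) apart)
      split : Dec (2 ≤ # (C ∩ B z₁)) → Dec (2 ≤ # (B z₁ ∖ C)) → Dec (2 ≤ # (C ∩ B z₂)) → Dec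
          (2 ≤ # (B z₂ ∖ C)) → Profile (d out C) (d in′ C)
      split (no p) _ _ _ = first (inj₁ (s≤s⁻¹ (≰⇒> p)))
      split (yes _) (no p) _ _ = first (inj₂ (s≤s⁻¹ (≰⇒> p)))
      split (yes _) (yes _) (no p) _ = second (inj₁ (s≤s⁻¹ (≰⇒> p)))
      split (yes _) (yes _) (yes _) (no p) = second (inj₂ (s≤s⁻¹ (≰⇒> p)))
      split (yes p₁) (yes q₁) (yes p₂) (yes q₂) = inner
          (two-middle-arith κ _ _ _ 4≤κ (middle-cut {C} {z₁} p₁ q₁) (middle-cut {C} {z₂} p₂ q₂)
          (two-cuts C z₁ z₂ apart))
    go₁ : ∀ z → z ∈ crosses → Nonempty (crosses ∖ B z) ⊎ (∀ y → y ∉ crosses ∖ B z) → Profile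
        (d out C) (d in′ C)
    go₁ z x (inj₁ (z₂ , p)) = go₂ z z₂ x (proj₁ (∧⁻ p)) (not⁻ (proj₂ (∧⁻ {crosses z₂} p)))
        (empty? ((crosses ∖ B z) ∖ B z₂))
    go₁ z x (inj₂ e) = profile₁ {C} {z} c≤C c≤∁C only (crossing x)
      where
      only : OnlyIn C z
      only {x} p q s with bool? (B z x)
      ... | inj₁ t = t
      ... | inj₂ t = ⊥-elim (true≢false (∧⁺ (crosses⁺ p q s) (not⁺ t)) (e x))
    go₀ : Nonempty crosses ⊎ (∀ y → y ∉ crosses) → Profile (d out C) (d in′ C)
    go₀ (inj₁ (z , x)) = go₁ z x (empty? (crosses ∖ B z))
    go₀ (inj₂ e) = union (union-bound C sat C≢∅ C≢V)
      where
      sat : Saturated C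
      sat {x} {y} p q with bool? (C y)
      ... | inj₁ s = s
      ... | inj₂ s = ⊥-elim (true≢false (crosses⁺ p q s) (e x))

tight-∪-arith : ∀ k k′ r r′ i j ri rj {x} → r ≤ k → r′ ≤ k′ → i ≤ ri → i + j ≡ k + k′ → ri + rj ≡ r
    + r′ → x ≤ rj → x ≤ j
tight-∪-arith k k′ r r′ i j ri rj {x} h₁ h₂ h₃ h₄ h₅ h₆ =
  by 0 (h₁ ⊞ h₂ ⊞ h₃ ⊞ ≥≡ h₄ ⊞ ≤≡ h₅ ⊞ h₆) (solve (k ∷ k′ ∷ r ∷ r′ ∷ i ∷ j ∷ ri ∷ rj ∷ x ∷ []))

#-injection : ∀ {q n} (f : Fin q → Fin n) (K : Sub q) (B : Sub n) → (∀ i → i ∈ K → f i ∈ B) →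
              (∀ i j → i ∈ K → j ∈ K → f i ≡ f j → i ≡ j) → # K ≤ # B
#-injection f K B h inj = go (# K) K B h inj ≤-refl
  where
  go : ∀ m K B → (∀ i → i ∈ K → f i ∈ B) → (∀ i j → i ∈ K → j ∈ K → f i ≡ f j → i ≡ j) → # K ≤ m → # K ≤ # B
  go zero    K B h inj le = ≤-trans le z≤n
  go (suc m) K B h inj le with empty? K
  ... | inj₂ e = ≤-trans (≤≡ (∉⇒#≡0 e)) z≤n
  ... | inj₁ (i , p) = ≤-trans (≤≡ (#-remove p)) (≤-trans (s≤s (go m (K ∖ ⁅ i ⁆) (B ∖ ⁅ f i ⁆)
      (λ j q → ∧⁺ (h j (proj₁ (∧⁻ q)))
          (not⁺ (≢⇒∉⁅⁆ (λ e → true≢false (subst (_∈ ⁅ i ⁆) (inj i j p (proj₁ (∧⁻ q)) e) (x∈⁅x⁆ i))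
          (not⁻ (proj₂ (∧⁻ {K j} q)))))))
      (λ j k q s e → inj j k (proj₁ (∧⁻ q)) (proj₁ (∧⁻ s)) e)
      (s≤s⁻¹ (≤-trans (≥≡ (#-remove p)) le)))) (≥≡ (#-remove (h i p))))

search : ∀ {n} {P Q : Fin n → Set} → (∀ x → P x ⊎ Q x) → ∃ P ⊎ (∀ x → Q x)
search {zero}  h = inj₂ λ ()
search {suc n} h with h zero | search (h ∘ suc)
... | inj₁ p | _ = inj₁ (zero , p)
... | inj₂ q | inj₁ (x , p) = inj₁ (suc x , p)
... | inj₂ q | inj₂ r = inj₂ λ { zero → q ; (suc x) → r x }

-- Hall's theorem

module Hall {q n : ℕ} (R : Fin q → Fin n → Bool) (y₀ : Fin n) where

  reach : Sub q → Sub n → Sub n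
  reach K T y = T y ∧ any (λ i → K i ∧ R i y)

  reach⁺ : ∀ {K T} i y → y ∈ T → i ∈ K → R i y ≡ true → y ∈ reach K T
  reach⁺ i y t k w = ∧⁺ t (any⁺ i (∧⁺ k w))

  reach⁻ : ∀ {K T} y → y ∈ reach K T → y ∈ T × ∃[ i ] i ∈ K × R i y ≡ true
  reach⁻ {K} {T} y p = let t , s = ∧⁻ {T y} p ; i , u = any⁻ {f = λ i → K i ∧ R i y} s in t , i , ∧⁻ u

  record Matching (J : Sub q) (T : Sub n) : Set where
    field
      f         : Fin q → Fin n
      f∈T       : ∀ i → i ∈ J → f i ∈ T
      f-adj     : ∀ i → i ∈ J → R i (f i) ≡ true
      injective : ∀ i j → i ∈ J → j ∈ J → f i ≡ f j → i ≡ j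

  Violator : Sub q → Sub n → Set
  Violator J T = ∃[ K ] K ⊆ J × # (reach K T) < # K

  matched-bound : ∀ {J T} → Matching J T → ∀ K → K ⊆ J → # K ≤ # (reach K T)
  matched-bound {J} {T} M K h = #-injection f K (reach K T)
      (λ i p → reach⁺ {K} {T} i (f i) (f∈T i (h i p)) p (f-adj i (h i p)))
    (λ i j p q → injective i j (h i p) (h j q))
    where open Matching M

  extend : ∀ {J T} i s → i ∈ J → s ∈ T → R i s ≡ true → Matching (J ∖ ⁅ i ⁆) (T ∖ ⁅ s ⁆) → Matching J T
  extend {J} {T} i s i∈J s∈T w M = record { f = f′ ; f∈T = f∈T′ ; f-adj = f-adj′ ; injective = inj′ }
    where
    open Matching M
    pick : ∀ j → Dec (i ≡ j) → Fin n
    pick j (yes _) = s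
    pick j (no _)  = f j
    f′ : Fin q → Fin n
    f′ j = pick j (i ≟ j)
    rest : ∀ {j} → j ∈ J → i ≢ j → j ∈ J ∖ ⁅ i ⁆
    rest p ne = ∧⁺ p (not⁺ (≢⇒∉⁅⁆ ne))
    avoid : ∀ {j} → j ∈ J → i ≢ j → s ≢ f j
    avoid {j} p ne e = true≢false (subst (_∈ ⁅ s ⁆) e (x∈⁅x⁆ s))
        (not⁻ (proj₂ (∧⁻ {T (f j)} (f∈T j (rest p ne)))))
    f∈T′ : ∀ j → j ∈ J → f′ j ∈ T
    f∈T′ j p with i ≟ j
    ... | yes _ = s∈T
    ... | no ne = proj₁ (∧⁻ (f∈T j (rest p ne)))
    f-adj′ : ∀ j → j ∈ J → R j (f′ j) ≡ true
    f-adj′ j p with i ≟ j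
    ... | yes refl = w
    ... | no ne = f-adj j (rest p ne)
    inj′ : ∀ j k → j ∈ J → k ∈ J → f′ j ≡ f′ k → j ≡ k
    inj′ j k p r e with i ≟ j | i ≟ k
    ... | yes refl | yes refl = refl
    ... | yes refl | no ne = ⊥-elim (avoid r ne e)
    ... | no ne | yes refl = ⊥-elim (avoid p ne (sym e))
    ... | no ne | no ne′ = injective j k (rest p ne) (rest r ne′) e

  reach-∪ : ∀ {K K′ T} y → y ∈ reach (K ∪ K′) T → y ∈ reach K T ⊎ y ∈ reach K′ T
  reach-∪ {K} {K′} {T} y p with reach⁻ {K ∪ K′} {T} y p
  ... | t , i , k , w with ∨⁻ {K i} k
  ...   | inj₁ a = inj₁ (reach⁺ {K} {T} i y t a w)
  ...   | inj₂ b = inj₂ (reach⁺ {K′} {T} i y t b w)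

  -- Reach is submodular, and the matching keeps the reach of `K ∩ K′` from being smaller than
  -- `K ∩ K′`.
  tight-∪ : ∀ {J T} → Matching J T → ∀ K K′ → K ⊆ J → K′ ⊆ J → # (reach K T) ≤ # K → # (reach K′ T) ≤ # K′ →
            # (reach (K ∪ K′) T) ≤ # (K ∪ K′)
  tight-∪ {J} {T} M K K′ h h′ t t′ = tight-∪-arith _ _ _ _ (# (K ∩ K′)) _
      (# (reach K T ∩ reach K′ T)) _ t t′
      (≤-trans (matched-bound M (K ∩ K′) (λ i p → h i (proj₁ (∧⁻ p))))
          (#-mono {A = reach (K ∩ K′) T} {reach K T ∩ reach K′ T}
        λ y p → let u , i , k , w = reach⁻ {K ∩ K′} {T} y p in
          ∧⁺ (reach⁺ {K} {T} i y u (proj₁ (∧⁻ k)) w) (reach⁺ {K′} {T} i y u (proj₂ (∧⁻ {K i} k)) w)))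
      (#∩+#∪ K K′) (#∩+#∪ (reach K T) (reach K′ T))
      (#-mono {A = reach (K ∪ K′) T} {reach K T ∪ reach K′ T} λ y p →
          [ (λ a → ∨⁺ˡ a) , (λ b → ∨⁺ʳ {reach K T y} b) ]′ (reach-∪ {K} {K′} {T} y p))

  -- Tight sets for the single points of `G` are united; each union covers a further point and stays
  -- tight.
  absorb : ∀ {J T} (M : Matching J T) (G : Sub n) →
           (∀ s → s ∈ G → ∃[ K ] K ⊆ J × # (reach K T) ≤ # K × s ∈ reach K T) →
           ∃[ K ] K ⊆ J × # (reach K T) ≤ # K × G ⊆ reach K T
  absorb {J} {T} M G h = go (# G) ∅ (λ _ ()) (≤-trans (≤≡ (∉⇒#≡0 {A = reach ∅ T} λ y → ≡false λ p →
      case proj₁ (proj₂ (proj₂ (reach⁻ {∅} {T} y p))) of λ ())) z≤n)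
          (#-mono {A = G ∖ reach ∅ T} {G} λ y p → proj₁ (∧⁻ p))
    where
    go : ∀ m K → K ⊆ J → # (reach K T) ≤ # K → # (G ∖ reach K T) ≤ m → ∃[ K ] K ⊆ J × # (reach K T)
        ≤ # K × G ⊆ reach K T
    go m K K⊆J t le with empty? (G ∖ reach K T)
    ... | inj₂ e = K , K⊆J , t , λ y p → case bool? (reach K T y) of λ where
      (inj₁ s) → s
      (inj₂ s) → ⊥-elim (true≢false (∧⁺ p (not⁺ s)) (e y))
    go zero K K⊆J t le | inj₁ (s , p) = ⊥-elim (n≮n 0 (≤-trans (∈⇒1≤ p) le))
    go (suc m) K K⊆J t le | inj₁ (s , p) with h s (proj₁ (∧⁻ {G s} p))
    ... | K′ , K′⊆J , t′ , s∈ = go m (K ∪ K′) (λ i u → [ K⊆J i , K′⊆J i ]′ (∨⁻ {K i} u))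
        (tight-∪ M K K′ K⊆J K′⊆J t t′)
      (s≤s⁻¹ (≤-trans (≤-trans (s≤s (#-mono {A = G ∖ reach (K ∪ K′) T} {(G ∖ reach K T) ∖ ⁅ s ⁆}
          sub)) (≥≡ (#-remove p))) le))
      where
      sub : G ∖ reach (K ∪ K′) T ⊆ (G ∖ reach K T) ∖ ⁅ s ⁆
      sub y u = let g , r = ∧⁻ {G y} u in ∧⁺ (∧⁺ g (not⁺ (≡false λ v → let t , i , k , w = reach⁻ {K} {T} y v in
                  true≢false (reach⁺ {K ∪ K′} {T} i y t (∨⁺ˡ k) w) (not⁻ r))))
                (not⁺ (≡false λ v → let t , i , k , w = reach⁻ {K′} {T} s s∈ in
                  true≢false (subst (λ z → z ∈ reach (K ∪ K′) T) (∈⁅⁆⇒≡ v)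
                      (reach⁺ {K ∪ K′} {T} i s t (∨⁺ʳ {K i} k) w)) (not⁻ r)))

  -- All of `J` but `i` is matched first, then each neighbour `s` of `i` is tried as its partner. If
  -- every trial fails, each `s` is reached by a tight set; the union of these sets reaches every
  -- neighbour of `i`, so adding `i` violates the condition.
  hall : ∀ m J T → # J ≤ m → Matching J T ⊎ Violator J T
  hall m J T le with empty? J
  ... | inj₂ e = inj₁ (record { f = λ _ → y₀ ; f∈T = λ i p → none p ; f-adj = λ i p → none p ;
      injective = λ i j p → none p })
    where
    none : ∀ {i} {A : Set} → i ∈ J → A
    none {i} p = ⊥-elim (true≢false p (e i))
  hall zero J T le | inj₁ (i , p) = ⊥-elim (n≮n 0 (≤-trans (∈⇒1≤ p) le))
  hall (suc m) J T le | inj₁ (i , i∈J) with hall m (J ∖ ⁅ i ⁆) T (s≤s⁻¹ (≤-trans (≥≡ (#-remove i∈J)) le))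
  ... | inj₂ (K , K⊆ , v) = inj₂ (K , (λ j p → proj₁ (∧⁻ (K⊆ j p))) , v)
  ... | inj₁ M with search {P = λ s → s ∈ T × R i s ≡ true × Matching (J ∖ ⁅ i ⁆) (T ∖ ⁅ s ⁆)}
                           {Q = λ s → s ∈ T ∩ R i → Violator (J ∖ ⁅ i ⁆) (T ∖ ⁅ s ⁆)} attempt
    where
    attempt : ∀ s → (s ∈ T × R i s ≡ true × Matching (J ∖ ⁅ i ⁆) (T ∖ ⁅ s ⁆)) ⊎
        (s ∈ T ∩ R i → Violator (J ∖ ⁅ i ⁆) (T ∖ ⁅ s ⁆))
    attempt s with bool? (T s ∧ R i s) | hall m (J ∖ ⁅ i ⁆) (T ∖ ⁅ s ⁆)
        (s≤s⁻¹ (≤-trans (≥≡ (#-remove i∈J)) le))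
    ... | inj₂ e | _ = inj₂ λ p → ⊥-elim (true≢false p e)
    ... | inj₁ p | inj₁ M = inj₁ (proj₁ (∧⁻ p) , proj₂ (∧⁻ {T s} p) , M)
    ... | inj₁ p | inj₂ v = inj₂ λ _ → v
  ...   | inj₁ (s , s∈T , w , M′) = inj₁ (extend i s i∈J s∈T w M′)
  ...   | inj₂ viol with absorb M (T ∩ R i) tight
    where
    tight : ∀ s → s ∈ T ∩ R i → ∃[ K ] K ⊆ J ∖ ⁅ i ⁆ × # (reach K T) ≤ # K × s ∈ reach K T
    tight s p with viol s p
    ... | K , K⊆ , v = K , K⊆ , ≤-trans (#-mono {A = reach K T} {reach K (T ∖ ⁅ s ⁆) ∪ ⁅ s ⁆} sub)
              (≤-trans (≤-trans (m≤n+m _ (# (reach K (T ∖ ⁅ s ⁆) ∩ ⁅ s ⁆)))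
                  (≤≡ (#∩+#∪ (reach K (T ∖ ⁅ s ⁆)) ⁅ s ⁆)))
                (≤-trans (≤≡ (trans (cong (# (reach K (T ∖ ⁅ s ⁆)) +_) (#⁅ s ⁆)) (+-comm _ 1))) v)) ,
            s∈
      where
      sub : reach K T ⊆ reach K (T ∖ ⁅ s ⁆) ∪ ⁅ s ⁆
      sub y u with bool? (⁅ s ⁆ y)
      ... | inj₁ e = ∨⁺ʳ {reach K (T ∖ ⁅ s ⁆) y} e
      ... | inj₂ e = let t , i , k , w = reach⁻ {K} {T} y u in ∨⁺ˡ (reach⁺ {K} {T ∖ ⁅ s ⁆} i y (∧⁺ t (not⁺ e)) k w)
      s∈ : s ∈ reach K T
      s∈ with bool? (reach K T s)
      ... | inj₁ u = u
      ... | inj₂ u = ⊥-elim (n≮n _ (≤-trans v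
          (≤-trans (matched-bound M K K⊆) (#-mono {A = reach K T} {reach K (T ∖ ⁅ s ⁆)} λ y p′ →
              let t , i , k , w = reach⁻ {K} {T} y p′ in reach⁺ {K} {T ∖ ⁅ s ⁆} i y
                (∧⁺ t (not⁺ (≡false λ e → true≢false (subst (λ z → z ∈ reach K T) (sym (∈⁅⁆⇒≡ e))
                    p′) u))) k w))))
  ...     | K , K⊆ , t , cover = inj₂ (K ∪ ⁅ i ⁆ ,
              (λ j p → [ (λ a → proj₁ (∧⁻ (K⊆ j a))) , (λ b → subst (_∈ J) (∈⁅⁆⇒≡ b) i∈J) ]′ (∨⁻ {K j} p)) ,
              ≤-trans (s≤s (≤-trans (#-mono {A = reach (K ∪ ⁅ i ⁆) T} {reach K T} sub) t))
                  (≥≡ (#-insert {A = K} {i} i∉K)))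
    where
    i∉K : i ∉ K
    i∉K = ≡false λ p → true≢false (x∈⁅x⁆ i) (not⁻ (proj₂ (∧⁻ {J i} (K⊆ i p))))
    sub : reach (K ∪ ⁅ i ⁆) T ⊆ reach K T
    sub y p with reach⁻ {K ∪ ⁅ i ⁆} {T} y p
    ... | t , j , k , w with ∨⁻ {K j} k
    ...   | inj₁ a = reach⁺ {K} {T} j y t a w
    ...   | inj₂ b = cover y (∧⁺ t (subst (λ z → R z y ≡ true) (sym (∈⁅⁆⇒≡ b)) w))

even-leftover-arith : ∀ s u z l → s + (u + z) + (u + l) ≡ z + (s + l) + (u + u)
even-leftover-arith s u z l =
  solve (s ∷ u ∷ z ∷ l ∷ [])

odd-leftover-arith : ∀ z s → z + (s + suc s) ≡ suc z + (s + s)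
odd-leftover-arith z s =
  solve (z ∷ s ∷ [])

refined-bound-arith : ∀ s s″ l l″ t → s ≡ suc l → s″ + 2 ≤ l″ → t ≡ l + l″ → s + suc s″ ≤ t
refined-bound-arith s s″ l l″ t h₁ h₂ h₃ =
  by 0 (≤≡ h₁ ⊞ h₂ ⊞ ≥≡ h₃) (solve (s ∷ s″ ∷ l ∷ l″ ∷ t ∷ []))

refined-size-arith : ∀ s s″ → s < s + suc s″
refined-size-arith s s″ =
  by s″ (≤-refl {0}) (solve (s ∷ s″ ∷ []))

-- Families of disjoint sets

Disjoint : ∀ {n} → Sub n → Sub n → Set
Disjoint A B = ∀ x → x ∈ A → x ∈ B → ⊥

⋃ : ∀ {n} → List (Sub n) → Sub n
⋃ []       = ∅
⋃ (P ∷ ps) = P ∪ ⋃ ps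

⋃⁺ : ∀ {n} {P : Sub n} {ps x} → P ∈ᴸ ps → x ∈ P → x ∈ ⋃ ps
⋃⁺ (here refl) p = ∨⁺ˡ p
⋃⁺ {ps = Q ∷ _} {x} (there i) p = ∨⁺ʳ {Q x} (⋃⁺ i p)

⋃⁻ : ∀ {n} (ps : List (Sub n)) {x} → x ∈ ⋃ ps → ∃[ P ] P ∈ᴸ ps × x ∈ P
⋃⁻ (P ∷ ps) {x} p with ∨⁻ {P x} p
... | inj₁ q = P , here refl , q
... | inj₂ q = let Q , i , s = ⋃⁻ ps q in Q , there i , s

#full : ∀ n → # (full {n}) ≡ n
#full n = trans (sym (+-identityʳ _))
    (trans (cong (# (full {n}) +_) (sym (∉⇒#≡0 {A = ∁ (full {n})} (λ _ → refl)))) (#∁ {n} full))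

disjoint-⋃ : ∀ {n} {P : Sub n} {ps} → All (Disjoint P) ps → Disjoint P (⋃ ps)
disjoint-⋃ {ps = ps} h x p q = let Q , i , s = ⋃⁻ ps q in All.lookup h i x p s

⋃-parity : ∀ {n} (ps : List (Sub n)) → All (λ P → Even (suc (# P))) ps → AllPairs Disjoint ps → Even
    (# (⋃ ps) + length ps)
⋃-parity [] _ _ = subst Even (sym (trans (+-identityʳ _) (∉⇒#≡0 {A = ∅} (λ _ → refl)))) even-0
⋃-parity (P ∷ ps) (o All.∷ os) (d AllPairs.∷ ds) = subst Even
  (trans (arith (# P) (# (⋃ ps)) (length ps))
      (cong (_+ suc (length ps)) (sym (disjoint-∪ P (⋃ ps) (disjoint-⋃ d)))))
  (even-+ o (⋃-parity ps os ds))
  where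
  arith : ∀ p u l → suc p + (u + l) ≡ p + u + suc l
  arith p u l = solve (p ∷ u ∷ l ∷ [])

extract : ∀ {n} {P : Sub n} {ps} → P ∈ᴸ ps → AllPairs Disjoint ps → Σ[ rest ∈ List (Sub n) ]
          length ps ≡ suc (length rest) × (∀ {Q : Sub n → Set} → All Q ps → All Q rest) ×
          All (Disjoint P) rest × AllPairs Disjoint rest
extract {ps = P ∷ ps} (here refl) (d AllPairs.∷ ds) = ps , refl , (λ { (_ All.∷ qs) → qs }) , d , ds
extract {ps = R ∷ ps} (there i) (d AllPairs.∷ ds) with extract i ds
... | rest , len , keep , e , es = R ∷ rest , cong suc len , (λ { (q All.∷ qs) → q All.∷ keep qs }) ,
      (λ x p q → All.lookup d i x q p) All.∷ e , keep d AllPairs.∷ es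

select : ∀ {n} (ps : List (Sub n)) → Sub (length ps) → List (Sub n)
select []       K = []
select (P ∷ ps) K with K zero
... | true  = P ∷ select ps (K ∘ suc)
... | false = select ps (K ∘ suc)

select-All : ∀ {n} {Q : Sub n → Set} (ps : List (Sub n)) K → (∀ i → i ∈ K → Q (lookup ps i)) → All Q
    (select ps K)
select-All []       K h = All.[]
select-All (P ∷ ps) K h with K zero in eq
... | true  = h zero eq All.∷ select-All ps (K ∘ suc) (h ∘ suc)
... | false = select-All ps (K ∘ suc) (h ∘ suc)

select-disjoint : ∀ {n} (ps : List (Sub n)) K → AllPairs Disjoint ps → AllPairs Disjoint (select ps K)
select-disjoint []       K _ = AllPairs.[]
select-disjoint (P ∷ ps) K (d AllPairs.∷ ds) with K zero
... | true  = select-All ps (K ∘ suc) (λ i _ → All.lookup d (∈-lookup i)) AllPairs.∷ select-disjoint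
    ps (K ∘ suc) ds
... | false = select-disjoint ps (K ∘ suc) ds

select-length : ∀ {n} (ps : List (Sub n)) K → length (select ps K) ≡ # K
select-length []       K = sym (trans (#-def K) (∑-nil _))
select-length (P ∷ ps) K = trans (lem (K zero) refl)
    (sym (trans (#-def K) (trans (∑-suc _) (cong (⟦ K zero ⟧ +_) (sym (#-def (K ∘ suc)))))))
  where
  lem : ∀ b → b ≡ K zero → length (select (P ∷ ps) K) ≡ ⟦ K zero ⟧ + # (K ∘ suc)
  lem b e with K zero
  ... | true  = cong suc (select-length ps (K ∘ suc))
  ... | false = select-length ps (K ∘ suc)

All-⊎ : ∀ {A G : Set} {Q : A → Set} (xs : List A) → (∀ {x} → x ∈ᴸ xs → G ⊎ Q x) → G ⊎
    (∀ {x} → x ∈ᴸ xs → Q x)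
All-⊎ []       h = inj₂ λ ()
All-⊎ (x ∷ xs) h with h (here refl) | All-⊎ xs (h ∘ there)
... | inj₁ g | _      = inj₁ g
... | inj₂ q | inj₁ g = inj₁ g
... | inj₂ q | inj₂ f = inj₂ λ { (here refl) → q ; (there i) → f i }

-- Tutte's theorem.  The odd parts of a barrier need not be connected, only
-- pairwise nonadjacent.

module Tutte {n : ℕ} (r : Rel n) (r-sym : Symm r) (r-irrefl : ∀ x → r x x ≡ false) where

  record Matching (W : Sub n) : Set where
    field
      mate       : Fin n → Fin n
      mate∈      : ∀ x → x ∈ W → mate x ∈ W
      adjacent   : ∀ x → x ∈ W → r x (mate x) ≡ true
      involutive : ∀ x → x ∈ W → mate (mate x) ≡ x

  record Part (W S P : Sub n) : Set where
    field
      P⊆W    : P ⊆ W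
      P∩S    : Disjoint P S
      closed : ∀ x y → x ∈ P → y ∈ W → r x y ≡ true → y ∈ P ⊎ y ∈ S
      odd    : Even (suc (# P))

  record Barrier (W : Sub n) (k : ℕ) : Set where
    field
      S        : Sub n
      S⊆W      : S ⊆ W
      parts    : List (Sub n)
      good     : All (Part W S) parts
      disjoint : AllPairs Disjoint parts
      bound    : # S + k ≤ length parts

  matching-empty : ∀ {W} → (∀ x → x ∉ W) → Matching W
  matching-empty {W} e = record { mate = λ x → x ; mate∈ = λ _ p → p ; adjacent = λ x p → ⊥-elim
      (true≢false p (e x)) ; involutive = λ _ _ → refl }

  matching-cong : ∀ {W W′} → W ≐ W′ → Matching W → Matching W′
  matching-cong e M = record
    { mate = mate ; mate∈ = λ x p → trans (sym (e (mate x))) (mate∈ x (trans (e x) p))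
    ; adjacent = λ x p → adjacent x (trans (e x) p) ; involutive = λ x p → involutive x (trans (e x) p) }
    where open Matching M

  matching-pair : ∀ s v → r s v ≡ true → Matching (⁅ s ⁆ ∪ ⁅ v ⁆)
  matching-pair s v w = record { mate = λ x → pick (s ≟ x) ; mate∈ = λ x _ → pick∈ (s ≟ x) ;
      adjacent = adj ; involutive = inv }
    where
    s≢v : s ≢ v
    s≢v refl = true≢false w (r-irrefl s)
    pick : ∀ {x} → Dec (s ≡ x) → Fin n
    pick (yes _) = v
    pick (no _)  = s
    pick∈ : ∀ {x} (d : Dec (s ≡ x)) → pick d ∈ ⁅ s ⁆ ∪ ⁅ v ⁆
    pick∈ (yes _) = ∨⁺ʳ {⁅ s ⁆ v} (x∈⁅x⁆ v)
    pick∈ (no _)  = ∨⁺ˡ (x∈⁅x⁆ s)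
    which : ∀ {x} → x ∈ ⁅ s ⁆ ∪ ⁅ v ⁆ → s ≡ x ⊎ v ≡ x
    which {x} p = [ (λ q → inj₁ (∈⁅⁆⇒≡ q)) , (λ q → inj₂ (∈⁅⁆⇒≡ q)) ]′ (∨⁻ {⁅ s ⁆ x} p)
    adj : ∀ x → x ∈ ⁅ s ⁆ ∪ ⁅ v ⁆ → r x (pick (s ≟ x)) ≡ true
    adj x p = lem (s ≟ x) (which p)
      where
      lem : (d : Dec (s ≡ x)) → s ≡ x ⊎ v ≡ x → r x (pick d) ≡ true
      lem (yes refl) _           = w
      lem (no ne)    (inj₁ e)    = ⊥-elim (ne e)
      lem (no ne)    (inj₂ refl) = trans (r-sym v s) w
    inv : ∀ x → x ∈ ⁅ s ⁆ ∪ ⁅ v ⁆ → pick (s ≟ pick (s ≟ x)) ≡ x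
    inv x p with s ≟ x | which p
    ... | no ne    | inj₁ e = ⊥-elim (ne e)
    inv x p | yes refl | _ with s ≟ v
    ... | yes e = ⊥-elim (s≢v e)
    ... | no _  = refl
    inv x p | no ne | inj₂ refl with s ≟ s
    ... | yes _  = refl
    ... | no ne′ = ⊥-elim (ne′ refl)

  matching-∪ : ∀ {W W′} → Disjoint W W′ → Matching W → Matching W′ → Matching (W ∪ W′)
  matching-∪ {W} {W′} dis M M′ = record { mate = λ x → pick x (W x) ; mate∈ = mate∈′ ; adjacent =
      adj′ ; involutive = inv′ }
    where
    module M = Matching M
    module M′ = Matching M′
    pick : Fin n → Bool → Fin n
    pick x true  = M.mate x
    pick x false = M′.mate x
    mate∈′ : ∀ x → x ∈ W ∪ W′ → pick x (W x) ∈ W ∪ W′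
    mate∈′ x p with W x in eq
    ... | true  = ∨⁺ˡ (M.mate∈ x eq)
    ... | false = ∨⁺ʳ {W (M′.mate x)} (M′.mate∈ x p)
    adj′ : ∀ x → x ∈ W ∪ W′ → r x (pick x (W x)) ≡ true
    adj′ x p with W x in eq
    ... | true  = M.adjacent x eq
    ... | false = M′.adjacent x p
    inv′ : ∀ x → x ∈ W ∪ W′ → pick (pick x (W x)) (W (pick x (W x))) ≡ x
    inv′ x p with W x in eq
    ... | true rewrite M.mate∈ x eq = M.involutive x eq
    ... | false rewrite ≡false {W (M′.mate x)} (λ q → dis _ q (M′.mate∈ x p)) = M′.involutive x p

  module _ {W : Sub n} {k : ℕ} (barrier : Barrier W k) where
    open Barrier barrier

    leftover : Sub n
    leftover = (W ∖ S) ∖ ⋃ parts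

    ⋃⊆W∖S : ⋃ parts ⊆ W ∖ S
    ⋃⊆W∖S x p = let P , i , q = ⋃⁻ parts p ; g = All.lookup good i in
      ∧⁺ (Part.P⊆W g x q) (not⁺ (≡false (Part.P∩S g x q)))

    #W : # W ≡ # S + (# (⋃ parts) + # leftover)
    #W = sym (trans (cong₂ _+_ (#-cong (⊆-antisym {A = S} {W ∩ S} (λ x p → ∧⁺ (S⊆W x p) p)
        (λ x p → proj₂ (∧⁻ {W x} p))))
      (trans (cong (_+ # leftover) (#-cong (⊆-antisym {A = ⋃ parts} {(W ∖ S) ∩ ⋃ parts}
          (λ x p → ∧⁺ (⋃⊆W∖S x p) p)
        (λ x p → proj₂ (∧⁻ {W x ∧ not (S x)} p))))) (#∩+#∖ (W ∖ S) (⋃ parts)))) (#∩+#∖ W S))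

    even-leftover : Even (# W) → Even (# leftover + (# S + length parts))
    even-leftover e = even-+⁻ (subst Even (trans (cong (_+ (# (⋃ parts) + length parts)) #W)
        (even-leftover-arith (# S) (# (⋃ parts)) (# leftover) (length parts)))
            (even-+ e (⋃-parity parts (All.map Part.odd good) disjoint)))
      (even⁺ (# (⋃ parts)) refl)

    leftover-closed : ∀ x y → x ∈ leftover → y ∈ W → r x y ≡ true → y ∈ leftover ⊎ y ∈ S
    leftover-closed x y p q w with bool? (S y) | bool? (⋃ parts y)
    ... | inj₁ s | _      = inj₂ s
    ... | inj₂ s | inj₂ u = inj₁ (∧⁺ (∧⁺ q (not⁺ s)) (not⁺ u))
    ... | inj₂ s | inj₁ u with ⋃⁻ parts u
    ...   | P , i , t with Part.closed (All.lookup good i) y x t (proj₁ (∧⁻ (proj₁ (∧⁻ p))))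
        (trans (r-sym y x) w)
    ...     | inj₁ a = ⊥-elim (true≢false (⋃⁺ i a) (not⁻ (proj₂ (∧⁻ {W x ∧ not (S x)} p))))
    ...     | inj₂ b = ⊥-elim (true≢false b (not⁻ (proj₂ (∧⁻ {W x} (proj₁ (∧⁻ p))))))

    leftover-disjoint : All (Disjoint leftover) parts
    leftover-disjoint = All.tabulate λ i x p q → true≢false (⋃⁺ i q) (not⁻ (proj₂ (∧⁻ {W x ∧ not (S x)} p)))

    leftover∩S : Disjoint leftover S
    leftover∩S x p q = true≢false q (not⁻ (proj₂ (∧⁻ {W x} (proj₁ (∧⁻ p)))))

    leftover⊆W : leftover ⊆ W
    leftover⊆W x p = proj₁ (∧⁻ (proj₁ (∧⁻ p)))

  -- In a set of even size a surplus of exactly one forces the leftover to be odd, so the leftover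
  -- becomes another part.
  strengthen : ∀ {W} → Even (# W) → Barrier W 1 → Barrier W 2
  strengthen {W} e b with # (Barrier.S b) + 2 ≤? length (Barrier.parts b)
  ... | yes p = record { Barrier b hiding (bound) ; bound = p }
  ... | no ¬p = record
    { S = S ; S⊆W = S⊆W ; parts = leftover b ∷ parts
    ; good = record { P⊆W = leftover⊆W b ; P∩S = leftover∩S b ; closed = leftover-closed b ; odd =
        odd } All.∷ good
    ; disjoint = leftover-disjoint b AllPairs.∷ disjoint
    ; bound = ≤-trans (≤≡ (+-suc (# S) 1)) (s≤s bound) }
    where
    open Barrier b
    len : length parts ≡ suc (# S)
    len = ≤-antisym (s≤s⁻¹ (≤-trans (≰⇒> ¬p) (≤≡ (trans (+-comm (# S) 2) refl))))
        (≤-trans (≤≡ (+-comm 1 (# S))) bound)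
    odd : Even (suc (# (leftover b)))
    odd = even-+⁻ (subst Even (trans (cong (λ l → # (leftover b) + (# S + l)) len)
        (odd-leftover-arith (# (leftover b)) (# S))) (even-leftover b e)) (even⁺ (# S) refl)

  -- Moving a vertex of an even leftover into S leaves one more odd part.

  absorb-vertex : ∀ {W} → Even (# W) → (b : Barrier W 0) → length (Barrier.parts b) ≡ # (Barrier.S b) →
                  ∀ z → z ∈ leftover b → Σ[ b′ ∈ Barrier W 0 ] # (Barrier.S b) < # (Barrier.S b′)
  absorb-vertex {W} e b len z z∈ = record
    { S = S ∪ ⁅ z ⁆
    ; S⊆W = λ x p → [ S⊆W x , (λ q → subst (_∈ W) (∈⁅⁆⇒≡ q) (leftover⊆W b z z∈)) ]′ (∨⁻ {S x} p)
    ; parts = (leftover b ∖ ⁅ z ⁆) ∷ parts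
    ; good = record
        { P⊆W = λ x p → leftover⊆W b x (proj₁ (∧⁻ p))
        ; P∩S = λ x p q → [ leftover∩S b x (proj₁ (∧⁻ p)) ,
            (λ s → true≢false s (not⁻ (proj₂ (∧⁻ {leftover b x} p)))) ]′ (∨⁻ {S x} q)
        ; closed = λ x y p q w → [ (λ s → case bool? (⁅ z ⁆ y) of λ where
                       (inj₁ t) → inj₂ (∨⁺ʳ {S y} t)
                       (inj₂ t) → inj₁ (∧⁺ s (not⁺ t))) , (λ s → inj₂ (∨⁺ˡ s)) ]′
                           (leftover-closed b x y (proj₁ (∧⁻ p)) q w)
        ; odd = subst Even (#-remove z∈) even-Z } All.∷
      All.tabulate λ {Q} i → let g = All.lookup good i in record
        { P⊆W = Part.P⊆W g
        ; P∩S = λ x p q → [ Part.P∩S g x p ,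
            (λ s → true≢false (⋃⁺ i (subst (_∈ Q) (sym (∈⁅⁆⇒≡ s)) p)) z∉⋃) ]′ (∨⁻ {S x} q)
        ; closed = λ x y p q w → [ inj₁ , (λ s → inj₂ (∨⁺ˡ s)) ]′ (Part.closed g x y p q w)
        ; odd = Part.odd g }
    ; disjoint = All.map (λ d x p q → d x (proj₁ (∧⁻ p)) q) (leftover-disjoint b) AllPairs.∷ disjoint
    ; bound = ≤≡ (trans (+-identityʳ _) (trans #S′ (cong suc (sym len)))) } , ≥≡ #S′
    where
    open Barrier b
    z∉⋃ : z ∉ ⋃ parts
    z∉⋃ = not⁻ (proj₂ (∧⁻ {W z ∧ not (S z)} z∈))
    #S′ : # (S ∪ ⁅ z ⁆) ≡ suc (# S)
    #S′ = #-insert (not⁻ (proj₂ (∧⁻ {W z} (proj₁ (∧⁻ z∈)))))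
    even-Z : Even (# (leftover b))
    even-Z = even-+⁻ (subst Even (cong (λ l → # (leftover b) + (# S + l)) len) (even-leftover b e))
        (even⁺ (# S) refl)

  -- The surplus 2 of the inner barrier pays for the lost part `P` and for the vertex `v`, which
  -- moves into `S`.
  refine : ∀ {W} (b : Barrier W 0) → length (Barrier.parts b) ≡ # (Barrier.S b) →
           ∀ {P} → P ∈ᴸ Barrier.parts b → ∀ v → v ∈ P → Barrier (P ∖ ⁅ v ⁆) 2 →
           Σ[ b′ ∈ Barrier W 0 ] # (Barrier.S b) < # (Barrier.S b′)
  refine {W} b len {P} i v v∈P b″ with extract i (Barrier.disjoint b)
  ... | rest , len′ , keep , P-rest , rest-disj = record
    { S = S′
    ; S⊆W = λ x p → [ S⊆W x , (λ q → [ (λ s → Part.P⊆W g x (subst (_∈ P) (∈⁅⁆⇒≡ s) v∈P)) ,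
        (λ s → Part.P⊆W g x (S″⊆P x s)) ]′ (∨⁻ {⁅ v ⁆ x} q)) ]′ (∨⁻ {S x} p)
    ; parts = rest ++ b″.parts
    ; good = All-++⁺ (All.zipWith (λ (h , d) → record
          { P⊆W = Part.P⊆W h
          ; P∩S = λ x p q → [ Part.P∩S h x p ,
              (λ s → [ (λ t → d x (subst (_∈ P) (∈⁅⁆⇒≡ t) v∈P) p) , (λ t → d x (S″⊆P x t) p) ]′
              (∨⁻ {⁅ v ⁆ x} s)) ]′ (∨⁻ {S x} q)
          ; closed = λ x y p q w → [ inj₁ , (λ s → inj₂ (∨⁺ˡ s)) ]′ (Part.closed h x y p q w)
          ; odd = Part.odd h }) (keep good , P-rest))
        (All.map (λ h → record
          { P⊆W = λ x p → Part.P⊆W g x (proj₁ (∧⁻ (Part.P⊆W h x p)))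
          ; P∩S = λ x p q → [ Part.P∩S g x (proj₁ (∧⁻ (Part.P⊆W h x p))) , (λ s →
              [ (λ t → true≢false t (not⁻ (proj₂ (∧⁻ {P x} (Part.P⊆W h x p))))) , Part.P∩S h x p ]′
                  (∨⁻ {⁅ v ⁆ x} s)) ]′ (∨⁻ {S x} q)
          ; closed = λ x y p q w → closed″ h x y p (Part.closed g x y (proj₁ (∧⁻ (Part.P⊆W h x p))) q w) w
          ; odd = Part.odd h }) b″.good)
    ; disjoint = AllPairs-++⁺ rest-disj b″.disjoint
        (All.map (λ d → All.map (λ h x p q → d x (proj₁ (∧⁻ (Part.P⊆W h x q))) p) b″.good) P-rest)
    ; bound = ≤-trans (≤≡ (+-identityʳ _))
        (≤-trans (≤≡ #S′) (refined-bound-arith (# S) (# b″.S) (length rest) (length b″.parts) _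
        (trans (sym len) len′) b″.bound (length-++ rest)))
    } , ≤-trans (refined-size-arith (# S) (# b″.S)) (≥≡ #S′)
    where
    open Barrier b
    module b″ = Barrier b″
    g : Part W S P
    g = All.lookup good i
    S″⊆P : b″.S ⊆ P
    S″⊆P x p = proj₁ (∧⁻ (b″.S⊆W x p))
    S′ : Sub n
    S′ = S ∪ (⁅ v ⁆ ∪ b″.S)
    #S′ : # S′ ≡ # S + suc (# b″.S)
    #S′ = trans (disjoint-∪ S (⁅ v ⁆ ∪ b″.S)
        (λ x p q → Part.P∩S g x ([ (λ s → subst (_∈ P) (∈⁅⁆⇒≡ s) v∈P) , S″⊆P x ]′ (∨⁻ {⁅ v ⁆ x} q)) p))
      (cong (# S +_) (trans (disjoint-∪ ⁅ v ⁆ b″.S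
          (λ x p q → true≢false p (not⁻ (proj₂ (∧⁻ {P x} (b″.S⊆W x q)))))) (cong (_+ # b″.S) (#⁅ v ⁆))))
    closed″ : ∀ {Q} → Part (P ∖ ⁅ v ⁆) b″.S Q → ∀ x y → x ∈ Q → y ∈ P ⊎ y ∈ S → r x y ≡ true → y ∈ Q
        ⊎ y ∈ S′
    closed″ h x y p (inj₂ s) w = inj₂ (∨⁺ˡ s)
    closed″ h x y p (inj₁ s) w with bool? (⁅ v ⁆ y)
    ... | inj₁ t = inj₂ (∨⁺ʳ {S y} (∨⁺ˡ t))
    ... | inj₂ t = [ inj₁ , (λ u → inj₂ (∨⁺ʳ {S y} (∨⁺ʳ {⁅ v ⁆ y} u))) ]′
        (Part.closed h x y p (∧⁺ s (not⁺ t)) w)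

  Image : ∀ {q} → (Fin q → Fin n) → Sub n
  Image f y = any (λ i → ⁅ f i ⁆ y)

  image-size : ∀ {q} (f : Fin q → Fin n) → (∀ i j → f i ≡ f j → i ≡ j) → q ≤ # (Image f)
  image-size {q} f inj = ≤-trans (≥≡ (#full q))
    (#-injection f full (Image f) (λ i _ → any⁺ i (x∈⁅x⁆ (f i))) (λ i j _ _ → inj i j))

  -- A part is joined to its representative in `S` by an edge at some `v`, and the rest of the part
  -- is matched within itself.
  assemble : ∀ (S : Sub n) ps (f : Fin (length ps) → Fin n) → (∀ i → f i ∈ S) →
      (∀ i j → f i ≡ f j → i ≡ j) →
             All (λ P → Disjoint P S) ps → AllPairs Disjoint ps →
             (∀ i → ∃[ v ] v ∈ lookup ps i × r (f i) v ≡ true) →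
                 (∀ {P} → P ∈ᴸ ps → ∀ v → v ∈ P → Matching (P ∖ ⁅ v ⁆)) →
             Matching (⋃ ps ∪ Image f)
  assemble S [] f f∈S inj dS ds adj match = matching-empty λ _ → refl
  assemble S (P ∷ ps) f f∈S inj (dS All.∷ dSs) (d AllPairs.∷ ds) adj match with adj zero
  ... | v , v∈P , w = matching-cong (λ x → bool-ext (to x) (from x))
      (matching-∪ apart (matching-∪ inner (matching-pair (f zero) v w) (match (here refl) v v∈P))
      (assemble S ps (f ∘ suc) (f∈S ∘ suc) (λ i j e → Fin-suc-injective (inj (suc i) (suc j) e)) dSs
          ds (adj ∘ suc) (match ∘ there)))
    where
    in-pair : ∀ {x} → x ∈ ⁅ f zero ⁆ ∪ ⁅ v ⁆ → f zero ≡ x ⊎ v ≡ x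
    in-pair {x} p = [ (λ q → inj₁ (∈⁅⁆⇒≡ q)) , (λ q → inj₂ (∈⁅⁆⇒≡ q)) ]′ (∨⁻ {⁅ f zero ⁆ x} p)
    inner : Disjoint (⁅ f zero ⁆ ∪ ⁅ v ⁆) (P ∖ ⁅ v ⁆)
    inner x p q with in-pair p
    ... | inj₁ refl = dS x (proj₁ (∧⁻ q)) (f∈S zero)
    ... | inj₂ refl = true≢false (x∈⁅x⁆ v) (not⁻ (proj₂ (∧⁻ {P x} q)))
    cases : ∀ {x} → x ∈ (⁅ f zero ⁆ ∪ ⁅ v ⁆) ∪ (P ∖ ⁅ v ⁆) → f zero ≡ x ⊎ x ∈ P
    cases {x} p with ∨⁻ {⁅ f zero ⁆ x ∨ ⁅ v ⁆ x} p
    ... | inj₂ q = inj₂ (proj₁ (∧⁻ q))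
    ... | inj₁ q with in-pair q
    ...   | inj₁ e    = inj₁ e
    ...   | inj₂ refl = inj₂ v∈P
    image⊆S : ∀ x → x ∈ Image (f ∘ suc) → ∃[ i ] f (suc i) ≡ x
    image⊆S x p = let i , q = any⁻ {f = λ i → ⁅ f (suc i) ⁆ x} p in i , ∈⁅⁆⇒≡ q
    apart : Disjoint ((⁅ f zero ⁆ ∪ ⁅ v ⁆) ∪ (P ∖ ⁅ v ⁆)) (⋃ ps ∪ Image (f ∘ suc))
    apart x p q with cases p | ∨⁻ {⋃ ps x} q
    ... | inj₁ refl | inj₁ s = let Q , i , t = ⋃⁻ ps s in All.lookup dSs i x t (f∈S zero)
    ... | inj₁ e    | inj₂ s = let i , e′ = image⊆S x s in case inj zero (suc i) (trans e (sym e′)) of λ ()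
    ... | inj₂ t    | inj₁ s = disjoint-⋃ d x t s
    ... | inj₂ t    | inj₂ s = let i , e = image⊆S x s in dS x t (subst (_∈ S) e (f∈S (suc i)))
    to : ∀ x → x ∈ ((⁅ f zero ⁆ ∪ ⁅ v ⁆) ∪ (P ∖ ⁅ v ⁆)) ∪ (⋃ ps ∪ Image (f ∘ suc)) → x ∈ (P ∪ ⋃ ps)
        ∪ Image f
    to x p with ∨⁻ {((⁅ f zero ⁆ ∪ ⁅ v ⁆) ∪ (P ∖ ⁅ v ⁆)) x} p
    to x p | inj₁ q with cases q
    ... | inj₁ e = ∨⁺ʳ {P x ∨ ⋃ ps x}
        (any⁺ {f = λ i → ⁅ f i ⁆ x} zero (subst (_∈ ⁅ f zero ⁆) e (x∈⁅x⁆ (f zero))))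
    ... | inj₂ t = ∨⁺ˡ (∨⁺ˡ t)
    to x p | inj₂ q with ∨⁻ {⋃ ps x} q
    ... | inj₁ t = ∨⁺ˡ (∨⁺ʳ {P x} t)
    ... | inj₂ t = ∨⁺ʳ {P x ∨ ⋃ ps x} (∨⁺ʳ {⁅ f zero ⁆ x} t)
    from : ∀ x → x ∈ (P ∪ ⋃ ps) ∪ Image f → x ∈ ((⁅ f zero ⁆ ∪ ⁅ v ⁆) ∪ (P ∖ ⁅ v ⁆)) ∪
        (⋃ ps ∪ Image (f ∘ suc))
    from x p with ∨⁻ {P x ∨ ⋃ ps x} p
    from x p | inj₁ q with ∨⁻ {P x} q
    ... | inj₂ t = ∨⁺ʳ {((⁅ f zero ⁆ ∪ ⁅ v ⁆) ∪ (P ∖ ⁅ v ⁆)) x} (∨⁺ˡ t)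
    ... | inj₁ t with bool? (⁅ v ⁆ x)
    ...   | inj₁ u = ∨⁺ˡ (∨⁺ˡ (∨⁺ʳ {⁅ f zero ⁆ x} u))
    ...   | inj₂ u = ∨⁺ˡ (∨⁺ʳ {⁅ f zero ⁆ x ∨ ⁅ v ⁆ x} (∧⁺ t (not⁺ u)))
    from x p | inj₂ q with ∨⁻ {⁅ f zero ⁆ x} q
    ... | inj₁ t = ∨⁺ˡ (∨⁺ˡ (∨⁺ˡ t))
    ... | inj₂ t = ∨⁺ʳ {((⁅ f zero ⁆ ∪ ⁅ v ⁆) ∪ (P ∖ ⁅ v ⁆)) x} (∨⁺ʳ {⋃ ps x} t)

  -- Hall's theorem for the parts against the vertices of `S`. A violator selects parts with too few
  -- neighbours in `S`, and these parts with these neighbours form a barrier.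
  finish : ∀ {W} (b : Barrier W 0) → length (Barrier.parts b) ≡ # (Barrier.S b) → (∀ x → x ∉ leftover b) →
           (∀ {P} → P ∈ᴸ Barrier.parts b → ∀ v → v ∈ P → Matching (P ∖ ⁅ v ⁆)) → Fin n → Matching W
               ⊎ Barrier W 1
  finish {W} b len none match y₀ with Hall.hall R y₀ _ full S ≤-refl
    where
    open Barrier b
    R : Fin (length parts) → Fin n → Bool
    R i s = any (λ v → lookup parts i v ∧ r s v)
  ... | inj₁ M = inj₁ (matching-cong (⊆-antisym to from)
      (assemble S parts f (λ i → f∈T i refl) (λ i j → injective i j refl refl)
      (All.map Part.P∩S good) disjoint (λ i → let v , p = any⁻ {f = λ v → lookup parts i v ∧ r (f i) v} (f-adj i refl) in v , ∧⁻ p) match))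
    where
    open Barrier b
    open Hall.Matching M
    image⊆S : Image f ⊆ S
    image⊆S x p = let i , q = any⁻ {f = λ i → ⁅ f i ⁆ x} p in subst (_∈ S) (∈⁅⁆⇒≡ q) (f∈T i refl)
    to : ⋃ parts ∪ Image f ⊆ W
    to x p = [ (λ q → proj₁ (∧⁻ (⋃⊆W∖S b x q))) , (λ q → S⊆W x (image⊆S x q)) ]′ (∨⁻ {⋃ parts x} p)
    from : W ⊆ ⋃ parts ∪ Image f
    from x p with bool? (S x) | bool? (⋃ parts x)
    ... | _      | inj₁ u = ∨⁺ˡ u
    -- There are as many parts as vertices of `S`, so the injection is onto.
    ... | inj₁ s | inj₂ u = ∨⁺ʳ {⋃ parts x}
        (⊆∧≥⇒⊇ {A = Image f} {S} image⊆S
        (≤-trans (≥≡ len) (image-size f (λ i j → injective i j refl refl))) x s)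
    ... | inj₂ s | inj₂ u = ⊥-elim (true≢false (∧⁺ (∧⁺ p (not⁺ s)) (not⁺ u)) (none x))
  ... | inj₂ (K , _ , v) = inj₂ record
    { S = T
    ; S⊆W = λ x p → S⊆W x (T⊆S x p)
    ; parts = select parts K
    ; good = select-All parts K λ i k → let g = All.lookup good (∈-lookup i) in record
        { P⊆W = Part.P⊆W g
        ; P∩S = λ x p q → Part.P∩S g x p (T⊆S x q)
        ; closed = λ x y p q w → [ inj₁ ,
            (λ s → inj₂ (Hall.reach⁺ R y₀ {K} {S} i y s k (any⁺ x (∧⁺ p (trans (r-sym y x) w))))) ]′
            (Part.closed g x y p q w)
        ; odd = Part.odd g }
    ; disjoint = select-disjoint parts K disjoint
    ; bound = ≤-trans (≤≡ (+-comm _ 1)) (≤-trans v (≥≡ (select-length parts K))) }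
    where
    open Barrier b
    R : Fin (length parts) → Fin n → Bool
    R i s = any (λ v → lookup parts i v ∧ r s v)
    T : Sub n
    T = Hall.reach R y₀ K S
    T⊆S : T ⊆ S
    T⊆S x p = proj₁ (∧⁻ {S x} p)

  -- A balanced barrier is enlarged until nothing is left over and every part minus any vertex has a
  -- matching. These sets are smaller than `W`, so induction on `m` decides about them.
  tutte : ∀ m W → # W ≤ m → Matching W ⊎ Barrier W 1
  tutte m W le with even-or-odd (# W)
  ... | inj₂ odd = inj₂ record
    { S = ∅ ; S⊆W = λ _ () ; parts = W ∷ []
    ; good = record { P⊆W = λ _ p → p ; P∩S = λ _ _ () ; closed = λ _ _ _ q _ → inj₁ q ; odd = odd }
        All.∷ All.[]
    ; disjoint = All.[] AllPairs.∷ AllPairs.[] ; bound = ≤≡ (cong (_+ 1) (∉⇒#≡0 {A = ∅} (λ _ → refl))) }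
  ... | inj₁ even = start m (empty? W) le
    where
    base : Barrier W 0
    base = record { S = ∅ ; S⊆W = λ _ () ; parts = [] ; good = All.[] ; disjoint = AllPairs.[] ;
        bound = ≤≡ (trans (+-identityʳ _) (∉⇒#≡0 {A = ∅} (λ _ → refl))) }
    start : ∀ m → Nonempty W ⊎ (∀ x → x ∉ W) → # W ≤ m → Matching W ⊎ Barrier W 1
    start m (inj₂ e) le = inj₁ (matching-empty e)
    start zero (inj₁ (y₀ , p)) le = ⊥-elim (n≮n 0 (≤-trans (∈⇒1≤ p) le))
    -- The fuel keeps `# S + g` above `n`, and `S` never exceeds `n` vertices.
    start (suc m) (inj₁ (y₀ , _)) le = grow (suc n) base (≤-trans (s≤s (m≤n+m n _)) (≤≡ (sym (+-suc _ n))))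
      where
      Grown : Barrier W 0 → Set
      Grown b = Σ[ b′ ∈ Barrier W 0 ] # (Barrier.S b) < # (Barrier.S b′)
      inspect : (b : Barrier W 0) → length (Barrier.parts b) ≡ # (Barrier.S b) → ∀ {P} → P ∈ᴸ
          Barrier.parts b →
                Grown b ⊎ (∀ v → v ∈ P → Matching (P ∖ ⁅ v ⁆))
      inspect b len {P} i with search {P = λ _ → Grown b} {Q = λ v → v ∈ P → Matching (P ∖ ⁅ v ⁆)} attempt
        where
        attempt : ∀ v → Grown b ⊎ (v ∈ P → Matching (P ∖ ⁅ v ⁆))
        attempt v with bool? (P v)
        ... | inj₂ q = inj₂ λ p → ⊥-elim (true≢false p q)
        ... | inj₁ p with tutte m (P ∖ ⁅ v ⁆)
            (s≤s⁻¹ (≤-trans (≥≡ (#-remove p))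
            (≤-trans (#-mono {A = P} {W} (Part.P⊆W (All.lookup (Barrier.good b) i))) le)))
        ...   | inj₁ M = inj₂ λ _ → M
        ...   | inj₂ b″ = inj₁ (refine b len i v p
            (strengthen (even-pred (subst (Even ∘ suc) (#-remove p)
            (Part.odd (All.lookup (Barrier.good b) i)))) b″))
      ... | inj₁ (_ , g) = inj₁ g
      ... | inj₂ h = inj₂ h
      inspect-all : (b : Barrier W 0) → length (Barrier.parts b) ≡ # (Barrier.S b) →
                    Grown b ⊎ (∀ {P} → P ∈ᴸ Barrier.parts b → ∀ v → v ∈ P → Matching (P ∖ ⁅ v ⁆))
      inspect-all b len with All-⊎ (Barrier.parts b) (inspect b len)
      ... | r = r
      grow : ∀ g (b : Barrier W 0) → n < # (Barrier.S b) + g → Matching W ⊎ Barrier W 1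
      grow zero b lt = ⊥-elim (n≮n n (≤-trans lt (≤-trans (≤≡ (+-identityʳ _)) (#≤n (Barrier.S b)))))
      grow (suc g) b lt with # (Barrier.S b) + 1 ≤? length (Barrier.parts b)
      ... | yes p = inj₂ record { Barrier b hiding (bound) ; bound = p }
      ... | no ¬p = continue (empty? (leftover b))
        where
        len : length (Barrier.parts b) ≡ # (Barrier.S b)
        len = ≤-antisym (s≤s⁻¹ (≤-trans (≰⇒> ¬p) (≤≡ (+-comm _ 1))))
            (≤-trans (≤≡ (sym (+-identityʳ _))) (Barrier.bound b))
        next : Grown b → Matching W ⊎ Barrier W 1
        next (b′ , p) = grow g b′ (≤-trans lt (≤-trans (≤≡ (+-suc _ g)) (p ⊞ ≤-refl)))
        continue : Nonempty (leftover b) ⊎ (∀ x → x ∉ leftover b) → Matching W ⊎ Barrier W 1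
        continue (inj₁ (z , p)) = next (absorb-vertex even b len z p)
        continue (inj₂ none) with inspect-all b len
        ... | inj₁ g     = next g
        ... | inj₂ match = finish b len none match y₀

-- Numerical bounds for the counts at `X`

common-neighbour-arith : ∀ a b i j s κ → a ≡ κ → b ≡ κ → i + j ≡ a + b → j ≤ s → suc s ≤ 2 * κ → 1 ≤ i
common-neighbour-arith a b i j s κ h₁ h₂ h₃ h₄ h₅ =
  by 0 (≥≡ h₁ ⊞ ≥≡ h₂ ⊞ ≥≡ h₃ ⊞ h₄ ⊞ h₅) (solve (a ∷ b ∷ i ∷ j ∷ s ∷ κ ∷ []))

sparse-outdegree-arith : ∀ f b δ κ → δ ≡ suc (suc f) * b → 7 ≤ b → δ ≤ 2 * κ + 1 → κ ≤ 5 → ⊥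
sparse-outdegree-arith f b δ κ h₁ h₂ h₃ h₄ =
  absurd (2 + 7 * f) (≥≡ h₁ ⊞ (2 + f) ⊠ h₂ ⊞ h₃ ⊞ 2 ⊠ h₄) (solve (f ∷ b ∷ δ ∷ κ ∷ []))

middle₄-arith : ∀ a i e → a + i ≡ 16 → i ≤ e → 5 * e ≤ 48 → 6 ≤ a
middle₄-arith a i e h₁ h₂ h₃ =
  ≮⇒≥ λ (a<6 : a < 6) → absurd 6 (5 ⊠ ≥≡ h₁ ⊞ 5 ⊠ h₂ ⊞ h₃ ⊞ 5 ⊠ a<6) (solve (a ∷ i ∷ e ∷ []))

middle₅-arith : ∀ a i e → a + i ≡ 25 → i ≤ e → 8 * e ≤ 120 → 8 ≤ a
middle₅-arith a i e h₁ h₂ h₃ =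
  ≮⇒≥ λ (a<8 : a < 8) → absurd 23 (8 ⊠ ≥≡ h₁ ⊞ 8 ⊠ h₂ ⊞ h₃ ⊞ 8 ⊠ a<8) (solve (a ∷ i ∷ e ∷ []))

union-excluded-arith : ∀ m b κ → b ≤ m → m ≤ 5 → 2 * κ ≤ b → 4 ≤ κ → ⊥
union-excluded-arith m b κ h₁ h₂ h₃ h₄ =
  absurd 2 (h₁ ⊞ h₂ ⊞ h₃ ⊞ 2 ⊠ h₄) (solve (m ∷ b ∷ κ ∷ []))

single-excluded-arith : ∀ m b κ → b ≤ m + 1 → m ≤ 5 → 2 * κ ≤ b → 4 ≤ κ → ⊥
single-excluded-arith m b κ h₁ h₂ h₃ h₄ =
  absurd 1 (h₁ ⊞ h₂ ⊞ h₃ ⊞ 2 ⊠ h₄) (solve (m ∷ b ∷ κ ∷ []))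

middle-excluded-arith : ∀ m i κ → i + m ≤ 2 * κ + 1 → 4 ≤ m → 2 * κ ≤ i + 2 → ⊥
middle-excluded-arith m i κ h₁ h₂ h₃ =
  absurd 0 (h₁ ⊞ h₂ ⊞ h₃) (solve (m ∷ i ∷ κ ∷ []))

single-single-excluded-arith : ∀ m b κ → b ≤ m + 2 → m ≤ 5 → 2 * κ ≤ b → 4 ≤ κ → ⊥
single-single-excluded-arith m b κ h₁ h₂ h₃ h₄ =
  absurd 0 (h₁ ⊞ h₂ ⊞ h₃ ⊞ 2 ⊠ h₄) (solve (m ∷ b ∷ κ ∷ []))

single-middle-excluded-arith : ∀ m i κ → i + m ≤ 2 * κ + 1 → 1 ≤ m → 3 * κ ≤ i + 2 → 4 ≤ κ → ⊥
single-middle-excluded-arith m i κ h₁ h₂ h₃ h₄ =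
  absurd 1 (h₁ ⊞ h₂ ⊞ h₃ ⊞ h₄) (solve (m ∷ i ∷ κ ∷ []))

inner-excluded-arith : ∀ m i κ → i + m ≤ 2 * κ + 1 → 3 * κ ≤ i → 4 ≤ κ → ⊥
inner-excluded-arith m i κ h₁ h₂ h₃ =
  absurd (2 + m) (h₁ ⊞ h₂ ⊞ h₃) (solve (m ∷ i ∷ κ ∷ []))

X-edges₆-arith : ∀ a x κ → a + x ≤ 10 → 2 * κ ≤ a → 5 ≤ κ → x ≤ 2
X-edges₆-arith a x κ h₁ h₂ h₃ =
  by 2 (h₁ ⊞ h₂ ⊞ 2 ⊠ h₃) (solve (a ∷ x ∷ κ ∷ []))

triangle₆-arith : ∀ a i x → a + i ≡ 18 → i + 3 ≤ 9 → a + x ≤ 10 → ⊥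
triangle₆-arith a i x h₁ h₂ h₃ =
  absurd (1 + x) (≥≡ h₁ ⊞ h₂ ⊞ h₃) (solve (a ∷ i ∷ x ∷ []))

narrow-outdegree-arith : ∀ i f b δ a κ → δ ≡ suc (suc f) * b → i + suc (suc f) ≡ suc κ → i < b → 2 ≤
    b → δ ≤ a → suc a ≤ 2 * κ → ⊥
narrow-outdegree-arith i f b δ a κ h₁ h₂ h₃ h₄ h₅ h₆ =
  absurd 0 (≥≡ h₁ ⊞ 2 ⊠ ≥≡ h₂ ⊞ 2 ⊠ h₃ ⊞ f ⊠ h₄ ⊞ h₅ ⊞ h₆) (solve (i ∷ f ∷ b ∷ δ ∷ a ∷ κ ∷ []))

halves-arith : ∀ κ p q b → p + q ≡ b → κ ≤ p → κ ≤ q → suc b ≤ 2 * κ → ⊥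
halves-arith κ p q b h₁ h₂ h₃ h₄ =
  absurd 0 (≤≡ h₁ ⊞ h₂ ⊞ h₃ ⊞ h₄) (solve (p ∷ q ∷ b ∷ κ ∷ []))

three-parts-arith : ∀ κ j t i x m → t ≡ 3 + j → i + x ≤ κ * (t + 2) → m ≤ 1 * (t + 2) → t *
    (5 * κ + 16) ≤ 3 * i + 9 * m → ⊥
three-parts-arith κ j t i x m refl h₁ h₂ h₃ =
  absurd (2 + 3 * x + j * (2 * κ + 7)) (3 ⊠ h₁ ⊞ 9 ⊠ h₂ ⊞ h₃) (solve (κ ∷ j ∷ i ∷ x ∷ m ∷ []))

two-parts-arith : ∀ κ i₁ i₂ m₁ m₂ x → κ ≡ 4 → i₁ + (i₂ + 0) + x ≤ κ * 4 → m₁ + (m₂ + 0) ≤ 4 → 1 ≤ x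
    → 12 ≤ i₁ + 2 * m₁ → 12 ≤ i₂ + 2 * m₂ → ⊥
two-parts-arith κ i₁ i₂ m₁ m₂ x refl h₂ h₃ h₄ h₅ h₆ =
  absurd 0 (h₂ ⊞ 2 ⊠ h₃ ⊞ h₄ ⊞ h₅ ⊞ h₆) (solve (i₁ ∷ i₂ ∷ m₁ ∷ m₂ ∷ x ∷ []))

small-piece-arith : ∀ p t d i κ → d + i ≡ κ * suc p → i + suc p ≤ suc p * suc p → κ ≡ suc (suc p) +
    t → κ ≤ d
small-piece-arith p t d i κ h₁ h₂ refl =
  by (p * t + p) (≥≡ h₁ ⊞ h₂) (solve (p ∷ t ∷ d ∷ i ∷ []))

middle-piece-arith : ∀ p t d i κ → d + i ≡ κ * suc (suc p) → i + suc (suc p) ≤ suc (suc p) * suc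
    (suc p) → κ ≡ suc (suc (suc p)) + t → 2 * κ ≤ d + 2
middle-piece-arith p t d i κ h₁ h₂ refl =
  by (p * t) (≥≡ h₁ ⊞ h₂) (solve (p ∷ t ∷ d ∷ i ∷ []))

rest-arith : ∀ κ p q b → p + q ≡ b → b ≤ 2 * κ + 1 → κ < p → q ≤ κ
rest-arith κ p q b h₁ h₂ h₃ =
  by 0 (≤≡ h₁ ⊞ h₂ ⊞ h₃) (solve (p ∷ q ∷ b ∷ κ ∷ []))

weight-union-arith : ∀ κ b m i → 4 ≤ κ → suc κ ≤ b → b ≤ m → 5 * κ + 16 ≤ 3 * i + 9 * m
weight-union-arith κ b m i h₁ h₂ h₃ =
  by (9 + 3 * i) (4 ⊠ h₁ ⊞ 9 ⊠ h₂ ⊞ 9 ⊠ h₃) (solve (κ ∷ b ∷ m ∷ i ∷ []))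

weight-single-arith : ∀ κ b m i → 4 ≤ κ → suc κ ≤ b → b ≤ m + 1 → κ ≤ i → 5 * κ + 16 ≤ 3 * i + 9 * m
weight-single-arith κ b m i h₁ h₂ h₃ h₄ =
  by 12 (7 ⊠ h₁ ⊞ 9 ⊠ h₂ ⊞ 9 ⊠ h₃ ⊞ 3 ⊠ h₄) (solve (κ ∷ b ∷ m ∷ i ∷ []))

weight-middle-arith : ∀ κ m i → 4 ≤ κ → 3 ≤ m → 2 * κ ≤ i + 2 → 5 * κ + 16 ≤ 3 * i + 9 * m
weight-middle-arith κ m i h₁ h₂ h₃ =
  by 9 (1 ⊠ h₁ ⊞ 9 ⊠ h₂ ⊞ 3 ⊠ h₃) (solve (κ ∷ m ∷ i ∷ []))

weight-single-single-arith : ∀ κ b m i → 4 ≤ κ → suc κ ≤ b → b ≤ m + 2 → 2 * κ ≤ i → 5 * κ + 16 ≤ 3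
    * i + 9 * m
weight-single-single-arith κ b m i h₁ h₂ h₃ h₄ =
  by 15 (10 ⊠ h₁ ⊞ 9 ⊠ h₂ ⊞ 9 ⊠ h₃ ⊞ 3 ⊠ h₄) (solve (κ ∷ b ∷ m ∷ i ∷ []))

weight-single-middle-arith : ∀ κ m i → 4 ≤ κ → 1 ≤ m → 3 * κ ≤ i + 2 → 5 * κ + 16 ≤ 3 * i + 9 * m
weight-single-middle-arith κ m i h₁ h₂ h₃ =
  by 3 (4 ⊠ h₁ ⊞ 9 ⊠ h₂ ⊞ 3 ⊠ h₃) (solve (κ ∷ m ∷ i ∷ []))

weight-inner-arith : ∀ κ m i → 4 ≤ κ → 3 * κ ≤ i → 5 * κ + 16 ≤ 3 * i + 9 * m
weight-inner-arith κ m i h₁ h₂ =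
  by (9 * m) (4 ⊠ h₁ ⊞ 3 ⊠ h₂) (solve (κ ∷ m ∷ i ∷ []))

weight₄-union-arith : ∀ κ b m → κ ≡ 4 → suc κ ≤ b → b ≤ m → m ≤ 4 → ⊥
weight₄-union-arith κ b m h₁ h₂ h₃ h₄ =
  absurd 0 (≥≡ h₁ ⊞ h₂ ⊞ h₃ ⊞ h₄) (solve (κ ∷ b ∷ m ∷ []))

weight₄-single-arith : ∀ κ b m i → κ ≡ 4 → suc κ ≤ b → b ≤ m + 1 → κ ≤ i → 12 ≤ i + 2 * m
weight₄-single-arith κ b m i h₁ h₂ h₃ h₄ =
  by 0 (3 ⊠ ≥≡ h₁ ⊞ 2 ⊠ h₂ ⊞ 2 ⊠ h₃ ⊞ h₄) (solve (κ ∷ b ∷ m ∷ i ∷ []))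

weight₄-middle-arith : ∀ κ m i → κ ≡ 4 → 3 ≤ m → 2 * κ ≤ i + 2 → 12 ≤ i + 2 * m
weight₄-middle-arith κ m i h₁ h₂ h₃ =
  by 0 (2 ⊠ ≥≡ h₁ ⊞ 2 ⊠ h₂ ⊞ h₃) (solve (κ ∷ m ∷ i ∷ []))

weight₄-single-single-arith : ∀ κ b m i → κ ≡ 4 → suc κ ≤ b → b ≤ m + 2 → 2 * κ ≤ i → 12 ≤ i + 2 * m
weight₄-single-single-arith κ b m i h₁ h₂ h₃ h₄ =
  by 2 (4 ⊠ ≥≡ h₁ ⊞ 2 ⊠ h₂ ⊞ 2 ⊠ h₃ ⊞ h₄) (solve (κ ∷ b ∷ m ∷ i ∷ []))

weight₄-single-middle-arith : ∀ κ m i → κ ≡ 4 → 1 ≤ m → 3 * κ ≤ i + 2 → 12 ≤ i + 2 * m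
weight₄-single-middle-arith κ m i h₁ h₂ h₃ =
  by 0 (3 ⊠ ≥≡ h₁ ⊞ 2 ⊠ h₂ ⊞ h₃) (solve (κ ∷ m ∷ i ∷ []))

weight₄-inner-arith : ∀ κ m i → κ ≡ 4 → 3 * κ ≤ i → 12 ≤ i + 2 * m
weight₄-inner-arith κ m i h₁ h₂ =
  by (2 * m) (3 ⊠ ≥≡ h₁ ⊞ h₂) (solve (κ ∷ m ∷ i ∷ []))

no-pair-arith : ∀ a b i κ → a + i ≡ suc κ * 2 → i + 2 ≤ 4 → a ≤ b → suc b ≤ 2 * κ → ⊥
no-pair-arith a b i κ h₁ h₂ h₃ h₄ =
  absurd 0 (≥≡ h₁ ⊞ h₂ ⊞ h₃ ⊞ h₄) (solve (a ∷ b ∷ i ∷ κ ∷ []))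

no-quintuple-arith : ∀ a i κ → a + i ≡ suc κ * 5 → a ≤ 2 * κ + 1 → 8 * i ≤ 120 → 4 ≤ κ → ⊥
no-quintuple-arith a i κ h₁ h₂ h₃ h₄ =
  absurd 7 (8 ⊠ ≥≡ h₁ ⊞ 8 ⊠ h₂ ⊞ h₃ ⊞ 24 ⊠ h₄) (solve (a ∷ i ∷ κ ∷ []))

no-sextuple-arith : ∀ a i κ → a + i ≡ suc κ * 6 → a ≤ 2 * κ + 1 → 7 * i ≤ 144 → 4 ≤ κ → ⊥
no-sextuple-arith a i κ h₁ h₂ h₃ h₄ =
  absurd 2 (7 ⊠ ≥≡ h₁ ⊞ 7 ⊠ h₂ ⊞ h₃ ⊞ 28 ⊠ h₄) (solve (a ∷ i ∷ κ ∷ []))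

no-quadruple-arith : ∀ a i κ → a + i ≡ suc κ * 4 → a ≤ 2 * κ + 1 → 5 * i ≤ 48 → 4 ≤ κ → ⊥
no-quadruple-arith a i κ h₁ h₂ h₃ h₄ =
  absurd 6 (5 ⊠ ≥≡ h₁ ⊞ 5 ⊠ h₂ ⊞ h₃ ⊞ 10 ⊠ h₄) (solve (a ∷ i ∷ κ ∷ []))

first-triangle-arith : ∀ a b x y → a + (b + 0) + (x + y) ≤ 20 → 9 ≤ b → 2 ≤ x → a ≤ 9
first-triangle-arith a b x y h₁ h₂ h₃ =
  by y (h₁ ⊞ h₂ ⊞ h₃) (solve (a ∷ b ∷ x ∷ y ∷ []))

second-triangle-arith : ∀ a b x y → a + (b + 0) + (x + y) ≤ 20 → 9 ≤ a → 2 ≤ x → b ≤ 9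
second-triangle-arith a b x y h₁ h₂ h₃ =
  by y (h₁ ⊞ h₂ ⊞ h₃) (solve (a ∷ b ∷ x ∷ y ∷ []))

no-outside-arith : ∀ a b x y → a + (b + 0) + (x + y) ≤ 20 → 9 ≤ a → 9 ≤ b → 2 ≤ x → y ≤ 0
no-outside-arith a b x y h₁ h₂ h₃ h₄ =
  by 0 (h₁ ⊞ h₂ ⊞ h₃ ⊞ h₄) (solve (a ∷ b ∷ x ∷ y ∷ []))

share-arith : ∀ a c u v → 5 * a ≤ 48 → 6 ≤ c → 2 ≤ v → u ≡ v → c + u + v ≤ a → ⊥
share-arith a c u v h₁ h₂ h₃ h₄ h₅ =
  absurd 1 (h₁ ⊞ 5 ⊠ h₂ ⊞ 10 ⊠ h₃ ⊞ 5 ⊠ ≥≡ h₄ ⊞ 5 ⊠ h₅) (solve (a ∷ c ∷ u ∷ v ∷ []))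

off-edge-arith : ∀ x e → 4 ≤ x → 1 * x ≤ e → e ≤ 2 → ⊥
off-edge-arith x e h₁ h₂ h₃ =
  absurd 1 (h₁ ⊞ h₂ ⊞ h₃) (solve (x ∷ e ∷ []))

κ≤5-arith : ∀ j s x y t κ → 5 + j ≡ κ → s + (x + y) ≤ suc κ * (3 + t + 2) → (3 + t) * (2 * κ) ≤ s → κ ≤ 5
κ≤5-arith j s x y t κ refl h₁ h₂ =
  by (x + y + t * (4 + j)) (h₁ ⊞ h₂) (solve (j ∷ s ∷ x ∷ y ∷ t ∷ []))

t≡0-arith : ∀ j s x y t κ → 5 + j ≡ κ → s + (x + y) ≤ suc κ * (3 + t + 2) → (3 + t) * (2 * κ) ≤ s → t ≤ 0
t≡0-arith j s x y t κ refl h₁ h₂ =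
  by (x + y + 3 * t + j + j * t) (h₁ ⊞ h₂) (solve (j ∷ s ∷ x ∷ y ∷ t ∷ []))

tight-arith : ∀ a b c s x y t κ → κ ≡ 5 → t ≤ 0 → a + (b + (c + s)) + (x + y) ≤ suc κ * (3 + t + 2)
    → 2 * κ ≤ a → 2 * κ ≤ b → 2 * κ ≤ c → a + x ≤ 10
tight-arith a b c s x y zero κ refl z≤n h₁ h₂ h₃ h₄ =
  by (s + y) (h₁ ⊞ h₃ ⊞ h₄) (solve (a ∷ b ∷ c ∷ s ∷ x ∷ y ∷ []))

budget-arith : ∀ s x o c u f m a b l → s ≤ c → m * b ≤ u → x + (u + (c + o)) ≤ f → f ≡ m * a → m * a
    ≤ m * (b + l) → s + (x + o) ≤ m * l
budget-arith s x o c u f m a b l h₁ h₂ h₃ h₄ h₅ =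
  by 0 (h₁ ⊞ h₂ ⊞ h₃ ⊞ ≤≡ h₄ ⊞ h₅) (solve (s ∷ x ∷ o ∷ c ∷ u ∷ f ∷ m ∷ a ∷ b ∷ l ∷ []))

E₄-arith : ∀ e → 2 * (5 * e) ≤ 5 * e + 48 → 5 * e ≤ 48
E₄-arith e h =
  by 0 h (solve (e ∷ []))

E₅-arith : ∀ e → 2 * (7 * e) ≤ 6 * e + 120 → 8 * e ≤ 120
E₅-arith e h =
  by 0 h (solve (e ∷ []))

E₆-arith : ∀ e → 2 * (7 * e) ≤ 7 * e + 144 → 7 * e ≤ 144
E₆-arith e h =
  by 0 h (solve (e ∷ []))

X-edges₅-arith : ∀ a b x y → a + (b + 0) + (x + y) ≤ 20 → 9 ≤ a → 9 ≤ b → x ≤ 2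
X-edges₅-arith a b x y h₁ h₂ h₃ =
  by y (h₁ ⊞ h₂ ⊞ h₃) (solve (a ∷ b ∷ x ∷ y ∷ []))

triangle-arith : ∀ a e → a + e ≡ 15 → a ≤ 9 → 6 ≤ e
triangle-arith a e h₁ h₂ =
  by 0 (≥≡ h₁ ⊞ h₂) (solve (a ∷ e ∷ []))

rows-arith : ∀ e c a b → 6 ≤ e → e ≡ a + b → a ≤ c → b ≤ 4 → 2 ≤ c
rows-arith e c a b h₁ h₂ h₃ h₄ =
  by 0 (h₁ ⊞ ≤≡ h₂ ⊞ h₃ ⊞ h₄) (solve (e ∷ c ∷ a ∷ b ∷ []))

linked-arith : ∀ a b i j → 2 ≤ a → 2 ≤ b → i + j ≡ a + b → j ≤ 3 → 1 ≤ i
linked-arith a b i j h₁ h₂ h₃ h₄ =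
  by 0 (h₁ ⊞ h₂ ⊞ ≥≡ h₃ ⊞ h₄) (solve (a ∷ b ∷ i ∷ j ∷ []))

ten-arith : ∀ a b x → a + (b + 0) + x ≤ 20 → 9 < b → a ≤ 10
ten-arith a b x h₁ h₂ =
  by x (h₁ ⊞ h₂) (solve (a ∷ b ∷ x ∷ []))

degree≥6-arith : ∀ u c x v m → v ≡ u + c → m ≤ c + x → x ≤ u + 4 → m ≤ v + 4
degree≥6-arith u c x v m h₁ h₂ h₃ =
  by 0 (≥≡ h₁ ⊞ h₂ ⊞ h₃) (solve (u ∷ c ∷ x ∷ v ∷ m ∷ []))

degree-5-arith : ∀ s x y κ t z → 4 ≡ κ → s + (x + y) ≤ suc κ * (3 + t + 2) → (3 + t) * 9 ≤ 1 * s + 0 * z → ⊥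
degree-5-arith s x y κ t z refl h₁ h₂ =
  absurd (1 + 4 * t + x + y) (h₁ ⊞ h₂) (solve (s ∷ x ∷ y ∷ t ∷ []))

∑ᴸ-≥-arith : ∀ a b u v s t → a * u + b * v + (a * s + b * t) ≡ a * (u + s) + b * (v + t)
∑ᴸ-≥-arith a b u v s t =
  solve (a ∷ b ∷ u ∷ v ∷ s ∷ t ∷ [])

closed-gap-arith : ∀ c x m u l → m ≤ c + x → x ≤ u + l → u ≡ 0 → m ≤ c + l
closed-gap-arith c x m u l h₁ h₂ h₃ =
  by 0 (h₁ ⊞ h₂ ⊞ ≤≡ h₃) (solve (c ∷ x ∷ m ∷ u ∷ l ∷ []))

no-parts-arith : ∀ x u → 4 ≤ x → x ≤ u + 2 → 1 ≤ u
no-parts-arith x u h₁ h₂ =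
  by 1 (h₁ ⊞ h₂) (solve (x ∷ u ∷ []))

one-part-arith : ∀ x u → 4 ≤ x → x ≤ u + 3 → 1 ≤ u
one-part-arith x u h₁ h₂ =
  by 0 (h₁ ⊞ h₂) (solve (x ∷ u ∷ []))

-- Connected nonbipartite vertex-transitive graphs of even order

module Core {n : ℕ} (H : Homogeneous n) (r-irrefl : ∀ x → Homogeneous.r H x x ≡ false) (even : Even n) where

  open Homogeneous H

  -- Adjacent or equal: neighbourhoods under this relation are closed neighbourhoods, and every
  -- degree is one larger.
  r⁼ : Rel n
  r⁼ x y = r x y ∨ ⁅ x ⁆ y

  r⁼-sym : Symm r⁼
  r⁼-sym x y = cong₂ _∨_ (r-sym x y) (bool-ext (λ p → subst (_∈ ⁅ y ⁆) (sym (∈⁅⁆⇒≡ p)) (x∈⁅x⁆ y))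
      (λ p → subst (_∈ ⁅ x ⁆) (sym (∈⁅⁆⇒≡ p)) (x∈⁅x⁆ x)))

  r⁼-inv : Invariant r⁼
  r⁼-inv φ a x y = cong₂ _∨_ (r-inv φ a x y) (bool-ext
    (λ p → subst (_∈ ⁅ x ⁆) (trans (sym (inverseˡ φ))
        (trans (cong (φ ⟨$⟩ˡ_) (∈⁅⁆⇒≡ p)) (inverseˡ φ))) (x∈⁅x⁆ x))
    (λ p → subst (_∈ ⁅ φ ⟨$⟩ʳ x ⁆) (cong (φ ⟨$⟩ʳ_) (∈⁅⁆⇒≡ p)) (x∈⁅x⁆ (φ ⟨$⟩ʳ x))))

  r⁼-regular : ∀ x → # (r⁼ x) ≡ suc (suc κ)
  r⁼-regular x = trans (#-insert {A = r x} {x} (r-irrefl x)) (cong suc (regular x))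

  r⁼-connected : ∀ F → Nonempty F → (∀ x y → x ∈ F → r⁼ x y ≡ true → y ∈ F) → ∀ x → x ∈ F
  r⁼-connected F e h = connected F e (λ x y p w → h x y p (∨⁺ˡ w))

  r⁼-nonbipartite : Fin n → ∀ (F : Sub n) → (∀ x y → r⁼ x y ≡ true → F x ≢ F y) → ⊥
  r⁼-nonbipartite x F h = h x x (∨⁺ʳ {r x x} (x∈⁅x⁆ x)) refl

  H⁼ : Fin n → Homogeneous n
  H⁼ x = record
    { symmetry = symmetry ; r = r⁼ ; r-sym = r⁼-sym ; r-inv = r⁼-inv ; κ = suc κ ; regular = r⁼-regular
    ; connected = r⁼-connected ; nonbipartite = r⁼-nonbipartite x }

  module V = VertexAtoms H

  module V⁼ (x : Fin n) = VertexAtoms (H⁼ x)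

  module Classes {s : ℕ} (1≤s : 1 ≤ s) {c : ℕ}
    (S : EdgeAtoms.AtomSystem H s 1≤s c) where

    open EdgeAtoms.AtomSystem S
    open Partition partition

    in′ out : Rel n
    in′ x y = r x y ∧ B x y
    out x y = r x y ∧ not (B x y)

    in-sym : Symm in′
    in-sym x y = cong₂ _∧_ (r-sym x y) (symm x y)

    out-sym : Symm out
    out-sym x y = cong₂ (λ a b → a ∧ not b) (r-sym x y) (symm x y)

    out-inv : Invariant out
    out-inv φ a x y = cong₂ (λ u v → u ∧ not v) (r-inv φ a x y) (invariant φ a x y)

    in⊆B : ∀ x y → in′ x y ≡ true → y ∈ B x
    in⊆B x y w = proj₂ (∧⁻ {r x y} w)

    out⊆∁B : ∀ x y → out x y ≡ true → y ∈ B x → ⊥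
    out⊆∁B x y w p = true≢false p (not⁻ (proj₂ (∧⁻ {r x y} w)))

    #in+#out : ∀ x → # (in′ x) + # (out x) ≡ suc κ
    #in+#out x = trans (#∩+#∖ (r x) (B x)) (regular x)

    #in<size : ∀ x → # (in′ x) < size
    #in<size x = ≤-trans (≤-trans (≥≡
        (#-insert {A = in′ x} {x} (≡false λ p → true≢false (proj₁ (∧⁻ p)) (r-irrefl x))))
      (#-mono {A = in′ x ∪ ⁅ x ⁆} {B x} λ y p →
          [ in⊆B x y , (λ q → subst (_∈ B x) (∈⁅⁆⇒≡ q) (self x)) ]′ (∨⁻ {in′ x y} p))) (≤≡ (#B x))

    d-split : ∀ F → d r F ≡ d in′ F + d out F
    d-split F = E-split-rel F (∁ F) B

    d-in-saturated : ∀ {F} → Saturated F → d in′ F ≡ 0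
    d-in-saturated {F} sat = E-zero λ x y p q w → true≢false (sat p (in⊆B x y w)) (not⁻ q)

    module _ (x₀ : Fin n) where

      e : ℕ
      e = # (out x₀)

      #out : ∀ x → # (out x) ≡ e
      #out x = degree-const {out} out-inv x x₀

      -- The cut of a class consists of all `out` edges at its vertices.
      δ≡ : δ ≡ e * size
      δ≡ = trans (sym (d-class x₀)) (trans (d-split (B x₀))
          (trans (cong (_+ d out (B x₀)) (d-in-saturated (saturated-class x₀)))
        (trans (≤-antisym (E-mono′ λ x y p q w → p , refl , w)
            (E-mono′ λ x y p q w → p , not⁺ (≡false λ t → out⊆∁B x y w (join (swap p) t)) , w))
          (trans (E-full (B x₀) (λ x _ → #out x)) (cong (e *_) (#B x₀))))))

      1≤e : 1 ≤ e
      1≤e with 1 ≤? e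
      ... | yes p = p
      ... | no ¬p = ⊥-elim (true≢false (connected (B x₀) (x₀ , self x₀) (λ x y p w → case bool? (B x y) of λ where
            (inj₁ q) → join p q
            (inj₂ q) → ⊥-elim (true≢false (∧⁺ w (not⁺ q))
                (#≡0⇒∉ {A = out x} (trans (#out x) (n≤0⇒n≡0 (s≤s⁻¹ (≰⇒> ¬p)))) y))) (proj₁ y₀))
                (not⁻ (proj₂ y₀)))
        where
        y₀ : Nonempty (∁ (B x₀))
        y₀ = nonempty (∁ (B x₀)) (≤-trans 1≤s (proj₂ (class-adm x₀)))

    s≤size : Fin n → s ≤ size
    s≤size x = ≤-trans (proj₁ (class-adm x)) (≤≡ (#B x))

    union-bound : ∀ F → Saturated F → Nonempty F → Nonempty (∁ F) → δ ≤ d out F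
    union-bound F sat (x , p) (y , q) = ≤-trans
        (low F (≤-trans (s≤size x) (size≤ {F} sat p) , ≤-trans (s≤size x)
        (size≤ {∁ F} (saturated-∁ {F} sat) q)))
      (≤≡ (trans (d-split F) (cong (_+ d out F) (d-in-saturated {F} sat))))

    module _ (#in : ∀ x → # (in′ x) ≡ κ) where

      in-cut : ∀ P → d in′ P + E in′ P P ≡ κ * # P
      in-cut P = d+E P #in

      inner≤ : ∀ P → E in′ P P + # P ≤ # P * # P
      inner≤ = E-inner λ x → ≡false λ p → true≢false (proj₁ (∧⁻ p)) (r-irrefl x)

      -- A piece of p vertices has cut at least p (κ + 1 - p), a concave function of p with value κ
      -- at both p = 1 and p = κ.
      small-piece : ∀ P → 1 ≤ # P → # P < κ → κ ≤ d in′ P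
      small-piece P h₁ h₂ with # P | in-cut P | inner≤ P | m+[n∸m]≡n h₂
      ... | suc p | eq | le | k = small-piece-arith p (κ ∸ suc (suc p)) (d in′ P) (E in′ P P) κ eq
          le (sym k)

      -- The same concave bound takes the value 2 (κ - 1) at p = 2 and p = κ - 1.
      middle-piece : ∀ P → 2 ≤ # P → # P < κ → 2 * κ ≤ d in′ P + 2
      middle-piece P h₁ h₂ with # P | in-cut P | inner≤ P | m+[n∸m]≡n h₂
      ... | suc (suc p) | eq | le | k = middle-piece-arith p (κ ∸ suc (suc (suc p))) (d in′ P)
          (E in′ P P) κ eq le (sym k)
      ... | suc zero | _ | _ | _ = case h₁ of λ { (s≤s ()) }

      d-in-rest : ∀ z P → P ⊆ B z → d in′ (B z ∖ P) ≡ d in′ P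
      d-in-rest z P h = trans (≤-antisym
          (E-mono′ {A′ = B z ∖ P} {B′ = P} λ x y p q w → p , inside
              (join (proj₁ (∧⁻ p)) (in⊆B x y w)) (not⁻ q) , w)
          (E-mono′ {A′ = B z ∖ P} {B′ = ∁ (B z ∖ P)} λ x y p q w → p , not⁺
              (≡false λ t → true≢false q (not⁻ (proj₂ (∧⁻ {B z y} t)))) , w))
        (trans (E-sym in-sym (B z ∖ P) P) (≤-antisym
          (E-mono′ {A′ = P} {B′ = ∁ P} λ x y p q w → p , proj₂ (∧⁻ {B z y} q) , w)
          (E-mono′ {A′ = P} {B′ = B z ∖ P} λ x y p q w → p , ∧⁺ (join (h x p) (in⊆B x y w)) q , w)))
        where
        inside : ∀ {y} → y ∈ B z → B z y ∧ not (P y) ≡ false → y ∈ P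
        inside {y} t u with bool? (P y)
        ... | inj₁ p = p
        ... | inj₂ p = ⊥-elim (true≢false (∧⁺ t (not⁺ p)) u)

      #rest-of : ∀ z P → P ⊆ B z → # P + # (B z ∖ P) ≡ size
      #rest-of z P h = trans (cong (_+ # (B z ∖ P))
          (#-cong (⊆-antisym {A = P} {B z ∩ P} (λ x p → ∧⁺ (h x p) p) (λ x p → proj₂ (∧⁻ {B z x} p)))))
        (trans (#∩+#∖ (B z) P) (#B z))

      -- A piece or its complement in the class has fewer than κ elements,
      -- or both have exactly κ.

      piece-bound : (Q : ℕ → Set) (l : ℕ) → ∀ z P → P ⊆ B z → size ≤ 2 * κ + 1 →
          (∀ P → # P < κ → l ≤ # P → Q (d in′ P)) →
                    (∀ P → P ⊆ B z → # P ≡ κ → κ ≤ # (B z ∖ P) → Q (d in′ P)) → l ≤ # P → l ≤ #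
                        (B z ∖ P) → Q (d in′ P)
      piece-bound Q l z P h le small equal p q with # P <? κ | # (B z ∖ P) <? κ
      ... | yes a | _     = small P a p
      ... | no _  | yes b = subst Q (d-in-rest z P h) (small (B z ∖ P) b q)
      ... | no a  | no b with # P ≟ᴺ κ
      ...   | yes c = equal P h c (≮⇒≥ b)
      ...   | no ¬c = subst Q (d-in-rest z P h) (equal (B z ∖ P) (λ x t → proj₁ (∧⁻ t))
                (≤-antisym ((rest-arith κ) (# P) (# (B z ∖ P)) size (#rest-of z P h) le κ<P) (≮⇒≥ b))
                (≤-trans (≮⇒≥ a) (≤≡ (sym (+-cancelˡ-≡ (# (B z ∖ P)) _ _
                    (trans (#rest-of z (B z ∖ P) (λ x t → proj₁ (∧⁻ t)))
                  (trans (sym (#rest-of z P h)) (+-comm (# P) _))))))))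
        where
        κ<P : κ < # P
        κ<P with m≤n⇒m<n∨m≡n (≮⇒≥ a)
        ... | inj₁ lt = lt
        ... | inj₂ eq = ⊥-elim (¬c (sym eq))

      size≡δ : Fin n → δ ≡ size
      size≡δ x = trans (δ≡ x) (trans (cong (_* size)
          (+-cancelˡ-≡ κ _ 1 (trans (cong (_+ # (out x)) (sym (#in x)))
          (trans (#in+#out x) (+-comm 1 κ))))) (+-identityʳ size))

      #out≡1 : ∀ x → # (out x) ≡ 1
      #out≡1 x = +-cancelˡ-≡ κ _ 1 (trans (cong (_+ # (out x)) (sym (#in x)))
          (trans (#in+#out x) (+-comm 1 κ)))

  -- A Tutte barrier X, with the singletons among its odd parts collected in U

  record Obstruction (Cs : List (Sub n)) : Set where
    field
      X U      : Sub n
      U∩X      : Disjoint U X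
      U-closed : ∀ x y → x ∈ U → r x y ≡ true → y ∈ X
      big      : All (λ C → 3 ≤ # C) Cs
      odd      : All (λ C → Even (suc (# C))) Cs
      C∩X      : All (λ C → Disjoint C X) Cs
      C∩U      : All (λ C → Disjoint C U) Cs
      C-closed : All (λ C → ∀ x y → x ∈ C → r x y ≡ true → y ∈ C ⊎ y ∈ X) Cs
      disjoint : AllPairs Disjoint Cs
      4≤X      : 4 ≤ # X
      bound    : # X ≤ # U + (length Cs + 2)

  ∑ᴸ : (Sub n → ℕ) → List (Sub n) → ℕ
  ∑ᴸ f []       = 0
  ∑ᴸ f (C ∷ Cs) = f C + ∑ᴸ f Cs

  ∑ᴸ-mono : ∀ {f g} {Cs} → All (λ C → f C ≤ g C) Cs → ∑ᴸ f Cs ≤ ∑ᴸ g Cs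
  ∑ᴸ-mono All.[]       = z≤n
  ∑ᴸ-mono (p All.∷ ps) = p ⊞ ∑ᴸ-mono ps

  ∑ᴸ-member : ∀ {f : Sub n → ℕ} {C Cs} → C ∈ᴸ Cs → f C ≤ ∑ᴸ f Cs
  ∑ᴸ-member {f} {C} (here refl) = m≤m+n (f C) _
  ∑ᴸ-member {f} {Cs = C′ ∷ Cs} (there i) = ≤-trans (∑ᴸ-member {f} i) (m≤n+m _ (f C′))

  ∑ᴸ-≥ : ∀ {f g} {Cs} w a b → All (λ C → w ≤ a * f C + b * g C) Cs → length Cs * w ≤ a * ∑ᴸ f Cs + b
      * ∑ᴸ g Cs
  ∑ᴸ-≥ w a b All.[] = z≤n
  ∑ᴸ-≥ {f} {g} {C ∷ Cs} w a b (p All.∷ ps) = ≤-trans (p ⊞ ∑ᴸ-≥ {f} {g} w a b ps)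
      (≤≡ (∑ᴸ-≥-arith a b (f C) (g C) (∑ᴸ f Cs) (∑ᴸ g Cs)))

  E-⋃ : ∀ {q} X Cs → AllPairs Disjoint Cs → ∑ᴸ (E q X) Cs ≤ E q X (⋃ Cs)
  E-⋃ X [] _ = z≤n
  E-⋃ {q} X (C ∷ Cs) (d AllPairs.∷ ds) = ≤-trans
    (E-mono′ {A′ = X} {B′ = (C ∪ ⋃ Cs) ∩ C} (λ x y p s w → p , ∧⁺ (∨⁺ˡ s) s , w)
     ⊞ ≤-trans (E-⋃ X Cs ds) (E-mono′ {A′ = X} {B′ = (C ∪ ⋃ Cs) ∖ C} λ x y p s w → p , ∧⁺
         (∨⁺ʳ {C y} s) (not⁺ (≡false λ t → disjoint-⋃ d y t s)) , w))
    (≥≡ (E-splitʳ X (⋃ (C ∷ Cs)) C))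

  module _ {Cs : List (Sub n)} (o : Obstruction Cs) where
    open Obstruction o

    outside : Sub n
    outside = ∁ (X ∪ (U ∪ ⋃ Cs))

    -- All edges at `U` go to `X` and use up `m * # U` of the `m * # X` edge ends there, so at most
    -- `m * (length Cs + 2)` remain for the parts, for `X` itself and for the outside. The count
    -- applies to the adjacency and separately to its pieces `in′` and `out`.
    budget : ∀ {q} → Symm q → (∀ x y → q x y ≡ true → r x y ≡ true) → ∀ m → (∀ x → # (q x) ≡ m) →
             ∑ᴸ (d q) Cs + (E q X X + E q X outside) ≤ m * (length Cs + 2)
    budget {q} q-sym q⊆r m #q = budget-arith (∑ᴸ (d q) Cs) (E q X X) (E q X outside) (E q X (⋃ Cs))
        (E q X U) (E q X full) m (# X) (# U) (length Cs + 2)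
        (≤-trans (∑ᴸ-mono (All.map (λ {C} h → ≤-trans (E-mono′ {A′ = C} {B′ = X} λ x y p s w →
           p , [ (λ t → ⊥-elim (true≢false t (not⁻ s))) , (λ t → t) ]′ (h x y p (q⊆r x y w)) , w)
               (≤≡ (E-sym q-sym C X))) C-closed)) (E-⋃ X Cs disjoint))
        (≤-trans (≥≡ (E-full U (λ x _ → #q x)))
            (≤-trans (E-mono′ {A′ = U} {B′ = X} λ x y p s w → p , U-closed x y p (q⊆r x y w) , w)
            (≤≡ (E-sym q-sym U X))))
        split (E-full X (λ x _ → #q x)) (m ⊠ bound)
      where
      U∩⋃ : ∀ x → x ∈ U → x ∈ ⋃ Cs → ⊥
      U∩⋃ x p s = let C , i , t = ⋃⁻ Cs s in All.lookup C∩U i x t p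
      X∩⋃ : ∀ x → x ∈ X → x ∈ ⋃ Cs → ⊥
      X∩⋃ x p s = let C , i , t = ⋃⁻ Cs s in All.lookup C∩X i x t p
      split : E q X X + (E q X U + (E q X (⋃ Cs) + E q X outside)) ≤ E q X full
      split = ≤-trans
        (E-mono′ {A′ = X} {B′ = full ∩ X} (λ x y p s w → p , s , w)
         ⊞ ≤-trans
           (E-mono′ {A′ = X} {B′ = (full ∖ X) ∩ U} (λ x y p s w → p , ∧⁺ (not⁺ (≡false (U∩X y s))) s , w)
            ⊞ ≤-trans
              (E-mono′ {A′ = X} {B′ = ((full ∖ X) ∖ U) ∩ ⋃ Cs}
                  (λ x y p s w → p , ∧⁺ (∧⁺ (not⁺ (≡false λ t → X∩⋃ y t s))
                  (not⁺ (≡false λ t → U∩⋃ y t s))) s , w)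
               ⊞ E-mono′ {A′ = X} {B′ = ((full ∖ X) ∖ U) ∖ ⋃ Cs} (λ x y p s w → p ,
                   ∧⁺ (∧⁺ (not⁺ (≡false λ t → true≢false (∨⁺ˡ {X y} t) (not⁻ s)))
                       (not⁺ (≡false λ t → true≢false (∨⁺ʳ {X y} (∨⁺ˡ {U y} t)) (not⁻ s))))
                      (not⁺ (≡false λ t → true≢false (∨⁺ʳ {X y} (∨⁺ʳ {U y} t)) (not⁻ s))) , w))
              (≥≡ (E-splitʳ X ((full ∖ X) ∖ U) (⋃ Cs))))
           (≥≡ (E-splitʳ X (full ∖ X) U)))
        (≥≡ (E-splitʳ X full X))

    #∁-part : ∀ {C} → C ∈ᴸ Cs → 4 ≤ # (∁ C)
    #∁-part {C} i = ≤-trans 4≤X (#-mono {A = X} {∁ C} λ x p → not⁺ (≡false λ q → All.lookup C∩X i x q p))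

    U-admissible : Nonempty U → ∀ {F} → (∀ x y → x ∈ F → r x y ≡ true → y ∈ U → ⊥) → Nonempty F →
        V.Admissible F
    U-admissible (u , p) {F} h e = e , (u , not⁺ (≡false λ q → let x , s , w = nbhd⁻ {r = r} {F} u q in h x u s w p))

    no-edge-to-U : ∀ x y → y ∈ U → r x y ≡ true → x ∈ X
    no-edge-to-U x y p w = U-closed y x p (trans (r-sym y x) w)

    U-adm : Nonempty U → V.Admissible U
    U-adm e = U-admissible e (λ x y p w q → U∩X x p (no-edge-to-U x y q w)) e

    #N-U : # (nbhd r U) ≤ # U + (length Cs + 2)
    #N-U = ≤-trans (#-mono {A = nbhd r U} {X} λ y q → let x , s , w = nbhd⁻ {r = r} {U} y q in U-closed x y s w) bound

  -- If some edge cut is this small, the edge atoms are classes of κ + 1 to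
  -- 2 κ - 1 vertices joined by a perfect matching; the edges inside the
  -- classes and those of the matching can then be counted separately.

  module Narrow (4≤κ : 4 ≤ κ) (A : Sub n) (2≤A : 2 ≤ # A) (2≤∁A : 2 ≤ # (∁ A)) (dA : suc (d r A) ≤ 2 * κ) where

    module EA = EdgeAtoms H 2 (s≤s z≤n)

    x₀ : Fin n
    x₀ = proj₁ (nonempty A (≤-trans (s≤s z≤n) 2≤A))

    module _ (S : EA.AtomSystem (d r A)) where
      open Classes (s≤s z≤n) S
      open EA.AtomSystem S
      open Partition partition

      #in≡κ : ∀ x → # (in′ x) ≡ κ
      #in≡κ x = lem (# (out x)) (1≤e x) (δ≡ x) (#in+#out x) (#in<size x)
        where
        lem : ∀ e → 1 ≤ e → δ ≡ e * size → # (in′ x) + e ≡ suc κ → # (in′ x) < size → # (in′ x) ≡ κ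
        lem (suc zero) _ _ h _ = suc-injective (trans (+-comm 1 _) h)
        -- A class has at least `κ - f` and at least two vertices, so `suc (suc f)` leaving edges
        -- per vertex would make its cut at least `2 * κ`.
        lem (suc (suc f)) _ h₁ h₂ h₃ = ⊥-elim (narrow-outdegree-arith (# (in′ x)) f size δ (d r A) κ
            h₁ h₂ h₃ (s≤size x) δ≤c dA)

      κ<size : suc κ ≤ size
      κ<size = ≤-trans (≥≡ (cong suc (#in≡κ x₀))) (#in<size x₀)

      size<2κ : suc size ≤ 2 * κ
      size<2κ = ≤-trans (s≤s (≤-trans (≥≡ (size≡δ #in≡κ x₀)) δ≤c)) dA

      private
        equal : ∀ z P → P ⊆ B z → # P ≡ κ → κ ≤ # (B z ∖ P) → ⊥
        equal z P h p q = (halves-arith κ) (# P) (# (B z ∖ P)) size (#rest-of #in≡κ z P h) (≥≡ p) q size<2κ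
        size≤ᵏ : size ≤ 2 * κ + 1
        size≤ᵏ = ≤-trans (n≤1+n size) (≤-trans size<2κ (m≤m+n _ 1))

      matched : Matched B
      matched = record
        { partition = partition ; in′ = in′ ; out = out ; in⊆B = in⊆B ; out⊆∁B = out⊆∁B ; out-sym = out-sym
        ; #out = #out≡1 #in≡κ ; κ = κ ; 4≤κ = 4≤κ
        ; union-bound = λ F sat e f → ≤-trans (≥≡ (size≡δ #in≡κ x₀)) (union-bound F sat e f)
        ; piece-bound = λ z P h p q → piece-bound #in≡κ (κ ≤_) 1 z P h size≤ᵏ
            (λ P a b → small-piece #in≡κ P b a) (λ P s t u → ⊥-elim (equal z P s t u)) p q
        ; middle-bound = λ z P h p q → piece-bound #in≡κ (λ d → 2 * κ ≤ d + 2) 2 z P h size≤ᵏ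
            (λ P a b → middle-piece #in≡κ P b a) (λ P s t u → ⊥-elim (equal z P s t u)) p q
        ; c = 3 ; 3≤c = ≤-refl ; 2c≤size = ≤-trans (s≤s (s≤s 4≤κ)) (s≤s κ<size) }

      open Profiles matched using (Profile; profile; union; single; middle; single-single; single-middle; inner)

      -- The coefficients are chosen for three parts: the budgets allow a total weight of
      -- `15 * κ + 45`, three less than these bounds add up to.
      weight : ∀ {m i} → Profile m i → 5 * κ + 16 ≤ 3 * i + 9 * m
      weight {m} {i} (union h) = weight-union-arith κ size m i 4≤κ κ<size h
      weight {m} {i} (single h g) = weight-single-arith κ size m i 4≤κ κ<size h g
      weight {m} {i} (middle h g) = weight-middle-arith κ m i 4≤κ h g
      weight {m} {i} (single-single h g) = weight-single-single-arith κ size m i 4≤κ κ<size h g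
      weight {m} {i} (single-middle h g) = weight-single-middle-arith κ m i 4≤κ h g
      weight {m} {i} (inner g) = weight-inner-arith κ m i 4≤κ g

      -- For two parts the budgets allow a total of 16 + 2 * 4 = 24, exactly twice 12, so a single
      -- edge of `in′` within `X` decides.
      weight₄ : κ ≡ 4 → ∀ {m i} → m ≤ 4 → Profile m i → 12 ≤ i + 2 * m
      weight₄ κ≡4 {m} {i} m≤4 (union h) = ⊥-elim (weight₄-union-arith κ size m κ≡4 κ<size h m≤4)
      weight₄ κ≡4 {m} {i} m≤4 (single h g) = weight₄-single-arith κ size m i κ≡4 κ<size h g
      weight₄ κ≡4 {m} {i} m≤4 (middle h g) = weight₄-middle-arith κ m i κ≡4 h g
      weight₄ κ≡4 {m} {i} m≤4 (single-single h g) = weight₄-single-single-arith κ size m i κ≡4 κ<size h g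
      weight₄ κ≡4 {m} {i} m≤4 (single-middle h g) = weight₄-single-middle-arith κ m i κ≡4 h g
      weight₄ κ≡4 {m} {i} m≤4 (inner g) = weight₄-inner-arith κ m i κ≡4 g

      module _ {Cs : List (Sub n)} (o : Obstruction Cs) where
        open Obstruction o

        profiles : All (λ C → Profile (d out C) (d in′ C)) Cs
        profiles = All.tabulate λ {C} i → profile C (All.lookup big i) (≤-trans (n≤1+n 3) (#∁-part o i))

        in-budget : ∑ᴸ (d in′) Cs + E in′ X X ≤ κ * (length Cs + 2)
        in-budget = ≤-trans (≤-refl {∑ᴸ (d in′) Cs} ⊞ m≤m+n (E in′ X X) _)
            (budget o in-sym (λ x y w → proj₁ (∧⁻ w)) κ #in≡κ)

        out-budget : ∑ᴸ (d out) Cs ≤ 1 * (length Cs + 2)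
        out-budget = ≤-trans (m≤m+n _ _) (budget o out-sym (λ x y w → proj₁ (∧⁻ w)) 1 (#out≡1 #in≡κ))

        three-parts : 3 ≤ length Cs → ⊥
        three-parts 3≤t = three-parts-arith κ (length Cs ∸ 3) (length Cs) (∑ᴸ (d in′) Cs)
            (E in′ X X) (∑ᴸ (d out) Cs) (sym (m+[n∸m]≡n 3≤t))
          in-budget out-budget (∑ᴸ-≥ {d in′} {d out} (5 * κ + 16) 3 9 (All.map weight profiles))

        -- A class has fewer than `2 * κ` vertices, so `u` and a neighbour in its class have a
        -- common neighbour there; both neighbours of `u` lie in `X`.
        inner-edge : κ ≡ 4 → Nonempty U → 1 ≤ E in′ X X
        inner-edge κ≡4 (u , u∈U) = edge≤E {r = in′} {X} {X} x y (U-closed u x u∈U (proj₁ (∧⁻ x∈)))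
            (U-closed u y u∈U (proj₁ (∧⁻ (proj₁ (∧⁻ (proj₂ y∈)))))) (proj₂ (∧⁻ {in′ u y} (proj₂ y∈)))
          where
          x₁ : Nonempty (in′ u)
          x₁ = nonempty (in′ u) (≤-trans (≤-trans (s≤s z≤n) 4≤κ) (≥≡ (#in≡κ u)))
          x : Fin n
          x = proj₁ x₁
          x∈ : x ∈ in′ u
          x∈ = proj₂ x₁
          y∈ : Nonempty (in′ u ∩ in′ x)
          y∈ = nonempty (in′ u ∩ in′ x) (common-neighbour-arith (# (in′ u)) (# (in′ x))
              (# (in′ u ∩ in′ x)) (# (in′ u ∪ in′ x)) size κ (#in≡κ u) (#in≡κ x) (#∩+#∪ (in′ u) (in′ x))
            (≤-trans (#-mono {A = in′ u ∪ in′ x} {B u} λ z p →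
                [ in⊆B u z , (λ q → join (in⊆B u x x∈) (in⊆B x z q)) ]′ (∨⁻ {in′ u z} p))
                (≤≡ (#B u))) size<2κ)
          y : Fin n
          y = proj₁ y∈

      two-parts : ∀ {C₁ C₂} → (o : Obstruction (C₁ ∷ C₂ ∷ [])) → κ ≡ 4 → Nonempty (Obstruction.U o) → ⊥
      two-parts {C₁} {C₂} o κ≡4 u = lem (profiles o)
        where
        open Obstruction o
        lem : All (λ C → Profile (d out C) (d in′ C)) (C₁ ∷ C₂ ∷ []) → ⊥
        lem (p₁ All.∷ p₂ All.∷ All.[]) = two-parts-arith κ (d in′ C₁) (d in′ C₂) (d out C₁)
            (d out C₂) (E in′ X X) κ≡4 (in-budget o) (out-budget o) (inner-edge o κ≡4 u)
            (weight₄ κ≡4 (≤-trans (m≤m+n _ _) (out-budget o)) p₁)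
                (weight₄ κ≡4 (≤-trans (≤-trans (m≤m+n _ 0) (m≤n+m _ (d out C₁))) (out-budget o)) p₂)

    system : (EA.AtomSystem (d r A) → ⊥) → ⊥
    system = EA.atom-system A (2≤A , 2≤∁A) ≤-refl λ A′ adm dA′ → large A′ (proj₁ adm) dA′
      where
      large : ∀ A′ → 2 ≤ # A′ → d r A′ ≤ d r A → 4 ≤ suc (# A′)
      large A′ h dA′ with 3 ≤? # A′
      ... | yes p = s≤s p
      ... | no ¬p with # A′ | ≤-antisym (s≤s⁻¹ (≰⇒> ¬p)) h | d+E A′ regular | E-inner r-irrefl A′
      -- Two vertices span at most one edge, so a pair has cut at least `2 * κ`.
      ...   | _ | refl | e | f = ⊥-elim (no-pair-arith (d r A′) (d r A) (E r A′ A′) κ e f dA′ dA)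

  -- Here sets of four to six vertices have large boundaries, so an edge
  -- atom with at least four vertices on each side has at least seven, and
  -- its classes are again joined by a perfect matching.

  module Sparse (4≤κ : 4 ≤ κ) (κ≤5 : κ ≤ 5)
    (wide : ∀ A → 2 ≤ # A → 2 ≤ # (∁ A) → 2 * κ ≤ d r A)
    (codeg : ∀ x y → r x y ≡ true → # (r x ∩ r y) ≤ 1) where

    -- The parameter of `sparse`, 2 here and 3 for five or six vertices, is chosen so that the
    -- average degree still allowed lies between it and its successor.
    E₄ : ∀ P → # P ≡ 4 → 5 * E r P P ≤ 48
    E₄ P h with # P | h | sparse r-sym P (λ x y _ _ → codeg x y) 2
    ... | _ | refl | le = E₄-arith (E r P P) le

    E₅ : ∀ P → # P ≡ 5 → 8 * E r P P ≤ 120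
    E₅ P h with # P | h | sparse r-sym P (λ x y _ _ → codeg x y) 3
    ... | _ | refl | le = E₅-arith (E r P P) le

    E₆ : ∀ P → # P ≡ 6 → 7 * E r P P ≤ 144
    E₆ P h with # P | h | sparse r-sym P (λ x y _ _ → codeg x y) 3
    ... | _ | refl | le = E₆-arith (E r P P) le

    large : ∀ A → 4 ≤ # A → d r A ≤ 2 * κ + 1 → 7 ≤ # A
    large A h dA with 7 ≤? # A
    ... | yes p = p
    ... | no ¬p = ⊥-elim (cases (m≤n⇒m<n∨m≡n h))
      where
      eq : d r A + E r A A ≡ suc κ * # A
      eq = d+E A regular
      cases₆ : 5 < # A ⊎ 5 ≡ # A → ⊥
      cases₆ (inj₂ q) = no-quintuple-arith (d r A) (E r A A) κ
          (subst (λ a → d r A + E r A A ≡ suc κ * a) (sym q) eq) dA (E₅ A (sym q)) 4≤κ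
      cases₆ (inj₁ q) = no-sextuple-arith (d r A) (E r A A) κ
          (subst (λ a → d r A + E r A A ≡ suc κ * a) #A eq) dA (E₆ A #A) 4≤κ
        where
        #A : # A ≡ 6
        #A = ≤-antisym (s≤s⁻¹ (≰⇒> ¬p)) q
      cases : 4 < # A ⊎ 4 ≡ # A → ⊥
      cases (inj₁ q) = cases₆ (m≤n⇒m<n∨m≡n q)
      cases (inj₂ q) = no-quadruple-arith (d r A) (E r A A) κ
          (subst (λ a → d r A + E r A A ≡ suc κ * a) (sym q) eq) dA (E₄ A (sym q)) 4≤κ

    module EA = EdgeAtoms H 4 (s≤s z≤n)

    -- The classes have at least `2 * κ` vertices because no cut is narrow, and the budget leaves
    -- `C` at most five matching edges. No profile fits these bounds together with the bound on the
    -- cut of `C`.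
    dense : ∀ {Cs} (o : Obstruction Cs) → length Cs ≤ 3 → ∀ {C} → C ∈ᴸ Cs → 4 ≤ # C → d r C ≤ 2 * κ + 1 → ⊥
    dense {Cs} o t≤3 {C} C∈ 4≤C dC = EA.atom-system C (4≤C , #∁-part o C∈) dC
        (λ A adm dA → s≤s (large A (proj₁ adm) dA)) contra
      where
      x₀ : Fin n
      x₀ = proj₁ (nonempty C (≤-trans (s≤s z≤n) 4≤C))
      contra : EA.AtomSystem (2 * κ + 1) → ⊥
      contra S = profile-⊥ (profile C 4≤C (#∁-part o C∈))
        where
        open Classes (s≤s z≤n) S
        open EA.AtomSystem S
        open Partition partition

        7≤size : 7 ≤ size
        7≤size = ≤-trans (large (B x₀) (proj₁ (class-adm x₀)) (≤-trans (≤≡ (d-class x₀)) δ≤c)) (≤≡ (#B x₀))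

        #in≡κ : ∀ x → # (in′ x) ≡ κ
        #in≡κ x = lem (# (out x)) (1≤e x) (δ≡ x) (#in+#out x)
          where
          lem : ∀ e → 1 ≤ e → δ ≡ e * size → # (in′ x) + e ≡ suc κ → # (in′ x) ≡ κ
          lem (suc zero) _ _ h = suc-injective (trans (+-comm 1 _) h)
          lem (suc (suc f)) _ h₁ _ = ⊥-elim (sparse-outdegree-arith f size δ κ h₁ 7≤size δ≤c κ≤5)

        size≤ᵏ : size ≤ 2 * κ + 1
        size≤ᵏ = ≤-trans (≥≡ (size≡δ #in≡κ x₀)) δ≤c

        2κ≤size : 2 * κ ≤ size
        2κ≤size = ≤-trans (wide (B x₀) (≤-trans (s≤s (s≤s z≤n)) (proj₁ (class-adm x₀)))
            (≤-trans (s≤s (s≤s z≤n)) (proj₂ (class-adm x₀))))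
          (≤≡ (trans (d-class x₀) (size≡δ #in≡κ x₀)))

        -- The classes may have `2 * κ` or `2 * κ + 1` vertices, so pieces of exactly `κ` vertices
        -- occur; `κ` is 4 or 5, and such pieces span few edges.
        equal : ∀ z P → P ⊆ B z → # P ≡ κ → κ ≤ # (B z ∖ P) → 2 * κ ≤ d in′ P + 2 × κ ≤ d in′ P
        equal z P h p q = lem (m≤n⇒m<n∨m≡n 4≤κ)
          where
          i≤e : E in′ P P ≤ E r P P
          i≤e = E-mono′ λ x y s t w → s , t , proj₁ (∧⁻ w)
          lem : 4 < κ ⊎ 4 ≡ κ → 2 * κ ≤ d in′ P + 2 × κ ≤ d in′ P
          lem (inj₂ refl) = (6≤d ⊞ ≤-refl) , ≤-trans (s≤s (s≤s (s≤s (s≤s z≤n)))) 6≤d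
            where
            6≤d : 6 ≤ d in′ P
            6≤d = middle₄-arith (d in′ P) (E in′ P P) (E r P P)
                (trans (in-cut #in≡κ P) (cong (4 *_) p)) i≤e (E₄ P p)
          lem (inj₁ lt) with ≤-antisym κ≤5 lt
          ... | refl = (8≤d ⊞ ≤-refl) , ≤-trans (s≤s (s≤s (s≤s (s≤s (s≤s z≤n))))) 8≤d
            where
            8≤d : 8 ≤ d in′ P
            8≤d = middle₅-arith (d in′ P) (E in′ P P) (E r P P)
                (trans (in-cut #in≡κ P) (cong (5 *_) p)) i≤e (E₅ P p)

        matched : Matched B
        matched = record
          { partition = partition ; in′ = in′ ; out = out ; in⊆B = in⊆B ; out⊆∁B = out⊆∁B ; out-sym
              = out-sym
          ; #out = #out≡1 #in≡κ ; κ = κ ; 4≤κ = 4≤κ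
          ; union-bound = λ F sat e f → ≤-trans (≥≡ (size≡δ #in≡κ x₀)) (union-bound F sat e f)
          ; piece-bound = λ z P h p q → piece-bound #in≡κ (κ ≤_) 1 z P h size≤ᵏ
              (λ P a b → small-piece #in≡κ P b a) (λ P s t u → proj₂ (equal z P s t u)) p q
          ; middle-bound = λ z P h p q → piece-bound #in≡κ (λ d → 2 * κ ≤ d + 2) 2 z P h size≤ᵏ
              (λ P a b → middle-piece #in≡κ P b a) (λ P s t u → proj₁ (equal z P s t u)) p q
          -- The value 4 forces four matching edges in the case `middle`, just enough to exceed the
          -- cut bound `2 * κ + 1`.
          ; c = 4 ; 3≤c = n≤1+n 3 ; 2c≤size = s≤s 7≤size }

        open Profiles matched using (Profile; profile; union; single; middle; single-single; single-middle; inner)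

        i+m : d in′ C + d out C ≤ 2 * κ + 1
        i+m = ≤-trans (≥≡ (d-split C)) dC

        m≤5 : d out C ≤ 5
        m≤5 = ≤-trans (∑ᴸ-member {d out} C∈)
            (≤-trans (m≤m+n _ _) (≤-trans (budget o out-sym (λ x y w → proj₁ (∧⁻ w)) 1 (#out≡1 #in≡κ))
                (≤-trans (≤≡ (+-identityʳ _)) (t≤3 ⊞ ≤-refl))))

        profile-⊥ : Profile (d out C) (d in′ C) → ⊥
        profile-⊥ p = lem (d out C) (d in′ C) m≤5 i+m p
          where
          lem : ∀ m i → m ≤ 5 → i + m ≤ 2 * κ + 1 → Profile m i → ⊥
          lem m i h₁ h₂ (union h) = union-excluded-arith m size κ h h₁ 2κ≤size 4≤κ
          lem m i h₁ h₂ (single h _) = single-excluded-arith m size κ h h₁ 2κ≤size 4≤κ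
          lem m i h₁ h₂ (middle h g) = middle-excluded-arith m i κ h₂ h g
          lem m i h₁ h₂ (single-single h _) = single-single-excluded-arith m size κ h h₁ 2κ≤size 4≤κ
          lem m i h₁ h₂ (single-middle h g) = single-middle-excluded-arith m i κ h₂ h g 4≤κ
          lem m i h₁ h₂ (inner g) = inner-excluded-arith m i κ h₂ g 4≤κ

  -- Carries a bound on the edges among the neighbours of a vertex of `U`, all of which lie in `X`,
  -- over to every vertex.
  links : ∀ v w → E r (r v) (r v) ≡ E r (r w) (r w)
  links v w with transitive v w
  ... | φ , a , refl = trans (E-cong (λ x → sym (r-inv φ a v x)) (λ x → sym (r-inv φ a v x)))
      (E-permute φ (r-inv φ a) (r (φ ⟨$⟩ʳ v)) (r (φ ⟨$⟩ʳ v)))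

  -- Among the neighbours of `x`, the vertex `y` is adjacent to the common neighbours, and each of
  -- these edges is counted from both ends.
  codegree : ∀ x y → r x y ≡ true → 2 * # (r x ∩ r y) ≤ E r (r x) (r x)
  codegree x y w = ≤-trans (≤≡ (cong (# (r x ∩ r y) +_) (+-identityʳ _))) (≤-trans
    (row≤E {r = r} {r x ∩ ⁅ y ⁆} y (∧⁺ w (x∈⁅x⁆ y)) (r x)
     ⊞ ≤-trans (#-mono {A = r x ∩ r y} {(r x ∖ ⁅ y ⁆) ∩ r y} λ z p → ∧⁺
         (∧⁺ (proj₁ (∧⁻ p)) (not⁺ (≡false λ q →
           true≢false (subst (λ t → r y t ≡ true) (sym (∈⁅⁆⇒≡ q)) (proj₂ (∧⁻ {r x z} p)))
               (r-irrefl y)))) (proj₂ (∧⁻ {r x z} p)))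
       (≤-trans (row≤E {r = r} {⁅ y ⁆} y (x∈⁅x⁆ y) (r x ∖ ⁅ y ⁆))
           (≤-trans (≤≡ (E-sym r-sym ⁅ y ⁆ (r x ∖ ⁅ y ⁆)))
         (E-mono′ {A′ = r x ∖ ⁅ y ⁆} {B′ = r x} λ a b p q t → p , subst (_∈ r x) (∈⁅⁆⇒≡ q) w , t))))
    (≥≡ (E-splitˡ (r x) (r x) ⁅ y ⁆)))

  few-links : ∀ v → E r (r v) (r v) ≤ 2 → ∀ x y → r x y ≡ true → # (r x ∩ r y) ≤ 1
  few-links v h x y w = *-cancelˡ-≤ 2 (≤-trans (codegree x y w) (≤-trans (≤≡ (links x v)) h))

  links-U : ∀ {Cs} (o : Obstruction Cs) {u} → u ∈ Obstruction.U o → E r (r u) (r u) ≤ E r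
      (Obstruction.X o) (Obstruction.X o)
  links-U o {u} p = E-mono′ λ x y s t w → U-closed u x p s , U-closed u y p t , w
    where open Obstruction o

  -- The case of two odd parts in a 5-regular graph without narrow sets.
  -- Some part is a triangle; then both are, and X spans a single edge.  A
  -- vertex x of X off this edge lies in a triangle x p q, which shares the
  -- edge p q with one of the parts.

  module Degree5 (κ≡4 : κ ≡ 4) (wide : ∀ A → 2 ≤ # A → 2 ≤ # (∁ A) → 2 * κ ≤ d r A)
    {C₁ C₂ : Sub n} (o : Obstruction (C₁ ∷ C₂ ∷ [])) (u₀ : Nonempty (Obstruction.U o)) where

    open Obstruction o

    Cs : List (Sub n)
    Cs = C₁ ∷ C₂ ∷ []

    4≤κ : 4 ≤ κ
    4≤κ = ≥≡ κ≡4

    -- The degree is 5, so the cut has the parity of `# C`.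
    d-odd : ∀ {C} → C ∈ᴸ Cs → Even (d r C) → ⊥
    d-odd {C} i e = ¬even-suc (even-+⁻
        (subst Even (trans (d+E C regular) (cong (# C +_) (*-comm κ (# C))))
        (even-+ e (E-even r-sym r-irrefl C)))
      (even-* (# C) (even⁺ 2 κ≡4))) (All.lookup odd i)

    9≤d : ∀ {C} → C ∈ᴸ Cs → 9 ≤ d r C
    9≤d {C} i with m≤n⇒m<n∨m≡n (wide C (≤-trans (s≤s (s≤s z≤n)) (All.lookup big i))
        (≤-trans (s≤s (s≤s z≤n)) (#∁-part o i)))
    ... | inj₁ p = ≤-trans (≤≡ (cong (λ k → suc (2 * k)) (sym κ≡4))) p
    ... | inj₂ e = ⊥-elim (d-odd i (even⁺ κ (trans (sym e) (cong (κ +_) (+-identityʳ κ)))))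

    total : d r C₁ + (d r C₂ + 0) + (E r X X + E r X (outside o)) ≤ 20
    total = ≤-trans (budget o r-sym (λ _ _ w → w) (suc κ) regular) (≤≡ (cong (λ k → suc k * 4) κ≡4))

    EXX≤2 : E r X X ≤ 2
    EXX≤2 = X-edges₅-arith (d r C₁) (d r C₂) (E r X X) (E r X (outside o)) total (9≤d (here refl))
        (9≤d (there (here refl)))

    codeg : ∀ x y → r x y ≡ true → # (r x ∩ r y) ≤ 1
    codeg = few-links (proj₁ u₀) (≤-trans (links-U o (proj₂ u₀)) EXX≤2)

    open Sparse 4≤κ (≤-trans (≤≡ κ≡4) (n≤1+n 4)) wide codeg

    Triangle : Sub n → Set
    Triangle C = # C ≡ 3 × 6 ≤ E r C C

    triangle : ∀ {C} → C ∈ᴸ Cs → d r C ≤ 9 → Triangle C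
    triangle {C} i le with 4 ≤? # C
    ... | yes p = ⊥-elim (dense o (s≤s (s≤s z≤n)) i p (≤-trans le (≤≡ (cong (λ k → 2 * k + 1) (sym κ≡4)))))
    ... | no ¬p = #C , triangle-arith (d r C) (E r C C)
        (trans (d+E C regular) (cong₂ (λ k c → suc k * c) κ≡4 #C)) le
      where
      #C : # C ≡ 3
      #C = ≤-antisym (s≤s⁻¹ (≰⇒> ¬p)) (All.lookup big i)

    rows : ∀ {C} → Triangle C → ∀ {x} → x ∈ C → 2 ≤ # (C ∩ r x)
    rows {C} (#C , le) {x} p = rows-arith (E r C C) (# (C ∩ r x)) (E r (C ∩ ⁅ x ⁆) C)
        (E r (C ∖ ⁅ x ⁆) C) le (E-splitˡ C C ⁅ x ⁆)
        (≤-trans (E-rows-≤ {κ = # (C ∩ r x)} (C ∩ ⁅ x ⁆) C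
            (λ y q → ≤≡ (cong (λ z → # (C ∩ r z)) (sym (∈⁅⁆⇒≡ (proj₂ (∧⁻ {C y} q)))))))
           (≤-trans (# (C ∩ r x) ⊠ ≤-trans
               (#-mono {A = C ∩ ⁅ x ⁆} {⁅ x ⁆} (λ y q → proj₂ (∧⁻ {C y} q))) (≤≡ (#⁅ x ⁆)))
               (≤≡ (*-identityʳ _))))
        (≤-trans (E-rows-≤ {κ = 2} (C ∖ ⁅ x ⁆) C
            (λ y q → s≤s⁻¹ (≤-trans (≥≡ (#-insert {A = C ∩ r y} {y}
            (≡false λ t → true≢false (proj₂ (∧⁻ {C y} t)) (r-irrefl y))))
           (≤-trans (#-mono {A = (C ∩ r y) ∪ ⁅ y ⁆} {C} λ z t →
               [ (λ s → proj₁ (∧⁻ s)) , (λ s → subst (_∈ C) (∈⁅⁆⇒≡ s) (proj₁ (∧⁻ q))) ]′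
               (∨⁻ {C z ∧ r y z} t)) (≤≡ #C)))))
           (≤≡ (cong (2 *_) (suc-injective (trans (sym (#-remove p)) #C)))))

    linked : ∀ {C} → Triangle C → ∀ v → 1 ≤ E r (r v) (r v)
    linked {C} T v with nonempty C (≤-trans (s≤s z≤n) (≥≡ (proj₁ T)))
    ... | p , p∈C with nonempty (C ∩ r p) (≤-trans (s≤s z≤n) (rows T p∈C))
    ...   | q , q∈ with nonempty ((C ∩ r p) ∩ (C ∩ r q)) (linked-arith (# (C ∩ r p)) (# (C ∩ r q))
        (# ((C ∩ r p) ∩ (C ∩ r q))) (# ((C ∩ r p) ∪ (C ∩ r q)))
                            (rows T p∈C) (rows T (proj₁ (∧⁻ q∈))) (#∩+#∪ (C ∩ r p) (C ∩ r q))
                            (≤-trans (#-mono {A = (C ∩ r p) ∪ (C ∩ r q)} {C} λ z t →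
                                [ (λ s → proj₁ (∧⁻ s)) , (λ s → proj₁ (∧⁻ s)) ]′
                                (∨⁻ {C z ∧ r p z} t)) (≤≡ (proj₁ T))))
    ...     | z , z∈ = ≤-trans (edge≤E {r = r} {r p} {r p} q z (proj₂ (∧⁻ {C q} q∈))
        (proj₂ (∧⁻ {C z} (proj₁ (∧⁻ z∈)))) (proj₂ (∧⁻ {C z} (proj₂ (∧⁻ {C z ∧ r p z} z∈)))))
                         (≤≡ (links p v))

    2≤EXX : ∀ {C} → Triangle C → 2 ≤ E r X X
    2≤EXX T = lem (E r X X) (≤-trans (linked T (proj₁ u₀)) (links-U o (proj₂ u₀))) (E-even r-sym r-irrefl X)
      where
      lem : ∀ m → 1 ≤ m → Even m → 2 ≤ m
      lem (suc zero) _ e = ⊥-elim (¬even-suc even-0 e)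
      lem (suc (suc m)) _ _ = s≤s (s≤s z≤n)

    impossible : ∀ {C} → Triangle C → ⊥
    impossible T = on-triangle (empty? (X ∖ nbhd r X))
      where
      T₁ : Triangle C₁
      T₁ = triangle (here refl) (first-triangle-arith (d r C₁) (d r C₂) (E r X X)
          (E r X (outside o)) total (9≤d (there (here refl))) (2≤EXX T))
      T₂ : Triangle C₂
      T₂ = triangle (there (here refl)) (second-triangle-arith (d r C₁) (d r C₂) (E r X X)
          (E r X (outside o)) total (9≤d (here refl)) (2≤EXX T))
      no-outside : E r X (outside o) ≤ 0
      no-outside = no-outside-arith (d r C₁) (d r C₂) (E r X X) (E r X (outside o)) total
          (9≤d (here refl)) (9≤d (there (here refl))) (2≤EXX T)
      -- The triangle and `x` would be four vertices spanning five edges, which exceeds `E₄`.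
      share : ∀ {C} → Triangle C → ∀ x p q → x ∉ C → p ∈ C → q ∈ C → r x p ≡ true → r x q ≡ true → r
          p q ≡ true → ⊥
      share {C} (#C , le) x p q x∉ p∈ q∈ xp xq pq = share-arith (E r A A) (E r C C) (E r C ⁅ x ⁆)
          (E r ⁅ x ⁆ C) (E₄ A (trans (#-insert x∉) (cong suc #C))) le
          (≤-trans (two _ p∈ q∈ xp xq pq) (row≤E {r = r} {⁅ x ⁆} x (x∈⁅x⁆ x) C)) (E-sym r-sym C ⁅ x ⁆)
          (≤-trans (E-mono′ {A′ = A ∩ C} {B′ = A ∩ C} (λ a b s t w → ∧⁺ (∨⁺ˡ s) s , ∧⁺ (∨⁺ˡ t) t , w)
             ⊞ E-mono′ {A′ = A ∩ C} {B′ = A ∖ C} (λ a b s t w → ∧⁺ (∨⁺ˡ s) s , out-x t , w)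
             ⊞ E-mono′ {A′ = A ∖ C} {B′ = A} (λ a b s t w → out-x s , ∨⁺ˡ t , w))
            (≥≡ (trans (E-splitˡ A A C) (cong (_+ E r (A ∖ C) A) (E-splitʳ (A ∩ C) A C)))))
        where
        A : Sub n
        A = C ∪ ⁅ x ⁆
        out-x : ∀ {a} → a ∈ ⁅ x ⁆ → a ∈ A ∖ C
        out-x {a} s = ∧⁺ (∨⁺ʳ {C a} s) (not⁺ (trans (cong C (sym (∈⁅⁆⇒≡ s))) x∉))
        two : ∀ x → p ∈ C → q ∈ C → r x p ≡ true → r x q ≡ true → r p q ≡ true → 2 ≤ # (C ∩ r x)
        two x p∈ q∈ xp xq pq = ≤-trans (s≤s
            (∈⇒1≤ {A = (C ∩ r x) ∖ ⁅ p ⁆} {q}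
            (∧⁺ (∧⁺ q∈ xq) (not⁺ (≢⇒∉⁅⁆ {x = p} {q} λ { refl → true≢false pq (r-irrefl p) })))))
          (≥≡ (#-remove {A = C ∩ r x} {p} (∧⁺ p∈ xp)))
      on-triangle : Nonempty (X ∖ nbhd r X) ⊎ (∀ x → x ∉ X ∖ nbhd r X) → ⊥
      -- If each of the at least four vertices of `X` had a neighbour in `X`, then `E r X X` would
      -- be at least 4.
      on-triangle (inj₂ e) = off-edge-arith (# X) (E r X X) 4≤X (E-rows-≥ {κ = 1} X X each) EXX≤2
        where
        each : ∀ x → x ∈ X → 1 ≤ # (X ∩ r x)
        each x p with bool? (nbhd r X x)
        ... | inj₂ q = ⊥-elim (true≢false (∧⁺ p (not⁺ q)) (e x))
        ... | inj₁ q = let y , s , w = nbhd⁻ {r = r} {X} x q in ∈⇒1≤ {A = X ∩ r x} {y} (∧⁺ s (trans (r-sym x y) w))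
      on-triangle (inj₁ (x , x∈)) with empty? (r x ∩ nbhd r (r x))
      ... | inj₂ e = n≮n 0 (≤-trans (linked T x)
          (≤≡ (E-zero {r = r} {r x} {r x} λ p q s t w → true≢false
          (∧⁺ t (nbhd⁺ {r = r} {r x} p q s w)) (e q))))
      ... | inj₁ (q , q∈) with nbhd⁻ {r = r} {r x} q (proj₂ (∧⁻ {r x q} q∈))
      ...   | p , xp , pq = place (bool? (U p)) (bool? (C₁ p)) (bool? (C₂ p))
        where
        x∈X : x ∈ X
        x∈X = proj₁ (∧⁻ x∈)
        xq : r x q ≡ true
        xq = proj₁ (∧⁻ q∈)
        off : ∀ {y} → r x y ≡ true → y ∈ X → ⊥
        off {y} w s = true≢false (nbhd⁺ {r = r} {X} y x s (trans (r-sym y x) w))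
            (not⁻ (proj₂ (∧⁻ {X x} x∈)))
        inside : ∀ {C} → C ∈ᴸ Cs → p ∈ C → q ∈ C
        inside i s = [ (λ t → t) , (λ t → ⊥-elim (off xq t)) ]′ (All.lookup C-closed i p q s pq)
        x∉ : ∀ {C} → C ∈ᴸ Cs → x ∉ C
        x∉ i = ≡false λ s → All.lookup C∩X i x s x∈X
        place : p ∈ U ⊎ p ∉ U → p ∈ C₁ ⊎ p ∉ C₁ → p ∈ C₂ ⊎ p ∉ C₂ → ⊥
        place (inj₁ s) _ _ = off xq (U-closed p q s pq)
        place (inj₂ _) (inj₁ s) _ = share T₁ x p q (x∉ (here refl)) s (inside (here refl) s) xp xq pq
        place (inj₂ _) (inj₂ _) (inj₁ s) = share T₂ x p q (x∉ (there (here refl))) s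
            (inside (there (here refl)) s) xp xq pq
        place (inj₂ a) (inj₂ b) (inj₂ c) = n≮n 0
            (≤-trans (edge≤E {r = r} {X} {outside o} x p x∈X (not⁺ (≡false λ s →
            [ off xp , (λ t → [ (λ u → true≢false u a) ,
                (λ u → [ (λ v → true≢false v b) , (λ v → [ (λ z → true≢false z c) , (λ ()) ]′
                (∨⁻ {C₂ p} v)) ]′ (∨⁻ {C₁ p} u)) ]′ (∨⁻ {U p} t)) ]′ (∨⁻ {X p} s))) xp) no-outside)

    contradiction : ⊥
    contradiction with d r C₁ ≤? 9 | d r C₂ ≤? 9
    ... | yes p | _ = impossible (triangle (here refl) p)
    ... | no _ | yes p = impossible (triangle (there (here refl)) p)
    -- Two cuts above 9 within a total of 20 make the first exactly 10, which is even.
    ... | no p | no q = d-odd (here refl)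
        (even⁺ 5 (≤-antisym (ten-arith (d r C₁) (d r C₂) (E r X X + E r X (outside o)) total
        (≰⇒> q)) (≰⇒> p)))

  -- The closed neighbourhood of `C` lies in `C ∪ X` and misses the other part `C′`.
  closed-gap : ∀ {C C′ Cs} (o : Obstruction (C ∷ C′ ∷ Cs)) → (∀ x → x ∉ Obstruction.U o) →
               ∀ x → V⁼.Admissible x C × # (nbhd r⁼ C) ≤ # C + (length (C ∷ C′ ∷ Cs) + 2)
  closed-gap {C} {C′} {Cs} o none x =
      (member (here refl) , (c′ , not⁺
      (≡false λ q → [ (λ t → All.lookup (AllPairs-head disjoint) (here refl) c′ t c′∈) ,
      (λ t → All.lookup C∩X (there (here refl)) c′ c′∈ t) ]′ (∨⁻ {C c′} (sub c′ q))))) ,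
    closed-gap-arith (# C) (# X) (# (nbhd r⁼ C)) (# U) _ (≤-trans (#-mono {A = nbhd r⁼ C} {C ∪ X} sub)
      (≤≡ (disjoint-∪ C X (All.lookup C∩X (here refl))))) bound (∉⇒#≡0 none)
    where
    open Obstruction o
    AllPairs-head : ∀ {P ps} → AllPairs Disjoint (P ∷ ps) → All (Disjoint P) ps
    AllPairs-head (h AllPairs.∷ _) = h
    member : ∀ {D} → D ∈ᴸ (C ∷ C′ ∷ Cs) → Nonempty D
    member {D} i = nonempty D (≤-trans (s≤s z≤n) (All.lookup big i))
    c′ : Fin n
    c′ = proj₁ (member (there (here refl)))
    c′∈ : c′ ∈ C′
    c′∈ = proj₂ (member (there (here refl)))
    sub : nbhd r⁼ C ⊆ C ∪ X
    sub y q with nbhd⁻ {r = r⁼} {C} y q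
    ... | z , s , w with ∨⁻ {r z y} w
    ...   | inj₂ e = ∨⁺ˡ (subst (_∈ C) (∈⁅⁆⇒≡ e) s)
    ...   | inj₁ t = [ (λ a → ∨⁺ˡ a) , (λ b → ∨⁺ʳ {C y} b) ]′ (All.lookup C-closed (here refl) z y s t)

  -- With at most one larger part, `U` is nonempty and has excess at most 3. Two larger parts yield
  -- to parity, or to `Degree5` when the degree is 5 and `U` is nonempty. Three or more are bounded
  -- by the edges at `X`.
  obstruction-⊥ : 4 ≤ κ → ∀ {Cs} → Obstruction Cs → ⊥
  obstruction-⊥ 4≤κ {[]} o = V.gap≥4 (s≤s 4≤κ) even U
      (U-adm o (nonempty U (no-parts-arith (# X) (# U) 4≤X bound))) (≤-trans (#N-U o) (≤-refl ⊞ n≤1+n 2))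
    where
    open Obstruction o
  obstruction-⊥ 4≤κ {C ∷ []} o = V.gap≥4 (s≤s 4≤κ) even U
      (U-adm o (nonempty U (one-part-arith (# X) (# U) 4≤X bound))) (#N-U o)
    where
    open Obstruction o
  obstruction-⊥ 4≤κ {C₁ ∷ C₂ ∷ []} o = cases (empty? U)
    where
    open Obstruction o
    x₀ : Fin n
    x₀ = proj₁ (nonempty X (≤-trans (s≤s z≤n) 4≤X))
    C₁-odd : Even (# C₁) → ⊥
    C₁-odd e = ¬even-suc e (All.lookup odd (here refl))
    degree≥6 : Nonempty U → 5 ≤ κ → ⊥
    -- Both `U` and `U ∪ C₁` have excess at most 4, hence even size, although `C₁` is odd.
    degree≥6 u 5≤κ = V.even≥4 (s≤s 5≤κ) even U (U-adm o u) (#N-U o) λ e →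
      V.even≥4 (s≤s 5≤κ) even (U ∪ C₁) (U-admissible o u (λ x y p w q → case ∨⁻ {U x} p of λ where
          (inj₁ s) → U∩X x s (no-edge-to-U o x y q w)
          (inj₂ s) → All.lookup C∩X (here refl) x s (no-edge-to-U o x y q w))
        (proj₁ u , ∨⁺ˡ (proj₂ u)))
        (degree≥6-arith (# U) (# C₁) (# X) (# (U ∪ C₁)) (# (nbhd r (U ∪ C₁))) #UC
            (≤-trans (#-mono {A = nbhd r (U ∪ C₁)} {C₁ ∪ X} sub)
            (≤≡ (disjoint-∪ C₁ X (All.lookup C∩X (here refl))))) bound)
        λ e′ → C₁-odd (even-+⁻ (subst Even (trans #UC (+-comm (# U) _)) e′) e)
      where
      #UC : # (U ∪ C₁) ≡ # U + # C₁
      #UC = disjoint-∪ U C₁ (λ x p q → All.lookup C∩U (here refl) x q p)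
      sub : nbhd r (U ∪ C₁) ⊆ C₁ ∪ X
      sub y q with nbhd⁻ {r = r} {U ∪ C₁} y q
      ... | z , s , w with ∨⁻ {U z} s
      ...   | inj₁ a = ∨⁺ʳ {C₁ y} (U-closed z y a w)
      ...   | inj₂ b = [ (λ t → ∨⁺ˡ t) , (λ t → ∨⁺ʳ {C₁ y} t) ]′ (All.lookup C-closed (here refl) z y b w)
    cases : Nonempty U ⊎ (∀ x → x ∉ U) → ⊥
    cases (inj₂ none) = let adm , le = closed-gap o none x₀ in
      V⁼.reflexive-even≥4 x₀ (λ x → ∨⁺ʳ {r x x} (x∈⁅x⁆ x)) (s≤s (s≤s 4≤κ)) C₁ adm le C₁-odd
    cases (inj₁ u) with m≤n⇒m<n∨m≡n 4≤κ
    ... | inj₁ 5≤κ = degree≥6 u 5≤κ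
    ... | inj₂ 4≡κ = Degree5.contradiction (sym 4≡κ) wide o u
      where
      wide : ∀ A → 2 ≤ # A → 2 ≤ # (∁ A) → 2 * κ ≤ d r A
      wide A h₁ h₂ with 2 * κ ≤? d r A
      ... | yes p = p
      ... | no ¬p = ⊥-elim (Narrow.system 4≤κ A h₁ h₂ (≰⇒> ¬p) λ S → Narrow.two-parts 4≤κ A h₁ h₂
          (≰⇒> ¬p) S o (sym 4≡κ) u)
  obstruction-⊥ 4≤κ {C₁ ∷ C₂ ∷ C₃ ∷ Cs} o = cases (m≤n⇒m<n∨m≡n 4≤κ)
    where
    open Obstruction o
    t : ℕ
    t = length Cs
    x₀ : Fin n
    x₀ = proj₁ (nonempty X (≤-trans (s≤s z≤n) 4≤X))
    wide : ∀ A → 2 ≤ # A → 2 ≤ # (∁ A) → 2 * κ ≤ d r A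
    wide A h₁ h₂ with 2 * κ ≤? d r A
    ... | yes p = p
    ... | no ¬p = ⊥-elim (Narrow.system 4≤κ A h₁ h₂ (≰⇒> ¬p) λ S → Narrow.three-parts 4≤κ A h₁ h₂
        (≰⇒> ¬p) S o (s≤s (s≤s (s≤s z≤n))))
    wide-part : ∀ {C} → C ∈ᴸ (C₁ ∷ C₂ ∷ C₃ ∷ Cs) → 2 * κ ≤ d r C
    wide-part {C} i = wide C (≤-trans (s≤s (s≤s z≤n)) (All.lookup big i))
        (≤-trans (s≤s (s≤s z≤n)) (#∁-part o i))
    total : ∑ᴸ (d r) (C₁ ∷ C₂ ∷ C₃ ∷ Cs) + (E r X X + E r X (outside o)) ≤ suc κ * (3 + t + 2)
    total = budget o r-sym (λ _ _ w → w) (suc κ) regular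
    cases : 4 < κ ⊎ 4 ≡ κ → ⊥
    -- Parity raises the cut of each part from 8 to 9; from three parts on, nine per part exceed
    -- five times the number of parts plus two.
    cases (inj₂ 4≡κ) = degree-5-arith (∑ᴸ (d r) (C₁ ∷ C₂ ∷ C₃ ∷ Cs)) (E r X X) (E r X (outside o)) κ
        t (∑ᴸ (λ _ → 0) (C₁ ∷ C₂ ∷ C₃ ∷ Cs)) 4≡κ total
        (∑ᴸ-≥ {d r} {λ _ → 0} 9 1 0 (All.tabulate λ {C} i → ≤-trans (9≤d i)
            (≤≡ (sym (trans (+-identityʳ _) (+-identityʳ (d r C)))))))
      where
      9≤d : ∀ {C} → C ∈ᴸ (C₁ ∷ C₂ ∷ C₃ ∷ Cs) → 9 ≤ d r C
      9≤d {C} i with m≤n⇒m<n∨m≡n (wide-part i)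
      ... | inj₁ p = ≤-trans (≤≡ (cong (λ k → suc (2 * k)) 4≡κ)) p
      ... | inj₂ e = ⊥-elim (¬even-suc
          (even-+⁻ (subst Even (trans (d+E C regular) (cong (# C +_) (*-comm κ (# C))))
              (even-+ (even⁺ κ (trans (sym e) (cong (κ +_) (+-identityʳ κ))))
                  (E-even r-sym r-irrefl C))) (even-* (# C) (even⁺ 2 (sym 4≡κ)))) (All.lookup odd i))
    -- Cuts of at least `2 * κ` leave room only for three parts and `κ = 5`, with equality
    -- throughout.
    cases (inj₁ 5≤κ) = six (κ≤5 (κ ∸ 5) (m+[n∸m]≡n 5≤κ)) t≡0
      where
      sum≥ : (3 + t) * (2 * κ) ≤ ∑ᴸ (d r) (C₁ ∷ C₂ ∷ C₃ ∷ Cs)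
      sum≥ = ≤-trans (∑ᴸ-≥ {d r} {λ _ → 0} (2 * κ) 1 0 (All.tabulate λ {C} i → ≤-trans (wide-part i)
          (≤≡ (sym (trans (+-identityʳ _) (+-identityʳ (d r C)))))))
        (≤≡ (trans (+-identityʳ _) (+-identityʳ _)))
      κ≤5 : ∀ j → 5 + j ≡ κ → κ ≤ 5
      κ≤5 j e = κ≤5-arith j (∑ᴸ (d r) (C₁ ∷ C₂ ∷ C₃ ∷ Cs)) (E r X X) (E r X (outside o)) t κ e total sum≥
      t≡0 : t ≤ 0
      t≡0 = t≡0-arith (κ ∸ 5) (∑ᴸ (d r) (C₁ ∷ C₂ ∷ C₃ ∷ Cs)) (E r X X) (E r X (outside o)) t κ
          (m+[n∸m]≡n 5≤κ) total sum≥
      six : κ ≤ 5 → t ≤ 0 → ⊥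
      six κ≤5 t≤0 = split (empty? U)
        where
        κ≡5 : κ ≡ 5
        κ≡5 = ≤-antisym κ≤5 5≤κ
        dC₁+EXX : d r C₁ + E r X X ≤ 10
        dC₁+EXX = tight-arith (d r C₁) (d r C₂) (d r C₃) (∑ᴸ (d r) Cs) (E r X X) (E r X (outside o))
            t κ κ≡5 t≤0 total
          (wide-part (here refl)) (wide-part (there (here refl))) (wide-part (there (there (here refl))))
        split : Nonempty U ⊎ (∀ x → x ∉ U) → ⊥
        split (inj₂ none) = let adm , le = closed-gap o none x₀ in
          V⁼.reflexive-gap≥6 x₀ (λ x → ∨⁺ʳ {r x x} (x∈⁅x⁆ x)) (s≤s (s≤s 5≤κ)) C₁ adm
              (≤-trans le (≤-refl ⊞ (s≤s (s≤s (s≤s (t≤0 ⊞ ≤-refl))))))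
        split (inj₁ (u , p)) = Sparse.dense 4≤κ κ≤5 wide codeg o (s≤s (s≤s (s≤s t≤0))) (here refl) 4≤C₁
            (≤-trans (≤-trans (m≤m+n _ _) dC₁+EXX)
                (≤-trans (n≤1+n 10) (≤≡ (cong (λ k → 2 * k + 1) (sym κ≡5)))))
          where
          EXX≤2 : E r X X ≤ 2
          EXX≤2 = X-edges₆-arith (d r C₁) (E r X X) κ dC₁+EXX (wide-part (here refl)) 5≤κ
          codeg : ∀ x y → r x y ≡ true → # (r x ∩ r y) ≤ 1
          codeg = few-links u (≤-trans (links-U o p) EXX≤2)
          4≤C₁ : 4 ≤ # C₁
          4≤C₁ with m≤n⇒m<n∨m≡n (All.lookup big (here refl))
          ... | inj₁ q = q
          -- Three vertices of degree 6 have a cut of at least 12, above the available 10.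
          ... | inj₂ e = ⊥-elim (triangle₆-arith (d r C₁) (E r C₁ C₁) (E r X X)
              (trans (d+E C₁ regular) (cong₂ (λ k c → suc k * c) κ≡5 (sym e)))
                  (subst (λ c → E r C₁ C₁ + c ≤ c * c) (sym e) (E-inner r-irrefl C₁)) dC₁+EXX)

-- From a Tutte barrier to the theorem

obstruction-arith : ∀ x s l u c v → x ≡ 4 + s → s + 2 ≤ l → l ≡ u + c → u ≤ v → x ≤ v + (c + 2)
obstruction-arith x s l u c v h₁ h₂ h₃ h₄ =
  by 0 (≤≡ h₁ ⊞ h₂ ⊞ ≤≡ h₃ ⊞ h₄) (solve (x ∷ s ∷ l ∷ u ∷ c ∷ v ∷ []))

pairwise : ∀ {n} {ps : List (Sub n)} → AllPairs Disjoint ps → ∀ {P Q} → P ∈ᴸ ps → Q ∈ᴸ ps → P ≡ Q ⊎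
    Disjoint P Q
pairwise (d AllPairs.∷ ds) (here refl) (here refl) = inj₁ refl
pairwise (d AllPairs.∷ ds) (here refl) (there j)   = inj₂ (All.lookup d j)
pairwise (d AllPairs.∷ ds) (there i)   (here refl) = inj₂ (λ x p q → All.lookup d i x q p)
pairwise (d AllPairs.∷ ds) (there i)   (there j)   = pairwise ds i j

record Sorted {n} (ps : List (Sub n)) : Set where
  field
    small large : List (Sub n)
    small∈      : ∀ {P} → P ∈ᴸ small → P ∈ᴸ ps × # P ≤ 1
    large∈      : ∀ {P} → P ∈ᴸ large → P ∈ᴸ ps × 2 ≤ # P
    lengths     : length small + length large ≡ length ps
    small-disj  : AllPairs Disjoint small
    large-disj  : AllPairs Disjoint large

sort : ∀ {n} (ps : List (Sub n)) → AllPairs Disjoint ps → Sorted ps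
sort [] _ = record { small = [] ; large = [] ; small∈ = λ () ; large∈ = λ () ; lengths = refl
                   ; small-disj = AllPairs.[] ; large-disj = AllPairs.[] }
sort (P ∷ ps) (d AllPairs.∷ ds) with sort ps ds | 2 ≤? # P
... | s | yes p = record
  { small = small ; large = P ∷ large
  ; small∈ = λ i → there (proj₁ (small∈ i)) , proj₂ (small∈ i)
  ; large∈ = λ { (here refl) → here refl , p ; (there i) → there (proj₁ (large∈ i)) , proj₂ (large∈ i) }
  ; lengths = trans (+-suc _ _) (cong suc lengths)
  ; small-disj = small-disj ; large-disj = All.tabulate (λ i → All.lookup d (proj₁ (large∈ i)))
      AllPairs.∷ large-disj }
  where open Sorted s
... | s | no ¬p = record
  { small = P ∷ small ; large = large
  ; small∈ = λ { (here refl) → here refl , s≤s⁻¹ (≰⇒> ¬p) ; (there i) → there (proj₁ (small∈ i)) ,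
      proj₂ (small∈ i) }
  ; large∈ = λ i → there (proj₁ (large∈ i)) , proj₂ (large∈ i)
  ; lengths = cong suc lengths
  ; small-disj = All.tabulate (λ i → All.lookup d (proj₁ (small∈ i))) AllPairs.∷ small-disj ;
      large-disj = large-disj }
  where open Sorted s

⋃-length : ∀ {n} (ps : List (Sub n)) → AllPairs Disjoint ps → (∀ {P} → P ∈ᴸ ps → 1 ≤ # P) → length
    ps ≤ # (⋃ ps)
⋃-length [] _ _ = z≤n
⋃-length (P ∷ ps) (d AllPairs.∷ ds) h = ≤-trans (h (here refl) ⊞ ⋃-length ps ds (λ i → h (there i)))
  (≥≡ (disjoint-∪ P (⋃ ps) (disjoint-⋃ d)))

interpolate : ∀ {n} j {m} (A B : Sub n) → A ⊆ B → # A + j ≡ m → m ≤ # B → Σ[ S ∈ Sub n ] A ⊆ S × S ⊆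
    B × # S ≡ m
interpolate zero A B h e le = A , (λ _ p → p) , h , trans (sym (+-identityʳ _)) e
interpolate (suc j) {m} A B h e le with empty? (B ∖ A)
... | inj₂ none = ⊥-elim (n≮n _ (≤-trans (≤-trans (arith (# A) j m e) le) (#-mono {A = B} {A} λ x p → case bool? (A x) of λ where
        (inj₁ q) → q
        (inj₂ q) → ⊥-elim (true≢false (∧⁺ p (not⁺ q)) (none x)))))
  where
  arith : ∀ a j m → a + suc j ≡ m → suc a ≤ m
  arith a j m e = ≤-trans (s≤s (m≤m+n a j)) (≤≡ (trans (sym (+-suc a j)) e))
... | inj₁ (y , p) with interpolate j (A ∪ ⁅ y ⁆) B
    (λ x q → [ h x , (λ s → subst (_∈ B) (∈⁅⁆⇒≡ s) (proj₁ (∧⁻ p))) ]′ (∨⁻ {A x} q))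
                          (trans (cong (_+ j) (#-insert (not⁻ (proj₂ (∧⁻ {B y} p)))))
                              (trans (sym (+-suc _ j)) e)) le
...   | S , A⊆S , S⊆B , eq = S , (λ x q → A⊆S x (∨⁺ˡ q)) , S⊆B , eq

#-lookup : ∀ {n} (p : Subset n) → # (lookupⱽ p) ≡ card p
#-lookup Vec.[] = trans (#-def _) (∑-nil _)
#-lookup (b Vec.∷ p) = trans (#-def _) (trans (∑-suc _) (lem b (trans (sym (#-def _)) (#-lookup p))))
  where
  lem : ∀ b {m} → m ≡ card p → ⟦ b ⟧ + m ≡ card (b Vec.∷ p)
  lem true  e = cong suc e
  lem false e = e

-- The nonmembership proof in a `Refinement` is irrelevant, but it may still be used to reach an
-- absurdity.
refute : ∀ {A : Set} → Irrelevant (¬ A) → A → ⊥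
refute [ f ] a = ⊥-elim-irr (f a)

module _ {n : ℕ} (G : Graph (Fin n)) where
  open Graph G

  adj : Rel n
  adj x y = does (x ~? y)

  adj⁺ : ∀ {x y} → x ~ y → adj x y ≡ true
  adj⁺ {x} {y} p = dec-true (x ~? y) p

  adj⁻ : ∀ {x y} → adj x y ≡ true → x ~ y
  adj⁻ {x} {y} e with x ~? y
  ... | yes p = p

  adj-sym : Symm adj
  adj-sym x y = bool-ext (λ p → adj⁺ (~-sym (adj⁻ p))) (λ p → adj⁺ (~-sym (adj⁻ p)))

  adj-irrefl : ∀ x → adj x x ≡ false
  adj-irrefl x = ≡false λ p → ~-irrefl refl (adj⁻ p)

  degree≡ : ∀ x → # (adj x) ≡ degree G x
  degree≡ x = trans (#-cong (λ y → sym (lookup∘tabulate (λ y → does (x ~? y)) y)))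
      (#-lookup (neighbours G x))

  Aut : Permutation′ n → Set
  Aut φ = ∀ x y → adj (φ ⟨$⟩ʳ x) (φ ⟨$⟩ʳ y) ≡ adj x y

  Aut-flip : ∀ {φ} → Aut φ → Aut (flip φ)
  Aut-flip {φ} a x y = trans (sym (a (φ ⟨$⟩ˡ x) (φ ⟨$⟩ˡ y))) (cong₂ adj (inverseʳ φ) (inverseʳ φ))

  Aut-∘ : ∀ {φ ψ} → Aut φ → Aut ψ → Aut (φ ∘ₚ ψ)
  Aut-∘ {φ} a b x y = trans (b (φ ⟨$⟩ʳ x) (φ ⟨$⟩ʳ y)) (a x y)

  automorphism : ∀ {φ} → IsAutomorphism G φ → Aut φ
  automorphism a x y = bool-ext (λ p → adj⁺ (Equivalence.from (a x y) (adj⁻ p)))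
      (λ p → adj⁺ (Equivalence.to (a x y) (adj⁻ p)))

  closed⇒all : Connected G → ∀ F → Nonempty F → (∀ x y → x ∈ F → adj x y ≡ true → y ∈ F) → ∀ x → x ∈ F
  closed⇒all conn F (x₀ , p) h x = walk (conn x₀ x) p
    where
    walk : ∀ {x y} → Star _~_ x y → x ∈ F → y ∈ F
    walk ε        p = p
    walk (w ◅ ws) p = walk ws (h _ _ p (adj⁺ w))

  open Tutte adj adj-sym adj-irrefl

  matching⇒perfect : (S : Subset n) → Matching (∁ (lookupⱽ S)) → PerfectMatching (remove G S)
  matching⇒perfect S M = record
    { M           = λ x y → mate (value x) ≡ value y
    ; M-sym       = λ {x} {y} e → trans (cong mate (sym e)) (involutive (value x) (kept x))
    ; M⊆E         = λ {x} {y} e → adj⁻ (trans (cong (adj (value x)) (sym e)) (adjacent (value x) (kept x)))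
    ; nonadjacent = λ {x} {y} {z} e e′ → equal (trans (sym e) e′)
    ; covering    = λ x → (mate (value x) ,ᴿ
        [ (λ p → true≢false ([]=⇒lookup p) (not⁻ (mate∈ (value x) (kept x)))) ]) , refl
    }
    where
    open Matching M
    kept : (x : Refinement (Fin n) (_∉ˢ S)) → value x ∈ ∁ (lookupⱽ S)
    kept x = not⁺ (≡false λ p → refute (proof x) (lookup⇒[]= (value x) S p))
    equal : {x y : Refinement (Fin n) (_∉ˢ S)} → value x ≡ value y → x ≡ y
    equal refl = refl

  -- A vertex `x` of degree at most 4 becomes isolated when its neighbours, completed to four
  -- vertices other than `x`, are removed.
  isolated : ∀ {k} → Regular G k → 6 ≤ n → (∀ (S : Subset n) → card S ≡ 4 → PerfectMatching
      (remove G S)) → 5 ≤ k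
  isolated {k} reg 6≤n pm with 5 ≤? k
  ... | yes p = p
  ... | no ¬p = ⊥-elim (stuck (interpolate (4 ∸ k) {4} (adj x) (∁ ⁅ x ⁆)
      (λ y w → not⁺ (≢⇒∉⁅⁆ {x = x} {y} λ { refl → true≢false w (adj-irrefl x) }))
        (trans (cong (_+ (4 ∸ k)) (trans (degree≡ x) (reg x))) (m+[n∸m]≡n (s≤s⁻¹ (≰⇒> ¬p))))
            (arith (# (∁ ⁅ x ⁆)) (trans (cong (_+ # (∁ ⁅ x ⁆)) (sym (#⁅ x ⁆))) (#∁ ⁅ x ⁆)))))
    where
    x : Fin n
    x = proj₁ (nonempty {n} full (≤-trans (s≤s z≤n) (≤-trans 6≤n (≥≡ (#full n)))))
    arith : ∀ b → 1 + b ≡ n → 4 ≤ b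
    arith b e = s≤s⁻¹ (≤-trans (n≤1+n 5) (≤-trans 6≤n (≥≡ e)))
    stuck : Σ[ S ∈ Sub n ] adj x ⊆ S × S ⊆ ∁ ⁅ x ⁆ × # S ≡ 4 → ⊥
    stuck (S , N⊆S , S⊆ , #S) = refute (proof y)
        (lookup⇒[]= (value y) S′ (trans (lookup∘tabulate S (value y))
        (N⊆S (value y) (adj⁺ (PerfectMatching.M⊆E P (proj₂ (PerfectMatching.covering P x′)))))))
      where
      S′ : Subset n
      S′ = tabulate S
      P : PerfectMatching (remove G S′)
      P = pm S′ (trans (sym (#-lookup S′)) (trans (#-cong (lookup∘tabulate S)) #S))
      x′ : Refinement (Fin n) (_∉ˢ S′)
      x′ = x ,ᴿ [ (λ p → true≢false (x∈⁅x⁆ x)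
          (not⁻ (S⊆ x (trans (sym (lookup∘tabulate S x)) ([]=⇒lookup p))))) ]
      y : Refinement (Fin n) (_∉ˢ S′)
      y = proj₁ (PerfectMatching.covering P x′)

  module _ (κ : ℕ) (4≤κ : 4 ≤ κ) (conn : Connected G) (vt : VertexTransitive G) (nonbip : ¬ Bipartite G)
    (reg : Regular G (suc κ)) (even : Even n) where

    transitive : ∀ x y → ∃[ φ ] Aut φ × φ ⟨$⟩ʳ x ≡ y
    transitive x y = let φ , a , e = vt x y in φ , automorphism {φ} a , e

    homogeneous : Homogeneous n
    homogeneous = record
      { symmetry = record { Aut = Aut ; Aut-flip = λ {φ} → Aut-flip {φ} ; Aut-∘ = λ {φ} {ψ} → Aut-∘
          {φ} {ψ} ; transitive = transitive }
      ; r = adj ; r-sym = adj-sym ; r-inv = λ φ a → a ; κ = κ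
      ; regular = λ x → trans (degree≡ x) (reg x)
      ; connected = closed⇒all conn
      ; nonbipartite = λ F h → nonbip (F , λ {x} {y} w → h x y (adj⁺ w)) }

    open Core homogeneous adj-irrefl even using (Obstruction; obstruction-⊥)

    -- `X` adds the four removed vertices to the barrier set, whose surplus is 2; the difference is
    -- the 2 in the bound on `# X`. An odd part with more than one vertex has at least three.
    obstruction : (S : Sub n) → # S ≡ 4 → Barrier (∁ S) 2 → ∃[ Cs ] Obstruction Cs
    obstruction S #S b = large , record
      { X = X ; U = U
      ; U∩X = λ x p → let P , i , q = ⋃⁻ small p in part∩X (proj₁ (small∈ i)) x q
      ; U-closed = λ x y p w → let P , i , q = ⋃⁻ small p in
          [ (λ s → ⊥-elim (lonely (proj₂ (small∈ i)) q s w)) , (λ s → s) ]′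
              (part-closed (proj₁ (small∈ i)) x y q w)
      ; big = All.tabulate λ i → three (proj₂ (large∈ i)) (Part.odd (All.lookup good (proj₁ (large∈ i))))
      ; odd = All.tabulate λ i → Part.odd (All.lookup good (proj₁ (large∈ i)))
      ; C∩X = All.tabulate λ i → part∩X (proj₁ (large∈ i))
      ; C∩U = All.tabulate λ i x p q → let P , j , s = ⋃⁻ small q in
          case pairwise disjoint (proj₁ (large∈ i)) (proj₁ (small∈ j)) of λ where
            (inj₁ refl) → n≮n 1 (≤-trans (proj₂ (large∈ i)) (proj₂ (small∈ j)))
            (inj₂ h) → h x p s
      ; C-closed = All.tabulate λ i → part-closed (proj₁ (large∈ i))
      ; disjoint = large-disj
      ; 4≤X = ≤-trans (m≤m+n 4 _) (≥≡ #X)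
      ; bound = obstruction-arith (# X) (# b.S) (length parts) (length small) (length large) (# U)
          #X bound (sym lengths)
          (⋃-length small small-disj λ i → one (# _) (Part.odd (All.lookup good (proj₁ (small∈ i)))))
      }
      where
      module b = Barrier b
      open b using (parts; good; disjoint; bound)
      open Sorted (sort parts disjoint)
      X U : Sub n
      X = S ∪ b.S
      U = ⋃ small
      #X : # X ≡ 4 + # b.S
      #X = trans (disjoint-∪ S b.S (λ x p q → true≢false p (not⁻ (b.S⊆W x q)))) (cong (_+ # b.S) #S)
      part∩X : ∀ {P} → P ∈ᴸ parts → Disjoint P X
      part∩X i x p q = [ (λ s → true≢false s (not⁻ (Part.P⊆W (All.lookup good i) x p))) , Part.P∩S
          (All.lookup good i) x p ]′ (∨⁻ {S x} q)
      part-closed : ∀ {P} → P ∈ᴸ parts → ∀ x y → x ∈ P → adj x y ≡ true → y ∈ P ⊎ y ∈ X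
      part-closed i x y p w with bool? (S y)
      ... | inj₁ s = inj₂ (∨⁺ˡ s)
      ... | inj₂ s = [ inj₁ , (λ t → inj₂ (∨⁺ʳ {S y} t)) ]′
          (Part.closed (All.lookup good i) x y p (not⁺ s) w)
      lonely : ∀ {P x y} → # P ≤ 1 → x ∈ P → y ∈ P → adj x y ≡ true → ⊥
      lonely {P} {x} {y} le p q w = n≮n 1
          (≤-trans (s≤s (∈⇒1≤ {A = P ∖ ⁅ x ⁆} {y}
          (∧⁺ q (not⁺ (≢⇒∉⁅⁆ {x = x} {y} λ { refl → true≢false w (adj-irrefl x) })))))
        (≤-trans (≥≡ (#-remove p)) le))
      one : ∀ m → Even (suc m) → 1 ≤ m
      one zero    e = ⊥-elim (¬even-suc even-0 e)
      one (suc m) e = s≤s z≤n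
      three : ∀ {m} → 2 ≤ m → Even (suc m) → 3 ≤ m
      three {suc (suc zero)} _ e = ⊥-elim (¬even-suc (even⁺ 1 refl) e)
      three {suc (suc (suc m))} _ e = s≤s (s≤s (s≤s z≤n))
      three {suc zero} (s≤s ()) e

    four-critical : (S : Subset n) → card S ≡ 4 → PerfectMatching (remove G S)
    four-critical S eq with tutte _ (∁ (lookupⱽ S)) ≤-refl
    ... | inj₁ M = matching⇒perfect S M
    ... | inj₂ b = ⊥-elim (obstruction-⊥ 4≤κ (proj₂ (obstruction (lookupⱽ S) #S (strengthen even-W b))))
      where
      #S : # (lookupⱽ S) ≡ 4
      #S = trans (#-lookup S) eq
      even-W : Even (# (∁ (lookupⱽ S)))
      even-W = even-+⁻ (subst Even (trans (sym (#∁ (lookupⱽ S))) (+-comm (# (lookupⱽ S)) _)) even)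
          (even⁺ 2 #S)

theorem1p2 : ∀ (n k : ℕ) (G : Graph (Fin n)) →
    Connected G → VertexTransitive G → ¬ Bipartite G → Regular G k →
    2 ∣ n → n ≥ 6 →
    FactorCritical G 4 ⇔ (k ≥ 5)
theorem1p2 n k G conn vt nonbip reg (divides q n≡) 6≤n = mk⇔
  (λ fc → isolated G reg 6≤n (proj₂ fc))
  (λ { (s≤s {n = κ} 4≤κ) → sym (n∣m⇒m%n≡0 n 2 (divides q n≡)) ,
       four-critical G κ 4≤κ conn vt nonbip reg
           (even⁺ q (trans n≡ (trans (*-comm q 2) (cong (q +_) (+-identityʳ q))))) })
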